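{- Let $K=\mathbb{Q}(\sqrt{ -d})$ with $d\in\{2,7,11,19,43,67,163\}$ (i.e. $K$ is an imaginary quadratic field of class number $1$ with $d\neq 1,3$). Let $L=\mathcal{O}_K=\mathbb{Z}+\mathbb{Z}\theta_d\subset\mathbb{C}\cong\mathbb{R}^2$ be the lattice of algebraic integers of $K$, where $\theta_d=\sqrt{ -d}$ if $-d\equiv 2,3\pmod 4$ and $\theta_d=\frac{1+\sqrt{ -d}}{2}$ if $-d\equiv 1\pmod 4$. Then for every $m>0$ such that the shell $L_m=\{x\in L: |x|^2=m\}$ is nonempty, $L_m$ is not a spherical $2$-design.
   Context: A finite nonempty set $X\subset S^{n-1}$ is a spherical $t$-design if $\frac{1}{|X|}\sum_{x\in X}f(x)=\frac{1}{|S^{n-1}|}\int_{S^{n-1}}f\,d\sigma$ for all polynomials $f$ of degree at most $t$; a finite nonempty subset $X$ of the sphere of radius $r$ is a spherical $t$-design if $\frac{1}{r}X$ is one. (For $n=2$, a finite set $\{\xi_1,\dots,\xi_N\}$ on the unit circle in $\mathbb{C}$ is a spherical $t$-design iff $\sum_i\xi_i^k=0$ for $k=1,\dots,t$.) -}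

module Defs where

open import Data.Bool using (if_then_else_)
open import Data.Integer as ℤ using (ℤ; +_; -[1+_])
import Data.Integer.Properties as ℤ
open import Data.Integer.DivMod using (_%ℕ_)
open import Data.List using (List; _∷_; length; map; foldr; applyUpTo)
open import Data.Nat as ℕ using (ℕ; zero; suc)
import Data.Nat.Properties as ℕ
import Data.Nat.Solver as ℕ
open import Data.Product using (Σ; ∃-syntax; _×_; _,_)
open import Data.Product.Relation.Binary.Pointwise.NonDependent using (×-setoid)
open import Data.Rational as ℚ using (ℚ; mkℚ; 0ℚ; 1ℚ; ½; ∣_∣)
import Data.Rational.Properties as ℚ
import Data.Rational.Unnormalised as ℚᵘ
import Data.Rational.Unnormalised.Properties as ℚᵘ
import Data.Rational.Solver as ℚ
open import Data.Sum using (inj₁; inj₂)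
open import Function.Bundles using (_⇔_)
open import Relation.Binary.Bundles using (Setoid)
open import Relation.Binary.PropositionalEquality using (_≡_; refl; sym; trans; cong; cong₂; subst; subst₂)
open import Relation.Nullary using (yes; no)
open import Relation.Nullary.Decidable using (⌊_⌋)
import Data.List.Membership.Setoid as Membership
import Data.List.Relation.Unary.Unique.Setoid as Uniqueness

------------------------------------------------------------------------
-- Real numbers: Cauchy sequences of rationals up to _≃_

module _ where
  open ℚ.+-*-Solver

  split : ∀ x y z → (x ℚ.- y) ℚ.+ (y ℚ.- z) ≡ x ℚ.- z
  split = solve 3 (λ x y z → (x :- y) :+ (y :- z) := x :- z) refl

  +-split : ∀ x y u v → (x ℚ.- y) ℚ.+ (u ℚ.- v) ≡ (x ℚ.+ u) ℚ.- (y ℚ.+ v)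
  +-split = solve 4 (λ x y u v → (x :- y) :+ (u :- v) := (x :+ u) :- (y :+ v)) refl

  *-split : ∀ x y u v → x ℚ.* (u ℚ.- v) ℚ.+ v ℚ.* (x ℚ.- y) ≡ x ℚ.* u ℚ.- y ℚ.* v
  *-split = solve 4 (λ x y u v → x :* (u :- v) :+ v :* (x :- y) := x :* u :- y :* v) refl

  minus-swap : ∀ x y → y ℚ.- x ≡ ℚ.- (x ℚ.- y)
  minus-swap = solve 2 (λ x y → y :- x := :- (x :- y)) refl

  minus-neg : ∀ x y → (ℚ.- x) ℚ.- (ℚ.- y) ≡ ℚ.- (x ℚ.- y)
  minus-neg = solve 2 (λ x y → (:- x) :- (:- y) := :- (x :- y)) refl

  add-back : ∀ x y → (x ℚ.- y) ℚ.+ y ≡ x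
  add-back = solve 2 (λ x y → (x :- y) :+ y := x) refl

  cancel-left : ∀ x y → (x ℚ.+ y) ℚ.- x ≡ y
  cancel-left = solve 2 (λ x y → (x :+ y) :- x := y) refl

  inv-regroup : ∀ i j u v → (i ℚ.- j) ℚ.* (u ℚ.* v) ≡ (i ℚ.* u) ℚ.* v ℚ.- (j ℚ.* v) ℚ.* u
  inv-regroup = solve 4 (λ i j u v → (i :- j) :* (u :* v) := (i :* u) :* v :- (j :* v) :* u) refl

  half-regroup : ∀ b i e → b ℚ.* (i ℚ.* (½ ℚ.* e)) ≡ (i ℚ.* b) ℚ.* (½ ℚ.* e)
  half-regroup = solve 3 (λ b i e → b :* (i :* (con ½ :* e)) := (i :* b) :* (con ½ :* e)) refl

  halves : ∀ e → ½ ℚ.* e ℚ.+ ½ ℚ.* e ≡ e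
  halves = solve 1 (λ e → con ½ :* e :+ con ½ :* e := e) refl

∣-∣-swap : ∀ x y → ∣ y ℚ.- x ∣ ≡ ∣ x ℚ.- y ∣
∣-∣-swap x y = trans (cong ∣_∣ (minus-swap x y)) (ℚ.∣-p∣≡∣p∣ (x ℚ.- y))

0<½* : ∀ {e} → 0ℚ ℚ.< e → 0ℚ ℚ.< ½ ℚ.* e
0<½* {e} 0<e = ℚ.positive⁻¹ (½ ℚ.* e) {{ℚ.pos*pos⇒pos ½ e {{ℚ.positive 0<e}}}}

pos-+-nonneg : ∀ {x y} → 0ℚ ℚ.< x → 0ℚ ℚ.≤ y → 0ℚ ℚ.< x ℚ.+ y
pos-+-nonneg {x} {y} 0<x 0≤y = subst (ℚ._< x ℚ.+ y) (ℚ.+-identityˡ 0ℚ) (ℚ.+-mono-<-≤ 0<x 0≤y)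

triangle : ∀ {e} x y z → ∣ x ℚ.- y ∣ ℚ.< ½ ℚ.* e → ∣ y ℚ.- z ∣ ℚ.< ½ ℚ.* e → ∣ x ℚ.- z ∣ ℚ.< e
triangle {e} x y z p q = subst₂ ℚ._<_ (cong ∣_∣ (split x y z)) (halves e)
  (ℚ.≤-<-trans (ℚ.∣p+q∣≤∣p∣+∣q∣ (x ℚ.- y) (y ℚ.- z)) (ℚ.+-mono-< p q))

*-mono-≤-< : ∀ {a b c d} → 0ℚ ℚ.≤ c → 0ℚ ℚ.< b → a ℚ.≤ b → c ℚ.< d → a ℚ.* c ℚ.< b ℚ.* d
*-mono-≤-< {a} {b} {c} {d} 0≤c 0<b a≤b c<d = ℚ.≤-<-trans
  (ℚ.*-monoʳ-≤-nonNeg c {{ℚ.nonNegative 0≤c}} a≤b)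
  (ℚ.*-monoʳ-<-pos b {{ℚ.positive 0<b}} c<d)

record ℝ : Set where
  constructor mkℝ
  field
    seq    : ℕ → ℚ
    cauchy : ∀ ε → 0ℚ ℚ.< ε → ∃[ N ] (∀ m n → N ℕ.≤ m → N ℕ.≤ n → ∣ seq m ℚ.- seq n ∣ ℚ.< ε)

open ℝ public

infix  4 _≃_ _<_ _⟶_
infixl 6 _+_ _-_
infixl 7 _*_
infix  8 -_
infixr 8 _^_

_≃_ : ℝ → ℝ → Set
x ≃ y = ∀ ε → 0ℚ ℚ.< ε → ∃[ N ] (∀ n → N ℕ.≤ n → ∣ seq x n ℚ.- seq y n ∣ ℚ.< ε)

_<_ : ℝ → ℝ → Set
x < y = ∃[ ε ] (0ℚ ℚ.< ε × ∃[ N ] (∀ n → N ℕ.≤ n → seq x n ℚ.+ ε ℚ.< seq y n))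

≃-refl : ∀ {x} → x ≃ x
≃-refl {x} ε 0<ε = 0 , λ n _ → subst (ℚ._< ε) (sym (cong ∣_∣ (ℚ.+-inverseʳ (seq x n)))) 0<ε

≃-sym : ∀ {x y} → x ≃ y → y ≃ x
≃-sym {x} {y} x≃y ε 0<ε with x≃y ε 0<ε
... | N , h = N , λ n N≤n → subst (ℚ._< ε) (sym (∣-∣-swap (seq x n) (seq y n))) (h n N≤n)

≃-trans : ∀ {x y z} → x ≃ y → y ≃ z → x ≃ z
≃-trans {x} {y} {z} x≃y y≃z ε 0<ε with x≃y (½ ℚ.* ε) (0<½* 0<ε) | y≃z (½ ℚ.* ε) (0<½* 0<ε)
... | M , g | N , h = M ℕ.⊔ N , λ n le →
  triangle (seq x n) (seq y n) (seq z n) (g n (ℕ.≤-trans (ℕ.m≤m⊔n M N) le)) (h n (ℕ.≤-trans (ℕ.m≤n⊔m M N) le))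

ℝ-setoid : Setoid _ _
ℝ-setoid = record
  { Carrier = ℝ
  ; _≈_ = _≃_
  ; isEquivalence = record
    { refl  = λ {x} → ≃-refl {x}
    ; sym   = λ {x} {y} → ≃-sym {x} {y}
    ; trans = λ {x} {y} {z} → ≃-trans {x} {y} {z}
    }
  }

fromℚ : ℚ → ℝ
fromℚ q = mkℝ (λ _ → q) proof
  where
  abstract
    proof : ∀ ε → 0ℚ ℚ.< ε → ∃[ N ] (∀ m n → N ℕ.≤ m → N ℕ.≤ n → ∣ q ℚ.- q ∣ ℚ.< ε)
    proof ε 0<ε = 0 , λ _ _ _ _ → subst (ℚ._< ε) (sym (cong ∣_∣ (ℚ.+-inverseʳ q))) 0<ε

fromℤ : ℤ → ℝ
fromℤ a = fromℚ (a ℚ./ 1)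

0ℝ 1ℝ : ℝ
0ℝ = fromℚ 0ℚ
1ℝ = fromℚ 1ℚ

_+_ : ℝ → ℝ → ℝ
x + y = mkℝ (λ n → seq x n ℚ.+ seq y n) proof
  where
  abstract
    proof : ∀ ε → 0ℚ ℚ.< ε → ∃[ N ] (∀ m n → N ℕ.≤ m → N ℕ.≤ n → ∣ (seq x m ℚ.+ seq y m) ℚ.- (seq x n ℚ.+ seq y n) ∣ ℚ.< ε)
    proof ε 0<ε with cauchy x (½ ℚ.* ε) (0<½* 0<ε) | cauchy y (½ ℚ.* ε) (0<½* 0<ε)
    ... | M , g | N , h = M ℕ.⊔ N , λ m n p q → subst₂ ℚ._<_
      (cong ∣_∣ (+-split (seq x m) (seq x n) (seq y m) (seq y n))) (halves ε)
      (ℚ.≤-<-trans (ℚ.∣p+q∣≤∣p∣+∣q∣ (seq x m ℚ.- seq x n) (seq y m ℚ.- seq y n))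
        (ℚ.+-mono-< (g m n (ℕ.≤-trans (ℕ.m≤m⊔n M N) p) (ℕ.≤-trans (ℕ.m≤m⊔n M N) q))
                    (h m n (ℕ.≤-trans (ℕ.m≤n⊔m M N) p) (ℕ.≤-trans (ℕ.m≤n⊔m M N) q))))

-_ : ℝ → ℝ
- x = mkℝ (λ n → ℚ.- seq x n) proof
  where
  abstract
    proof : ∀ ε → 0ℚ ℚ.< ε → ∃[ N ] (∀ m n → N ℕ.≤ m → N ℕ.≤ n → ∣ (ℚ.- seq x m) ℚ.- (ℚ.- seq x n) ∣ ℚ.< ε)
    proof ε 0<ε with cauchy x ε 0<ε
    ... | N , h = N , λ m n p q → subst (ℚ._< ε)
      (sym (trans (cong ∣_∣ (minus-neg (seq x m) (seq x n))) (ℚ.∣-p∣≡∣p∣ (seq x m ℚ.- seq x n)))) (h m n p q)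

_-_ : ℝ → ℝ → ℝ
x - y = x + (- y)

bounded : ∀ x → ∃[ B ] (0ℚ ℚ.< B × ∃[ N ] (∀ n → N ℕ.≤ n → ∣ seq x n ∣ ℚ.≤ B))
bounded x with cauchy x 1ℚ (ℚ.positive⁻¹ 1ℚ)
... | N , h = 1ℚ ℚ.+ ∣ seq x N ∣ , pos-+-nonneg (ℚ.positive⁻¹ 1ℚ) (ℚ.0≤∣p∣ (seq x N)) , N , λ n N≤n →
  subst (λ z → ∣ z ∣ ℚ.≤ 1ℚ ℚ.+ ∣ seq x N ∣) (add-back (seq x n) (seq x N))
    (ℚ.≤-trans (ℚ.∣p+q∣≤∣p∣+∣q∣ (seq x n ℚ.- seq x N) (seq x N))
      (ℚ.+-monoˡ-≤ ∣ seq x N ∣ (ℚ.<⇒≤ (h n N N≤n ℕ.≤-refl))))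

_*_ : ℝ → ℝ → ℝ
x * y = mkℝ (λ n → seq x n ℚ.* seq y n) proof
  where
  η : (B : ℚ) → 0ℚ ℚ.< B → ℚ → ℚ
  η B 0<B ε = (ℚ.1/ B) {{ℚ.pos⇒nonZero B {{ℚ.positive 0<B}}}} ℚ.* (½ ℚ.* ε)

  0<η : ∀ B 0<B ε → 0ℚ ℚ.< ε → 0ℚ ℚ.< η B 0<B ε
  0<η B 0<B ε 0<ε = ℚ.positive⁻¹ (η B 0<B ε)
    {{ℚ.pos*pos⇒pos ((ℚ.1/ B) {{nz}}) {{ℚ.1/pos⇒pos B {{ℚ.positive 0<B}}}} (½ ℚ.* ε) {{ℚ.positive (0<½* 0<ε)}}}}
    where
    nz : ℚ.NonZero B
    nz = ℚ.pos⇒nonZero B {{ℚ.positive 0<B}}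

  factor-< : ∀ B 0<B ε a c → ∣ a ∣ ℚ.≤ B → ∣ c ∣ ℚ.< η B 0<B ε → ∣ a ℚ.* c ∣ ℚ.< ½ ℚ.* ε
  factor-< B 0<B ε a c a≤B c<η = subst₂ ℚ._<_ (sym (ℚ.∣p*q∣≡∣p∣*∣q∣ a c))
    (trans (half-regroup B ((ℚ.1/ B) {{nz}}) ε)
      (trans (cong (ℚ._* (½ ℚ.* ε)) (ℚ.*-inverseˡ B {{nz}})) (ℚ.*-identityˡ (½ ℚ.* ε))))
    (*-mono-≤-< (ℚ.0≤∣p∣ c) 0<B a≤B c<η)
    where
    nz : ℚ.NonZero B
    nz = ℚ.pos⇒nonZero B {{ℚ.positive 0<B}}

  combine : ∀ ε a b c d → ∣ a ℚ.* (c ℚ.- d) ∣ ℚ.< ½ ℚ.* ε → ∣ d ℚ.* (a ℚ.- b) ∣ ℚ.< ½ ℚ.* ε →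
            ∣ a ℚ.* c ℚ.- b ℚ.* d ∣ ℚ.< ε
  combine ε a b c d p q = subst₂ ℚ._<_ (cong ∣_∣ (*-split a b c d)) (halves ε)
    (ℚ.≤-<-trans (ℚ.∣p+q∣≤∣p∣+∣q∣ (a ℚ.* (c ℚ.- d)) (d ℚ.* (a ℚ.- b))) (ℚ.+-mono-< p q))

  abstract
    proof : ∀ ε → 0ℚ ℚ.< ε → ∃[ N ] (∀ m n → N ℕ.≤ m → N ℕ.≤ n → ∣ seq x m ℚ.* seq y m ℚ.- seq x n ℚ.* seq y n ∣ ℚ.< ε)
    proof ε 0<ε =
      let (B , 0<B , K , b) = bounded x
          (C , 0<C , L , c) = bounded y
          (M , g) = cauchy x (η C 0<C ε) (0<η C 0<C ε 0<ε)
          (N , h) = cauchy y (η B 0<B ε) (0<η B 0<B ε 0<ε)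
          KL = K ℕ.⊔ L
          MN = M ℕ.⊔ N
          ≤KL = λ {m} (p : KL ℕ.⊔ MN ℕ.≤ m) → ℕ.≤-trans (ℕ.m≤m⊔n KL MN) p
          ≤MN = λ {m} (p : KL ℕ.⊔ MN ℕ.≤ m) → ℕ.≤-trans (ℕ.m≤n⊔m KL MN) p
      in KL ℕ.⊔ MN , λ m n p q → combine ε (seq x m) (seq x n) (seq y m) (seq y n)
        (factor-< B 0<B ε (seq x m) (seq y m ℚ.- seq y n) (b m (ℕ.≤-trans (ℕ.m≤m⊔n K L) (≤KL p)))
          (h m n (ℕ.≤-trans (ℕ.m≤n⊔m M N) (≤MN p)) (ℕ.≤-trans (ℕ.m≤n⊔m M N) (≤MN q))))
        (factor-< C 0<C ε (seq y n) (seq x m ℚ.- seq x n) (c n (ℕ.≤-trans (ℕ.m≤n⊔m K L) (≤KL q)))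
          (g m n (ℕ.≤-trans (ℕ.m≤m⊔n M N) (≤MN p)) (ℕ.≤-trans (ℕ.m≤m⊔n M N) (≤MN q))))

_^_ : ℝ → ℕ → ℝ
x ^ zero  = 1ℝ
x ^ suc n = x * x ^ n

-- The inverse of a positive real x. A positive lower bound δ of the tail of
-- the sequence x is part of the proof of 0 < x; taking the maximum with δ
-- only changes terms outside that tail and keeps every term invertible.
inv : (x : ℝ) → 0ℝ < x → ℝ
inv x (δ , 0<δ , K , tail) = mkℝ (λ n → iv n) proof
  where
  instance
    δ-pos : ℚ.Positive δ
    δ-pos = ℚ.positive 0<δ

  u : ℕ → ℚ
  u n = δ ℚ.⊔ seq x n

  δ≤u : ∀ n → δ ℚ.≤ u n
  δ≤u n = ℚ.p≤p⊔q δ (seq x n)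

  u-pos : ∀ n → ℚ.Positive (u n)
  u-pos n = ℚ.positive (ℚ.<-≤-trans 0<δ (δ≤u n))

  u-tail : ∀ n → K ℕ.≤ n → u n ≡ seq x n
  u-tail n K≤n = ℚ.p≤q⇒p⊔q≡q (subst (ℚ._≤ seq x n) (ℚ.+-identityˡ δ) (ℚ.<⇒≤ (tail n K≤n)))

  iv : ℕ → ℚ
  iv n = (ℚ.1/ u n) {{ℚ.pos⇒nonZero (u n) {{u-pos n}}}}

  iv-u : ∀ n → iv n ℚ.* u n ≡ 1ℚ
  iv-u n = ℚ.*-inverseˡ (u n) {{ℚ.pos⇒nonZero (u n) {{u-pos n}}}}

  δδ-pos : ℚ.Positive (δ ℚ.* δ)
  δδ-pos = ℚ.pos*pos⇒pos δ δ

  δδ≤uu : ∀ m n → δ ℚ.* δ ℚ.≤ u m ℚ.* u n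
  δδ≤uu m n = ℚ.≤-trans
    (ℚ.*-monoʳ-≤-nonNeg δ {{ℚ.pos⇒nonNeg δ}} (δ≤u m))
    (ℚ.*-monoˡ-≤-nonNeg (u m) {{ℚ.pos⇒nonNeg (u m) {{u-pos m}}}} (δ≤u n))

  difference : ∀ m n → (iv m ℚ.- iv n) ℚ.* (u m ℚ.* u n) ≡ u n ℚ.- u m
  difference m n = trans (inv-regroup (iv m) (iv n) (u m) (u n))
    (cong₂ ℚ._-_ (trans (cong (ℚ._* u n) (iv-u m)) (ℚ.*-identityˡ (u n)))
                 (trans (cong (ℚ._* u m) (iv-u n)) (ℚ.*-identityˡ (u m))))

  ∣difference∣ : ∀ m n → ∣ iv m ℚ.- iv n ∣ ℚ.* (u m ℚ.* u n) ≡ ∣ u m ℚ.- u n ∣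
  ∣difference∣ m n = trans
    (cong (∣ iv m ℚ.- iv n ∣ ℚ.*_) (sym (ℚ.0≤p⇒∣p∣≡p (ℚ.≤-trans (ℚ.<⇒≤ (ℚ.positive⁻¹ (δ ℚ.* δ) {{δδ-pos}})) (δδ≤uu m n)))))
    (trans (sym (ℚ.∣p*q∣≡∣p∣*∣q∣ (iv m ℚ.- iv n) (u m ℚ.* u n)))
      (trans (cong ∣_∣ (difference m n)) (∣-∣-swap (u m) (u n))))

  abstract
    proof : ∀ ε → 0ℚ ℚ.< ε → ∃[ N ] (∀ m n → N ℕ.≤ m → N ℕ.≤ n → ∣ iv m ℚ.- iv n ∣ ℚ.< ε)
    proof ε 0<ε with cauchy x (ε ℚ.* (δ ℚ.* δ)) (ℚ.positive⁻¹ _ {{ℚ.pos*pos⇒pos ε {{ℚ.positive 0<ε}} (δ ℚ.* δ) {{δδ-pos}}}})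
    ... | N , h = K ℕ.⊔ N , λ m n p q →
      ℚ.*-cancelʳ-<-nonNeg (δ ℚ.* δ) {{ℚ.pos⇒nonNeg (δ ℚ.* δ) {{δδ-pos}}}}
        (ℚ.≤-<-trans
          (ℚ.*-monoˡ-≤-nonNeg ∣ iv m ℚ.- iv n ∣ {{ℚ.∣-∣-nonNeg (iv m ℚ.- iv n)}} (δδ≤uu m n))
          (subst (ℚ._< ε ℚ.* (δ ℚ.* δ))
            (sym (trans (∣difference∣ m n) (cong₂ (λ a b → ∣ a ℚ.- b ∣)
              (u-tail m (ℕ.≤-trans (ℕ.m≤m⊔n K N) p)) (u-tail n (ℕ.≤-trans (ℕ.m≤m⊔n K N) q)))))
            (h m n (ℕ.≤-trans (ℕ.m≤n⊔m K N) p) (ℕ.≤-trans (ℕ.m≤n⊔m K N) q))))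

_⟶_ : (ℕ → ℝ) → ℝ → Set
u ⟶ l = ∀ ε → 0ℚ ℚ.< ε → ∃[ N ] (∀ n → N ℕ.≤ n → (l - fromℚ ε < u n) × (u n < l + fromℚ ε))

sum : List ℝ → ℝ
sum = foldr _+_ 0ℝ

------------------------------------------------------------------------
-- Square roots of natural numbers

-- ⌊√n⌋. Opaque only to keep the typechecker from evaluating it on large
-- arguments; the two lemmas below characterise it.
opaque
  isqrt : ℕ → ℕ
  isqrt zero    = 0
  isqrt (suc n) = next (isqrt n)
    where
    next : ℕ → ℕ
    next r = if ⌊ suc r ℕ.* suc r ℕ.≤? suc n ⌋ then suc r else r

  isqrt-lower : ∀ n → isqrt n ℕ.* isqrt n ℕ.≤ n
  isqrt-lower zero = ℕ.z≤n
  isqrt-lower (suc n) with suc (isqrt n) ℕ.* suc (isqrt n) ℕ.≤? suc n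
  ... | yes le = le
  ... | no  _  = ℕ.m≤n⇒m≤1+n (isqrt-lower n)

  isqrt-upper : ∀ n → n ℕ.< suc (isqrt n) ℕ.* suc (isqrt n)
  isqrt-upper zero = ℕ.s≤s ℕ.z≤n
  isqrt-upper (suc n) with suc (isqrt n) ℕ.* suc (isqrt n) ℕ.≤? suc n
  ... | yes _  = ℕ.≤-<-trans (isqrt-upper n) (ℕ.*-mono-< (ℕ.n<1+n (suc (isqrt n))) (ℕ.n<1+n (suc (isqrt n))))
  ... | no  ≰  = ℕ.≰⇒> ≰

/-mono-< : ∀ a b m n → a ℕ.* suc n ℕ.< b ℕ.* suc m → + a ℚ./ suc m ℚ.< + b ℚ./ suc n
/-mono-< a b m n lt = ℚ.toℚᵘ-cancel-<
  (ℚᵘ.<-respˡ-≃ (ℚᵘ.≃-sym {ℚ.toℚᵘ (+ a ℚ./ suc m)} (ℚ.toℚᵘ-fromℚᵘ (ℚᵘ.mkℚᵘ (+ a) m)))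
    (ℚᵘ.<-respʳ-≃ (ℚᵘ.≃-sym {ℚ.toℚᵘ (+ b ℚ./ suc n)} (ℚ.toℚᵘ-fromℚᵘ (ℚᵘ.mkℚᵘ (+ b) n)))
      (ℚᵘ.*<* (subst₂ ℤ._<_ (ℤ.pos-* a (suc n)) (ℤ.pos-* b (suc m)) (ℤ.+<+ lt)))))

suc-/ : ∀ a n → + suc a ℚ./ suc n ≡ + 1 ℚ./ suc n ℚ.+ + a ℚ./ suc n
suc-/ a n = ℚ.toℚᵘ-injective (ℚᵘ.≃-trans (ℚ.toℚᵘ-fromℚᵘ (ℚᵘ.mkℚᵘ (+ suc a) n))
  (ℚᵘ.≃-trans (ℚᵘ.*≡* eq)
    (ℚᵘ.≃-sym (ℚᵘ.≃-trans (ℚ.toℚᵘ-homo-+ (+ 1 ℚ./ suc n) (+ a ℚ./ suc n))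
      (ℚᵘ.+-cong (ℚ.toℚᵘ-fromℚᵘ (ℚᵘ.mkℚᵘ (+ 1) n)) (ℚ.toℚᵘ-fromℚᵘ (ℚᵘ.mkℚᵘ (+ a) n)))))))
  where
  N : ℤ
  N = + suc n
  eq : + suc a ℤ.* (N ℤ.* N) ≡ (+ 1 ℤ.* N ℤ.+ + a ℤ.* N) ℤ.* N
  eq = trans (sym (ℤ.*-assoc (+ suc a) N N)) (cong (ℤ._* N) (ℤ.*-distribʳ-+ N (+ 1) (+ a)))

archimedean : ∀ ε → 0ℚ ℚ.< ε → ∃[ N ] (∀ n → N ℕ.≤ n → + 1 ℚ./ suc n ℚ.< ε)
archimedean ε@(mkℚ (+ suc a) b _) 0<ε = suc b , λ n b<n →
  subst (+ 1 ℚ./ suc n ℚ.<_) (ℚ.fromℚᵘ-toℚᵘ ε)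
    (/-mono-< 1 (suc a) n b (subst (ℕ._< suc a ℕ.* suc n) (sym (ℕ.*-identityˡ (suc b)))
      (ℕ.<-≤-trans (ℕ.s≤s b<n) (ℕ.m≤m+n (suc n) (a ℕ.* suc n)))))
archimedean (mkℚ (+ zero) b _) (ℚ.*<* (ℤ.+<+ ()))
archimedean (mkℚ -[1+ a ] b _) (ℚ.*<* ())

√-approx : ℕ → ℕ → ℚ
√-approx k n = + isqrt (k ℕ.* (suc n ℕ.* suc n)) ℚ./ suc n

√-step : ∀ k m n → √-approx k m ℚ.- √-approx k n ℚ.< + 1 ℚ./ suc n
√-step k m n = subst (√-approx k m ℚ.- √-approx k n ℚ.<_)
  (trans (cong (ℚ._- √-approx k n) (ℚ.+-comm (+ 1 ℚ./ suc n) (√-approx k n))) (cancel-left (√-approx k n) (+ 1 ℚ./ suc n)))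
  (ℚ.+-monoˡ-< (ℚ.- √-approx k n)
    (subst (√-approx k m ℚ.<_) (suc-/ q n) (/-mono-< p (suc q) m n pN<qM)))
  where
  open ℕ.+-*-Solver
  M N p q : ℕ
  M = suc m
  N = suc n
  p = isqrt (k ℕ.* (M ℕ.* M))
  q = isqrt (k ℕ.* (N ℕ.* N))

  squares : (p ℕ.* N) ℕ.* (p ℕ.* N) ℕ.< (suc q ℕ.* M) ℕ.* (suc q ℕ.* M)
  squares = subst₂ ℕ._<_
    (solve 2 (λ p N → (p :* p) :* (N :* N) := (p :* N) :* (p :* N)) refl p N)
    (solve 2 (λ q M → (q :* q) :* (M :* M) := (q :* M) :* (q :* M)) refl (suc q) M)
    (ℕ.≤-<-trans (ℕ.*-monoˡ-≤ (N ℕ.* N) (isqrt-lower (k ℕ.* (M ℕ.* M))))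
      (subst (ℕ._< (suc q ℕ.* suc q) ℕ.* (M ℕ.* M))
        (solve 3 (λ k M N → (k :* (N :* N)) :* (M :* M) := (k :* (M :* M)) :* (N :* N)) refl k M N)
        (ℕ.*-monoˡ-< (M ℕ.* M) (isqrt-upper (k ℕ.* (N ℕ.* N))))))

  pN<qM : p ℕ.* N ℕ.< suc q ℕ.* M
  pN<qM = ℕ.≰⇒> λ le → ℕ.<⇒≱ squares (ℕ.*-mono-≤ le le)

√-close : ∀ k m n ε → + 1 ℚ./ suc m ℚ.< ε → + 1 ℚ./ suc n ℚ.< ε → ∣ √-approx k m ℚ.- √-approx k n ∣ ℚ.< ε
√-close k m n ε p q = ∣∣-< (√-approx k m) (√-approx k n) (ℚ.<-trans (√-step k m n) q) (ℚ.<-trans (√-step k n m) p)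
  where
  ∣∣-< : ∀ x y → x ℚ.- y ℚ.< ε → y ℚ.- x ℚ.< ε → ∣ x ℚ.- y ∣ ℚ.< ε
  ∣∣-< x y p q with ℚ.∣p∣≡p∨∣p∣≡-p (x ℚ.- y)
  ... | inj₁ eq = subst (ℚ._< ε) (sym eq) p
  ... | inj₂ eq = subst (ℚ._< ε) (sym (trans eq (sym (minus-swap x y)))) q

infix 9 √_

√_ : ℕ → ℝ
√ k = mkℝ (√-approx k) proof
  where
  abstract
    proof : ∀ ε → 0ℚ ℚ.< ε → ∃[ N ] (∀ m n → N ℕ.≤ m → N ℕ.≤ n → ∣ √-approx k m ℚ.- √-approx k n ∣ ℚ.< ε)
    proof ε 0<ε with archimedean ε 0<ε
    ... | N , h = N , λ m n N≤m N≤n → √-close k m n ε (h m N≤m) (h n N≤n)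

------------------------------------------------------------------------
-- The plane ℂ ≅ ℝ²

ℝ² : Set
ℝ² = ℝ × ℝ

ℝ²-setoid : Setoid _ _
ℝ²-setoid = ×-setoid ℝ-setoid ℝ-setoid

open Setoid ℝ²-setoid public using () renaming (_≈_ to _≈²_)
open Membership ℝ²-setoid public using (_∈_)
open Uniqueness ℝ²-setoid public using (Unique)

infixl 6 _+²_
infixl 7 _·_

_+²_ : ℝ² → ℝ² → ℝ²
(x , y) +² (x′ , y′) = x + x′ , y + y′

_·_ : ℝ → ℝ² → ℝ²
c · (x , y) = c * x , c * y

∣_∣² : ℝ² → ℝ
∣ (x , y) ∣² = x * x + y * y

------------------------------------------------------------------------
-- Integration over the unit circle

-- c i j is the coefficient of xⁱyʲ; only those with i + j ≤ t are used.
poly : (t : ℕ) → (ℕ → ℕ → ℝ) → ℝ² → ℝ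
poly t c (x , y) =
  sum (applyUpTo (λ k → sum (applyUpTo (λ i → c i (k ℕ.∸ i) * (x ^ i * y ^ (k ℕ.∸ i))) (suc k))) (suc t))

riemannSum : (ℚ → ℝ) → ℕ → ℝ
riemannSum g n = sum (applyUpTo (λ j → fromℚ (+ 1 ℚ./ suc n) * g (+ j ℚ./ suc n)) (suc n))

-- I = ∫₀¹ g(t) dt, for the restriction g to rational points of a continuous
-- function on [0,1].
HasIntegral₀¹ : (ℚ → ℝ) → ℝ → Set
HasIntegral₀¹ g I = riemannSum g ⟶ I

1+t²-nonZero : ∀ t → ℚ.NonZero (1ℚ ℚ.+ t ℚ.* t)
1+t²-nonZero t = ℚ.pos⇒nonZero (1ℚ ℚ.+ t ℚ.* t) {{ℚ.pos+nonNeg⇒pos 1ℚ (t ℚ.* t) {{square t}}}}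
  where
  square : ∀ t → ℚ.NonNegative (t ℚ.* t)
  square t with ℚ.≤-total 0ℚ t
  ... | inj₁ 0≤t = ℚ.nonNeg*nonNeg⇒nonNeg t {{ℚ.nonNegative 0≤t}} t {{ℚ.nonNegative 0≤t}}
  ... | inj₂ t≤0 = ℚ.nonPos*nonPos⇒nonPos t {{ℚ.nonPositive t≤0}} t {{ℚ.nonPositive t≤0}}

-- Opaque only to stop the typechecker from unfolding normalised fractions.
opaque
  1/[1+t²] : ℚ → ℚ
  1/[1+t²] t = (ℚ.1/ (1ℚ ℚ.+ t ℚ.* t)) {{1+t²-nonZero t}}

-- γ(t) = ((1-t²)/(1+t²), 2t/(1+t²)) runs through the arc of the unit circle
-- from (1,0) to (0,1) as t runs from 0 to 1, with speed |γ′(t)| = 2/(1+t²).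
arc : ℚ → ℝ²
arc t = fromℚ ((1ℚ ℚ.- t ℚ.* t) ℚ.* 1/[1+t²] t) , fromℚ ((t ℚ.+ t) ℚ.* 1/[1+t²] t)

arcSpeed : ℚ → ℝ
arcSpeed t = fromℚ ((1ℚ ℚ.+ 1ℚ) ℚ.* 1/[1+t²] t)

quarterTurn : ℝ² → ℝ²
quarterTurn (x , y) = - y , x

-- I = ∫ f dσ over the unit circle, σ being arc length: the circle is the
-- union of γ([0,1]) and its images under the quarter turns.
HasCircleIntegral : (ℝ² → ℝ) → ℝ → Set
HasCircleIntegral f I = HasIntegral₀¹ (λ t → arcSpeed t * (f (p₀ t) + f (p₁ t) + f (p₂ t) + f (p₃ t))) I
  where
  p₀ p₁ p₂ p₃ : ℚ → ℝ²
  p₀ t = arc t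
  p₁ t = quarterTurn (p₀ t)
  p₂ t = quarterTurn (p₁ t)
  p₃ t = quarterTurn (p₂ t)

-- A = I / S, where I = ∫ f dσ and S = ∫ 1 dσ is the circumference.
HasCircleMean : (ℝ² → ℝ) → ℝ → Set
HasCircleMean f A =
  Σ ℝ λ I → Σ ℝ λ S → Σ (0ℝ < S) λ S>0 →
    HasCircleIntegral f I × HasCircleIntegral (λ _ → 1ℝ) S × A ≃ inv S S>0 * I

------------------------------------------------------------------------
-- Spherical designs in the plane

-- Points are listed without repetition, so that the length of the list is |X|.
record FiniteNonempty (X : ℝ² → Set) : Set where
  field
    first    : ℝ²
    rest     : List ℝ²
    unique   : Unique (first ∷ rest)
    complete : ∀ p → X p ⇔ p ∈ first ∷ rest

  average : (ℝ² → ℝ) → ℝ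
  average f = fromℚ (+ 1 ℚ./ length (first ∷ rest)) * sum (map f (first ∷ rest))

UnitSphericalDesign : ℕ → (ℝ² → Set) → Set
UnitSphericalDesign t X =
  Σ (FiniteNonempty X) λ fin →
    (∀ p → X p → ∣ p ∣² ≃ 1ℝ)
    × (∀ c → HasCircleMean (poly t c) (FiniteNonempty.average fin (poly t c)))

scale : ℝ → (ℝ² → Set) → (ℝ² → Set)
scale c X q = ∃[ p ] (X p × q ≈² c · p)

SphericalDesign : ℕ → (ℝ² → Set) → Set
SphericalDesign t X =
  Σ ℝ λ r → Σ (0ℝ < r) λ r>0 →
    (∀ p → X p → ∣ p ∣² ≃ r * r) × UnitSphericalDesign t (scale (inv r r>0) X)

------------------------------------------------------------------------
-- The lattice of integers of ℚ(√-d)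

θ : ℕ → ℝ²
θ d = if ⌊ (ℤ.- (+ d)) %ℕ 4 ℕ.≟ 1 ⌋
      then (fromℚ ½ , fromℚ ½ * √ d)
      else (0ℝ , √ d)

𝓞 : ℕ → ℝ² → Set
𝓞 d p = ∃[ a ] ∃[ b ] p ≈² (fromℤ a · (1ℝ , 0ℝ) +² fromℤ b · θ d)

Shell : (ℝ² → Set) → ℝ → ℝ² → Set
Shell L m p = L p × ∣ p ∣² ≃ m

{-# OPTIONS --safe #-}

-- Because a quarter turn negates the harmonic polynomials x² − y² and xy, a
-- 2-design has Σ z² = 0. For the shells of the ring of integers this sum never
-- vanishes: up to the two units ±1 it is multiplicative in the norm. An inert
-- or ramified prime contributes a square factor. A split prime p = π π̄ with
-- p^k ∥ m contributes v_k, where v_0 = 1 and v_{k+1} = π² v_k + π̄^{2(k+1)},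
-- which is not divisible by π. That every prime with a root of the norm form
-- is the norm of some π is Gauss reduction of binary quadratic forms: the
-- reduced forms (a, b, c) have 3a² ≤ D, and for these discriminants only a = 1
-- occurs.
module Submission where

open import Defs
open import Data.Nat using (ℕ)
open import Data.List using ([]; _∷_)
open import Data.List.Membership.Propositional using () renaming (_∈_ to _∈ˡ_)
open import Data.Product using (∃)
open import Relation.Nullary using (¬_)

open import Data.Empty using (⊥)
open import Data.Fin using (Fin; toℕ; fromℕ<)
import Data.Fin.Properties as Fin
open import Data.Integer as ℤ using (ℤ; +_; -[1+_]; 0ℤ; 1ℤ)
open import Data.Integer.Divisibility.Signed as ℤ using (divides)
open import Data.Integer.DivMod using (_%ℕ_; _/ℕ_; n%ℕd<d; a≡a%ℕn+[a/ℕn]*n)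
import Data.Integer.Properties as ℤ
open import Data.Integer.Tactic.RingSolver using (solve-∀)
open import Data.List using (List; _++_; map; foldr; length; applyUpTo)
open import Data.List.Membership.Propositional.Properties using (∈-map⁺; ∈-map⁻; ∈-++⁺ˡ; ∈-++⁺ʳ; ∈-++⁻)
open import Data.List.Membership.Propositional.Properties.WithK using (unique∧set⇒bag)
open import Data.List.Relation.Binary.BagAndSetEquality using (∼bag⇒↭)
open import Data.List.Relation.Binary.Permutation.Propositional as Perm using (_↭_)
open import Data.List.Relation.Binary.Pointwise using (Pointwise; []; _∷_)
open import Data.List.Relation.Unary.All as All using (All; []; _∷_)
open import Data.List.Relation.Unary.AllPairs using ([]; _∷_)
open import Data.List.Relation.Unary.Any using (here; there)
open import Data.List.Relation.Unary.Unique.Propositional using () renaming (Unique to Uniqueˡ)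
open import Data.List.Relation.Unary.Unique.Propositional.Properties using (map⁺; ++⁺)
open import Data.Nat as ℕ using (zero; suc)
open import Data.Nat.Coprimality using (Coprime; coprime-Bézout)
import Data.Nat.Divisibility as ℕ
open import Data.Nat.GCD using (module Bézout)
open import Data.Nat.Induction using (Acc; acc; <-wellFounded)
open import Data.Nat.ListAction using (product)
open import Data.Nat.Primality using (Prime; euclidsLemma; prime⇒nonZero; prime⇒nonTrivial; prime⇒irreducible; ¬prime[1])
open import Data.Nat.Primality.Factorisation using (factorise)
import Data.Nat.Properties as ℕ
import Data.Nat.Solver as ℕ
open import Data.Product using (∃-syntax; _×_; _,_; proj₁; proj₂)
open import Data.Rational as ℚ using (ℚ; 0ℚ; 1ℚ; ½; ∣_∣)
import Data.Rational.Properties as ℚ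
import Data.Rational.Solver as ℚ
import Data.Rational.Unnormalised as ℚᵘ
import Data.Rational.Unnormalised.Properties as ℚᵘ
open import Data.Sum as Sum using (_⊎_; inj₁; inj₂; [_,_]′)
open import Function.Base using (_∘_; it)
open import Function.Bundles using (mk⇔; Equivalence)
open import Relation.Binary.Bundles using (Setoid)
open import Relation.Binary.PropositionalEquality using (_≡_; _≢_; refl; sym; trans; cong; cong₂; subst; subst₂; module ≡-Reasoning)
import Relation.Binary.Reasoning.Setoid as SetoidReasoning
open import Relation.Nullary using (Dec; yes; no; contradiction)
open import Relation.Nullary.Decidable using (_→-dec_; ¬?; toWitness)

-- The order ℤ + ℤθ

-- The bound 4 < D is where d = 1 and d = 3 drop out: for D = 4 and D = 3 every shell is stable
-- under a unit ε with ε² ≠ 1, so Σ z² = ε² Σ z² vanishes. For D > 4 the units are ±1, and norm 1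
-- gives the sum 2. Multiplicativity is not stated as such, and elements are never factored into
-- primes. Strong induction on m removes primes from m and builds an explicit duplicate-free list of
-- the elements of norm m from the lists for smaller norms. An empty shell has sum zero, so an
-- element of the shell has to accompany every step down. For a split prime, v alone does not
-- reproduce itself: the elements not divisible by π need a list of their own, whose sum supplies
-- the power of π̄. Modulo π only that power survives in v_{k+1}, and π does not divide it because π
-- does not divide π̄. Divisibility by π is tested by one integral linear form modulo p. Primality
-- of π, and the choice between π and π̄, then become polynomial identities combined with Euclid's
-- lemma for p.

square-abs : ∀ i → i ℤ.* i ≡ + (ℤ.∣ i ∣ ℕ.* ℤ.∣ i ∣)
square-abs (+ k)    = sym (ℤ.pos-* k k)
square-abs -[1+ k ] = refl

prime-divides-* : ∀ {p} → Prime p → ∀ i j → + p ℤ.∣ i ℤ.* j → + p ℤ.∣ i ⊎ + p ℤ.∣ j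
prime-divides-* {p} pr i j d = Sum.map ℤ.∣ᵤ⇒∣ ℤ.∣ᵤ⇒∣
  (euclidsLemma ℤ.∣ i ∣ ℤ.∣ j ∣ pr (subst (p ℕ.∣_) (ℤ.abs-* i j) (ℤ.∣⇒∣ᵤ d)))

𝕆 : Set
𝕆 = ℤ × ℤ

0𝕆 1𝕆 : 𝕆
0𝕆 = 0ℤ , 0ℤ
1𝕆 = 1ℤ , 0ℤ

infixl 6 _⊕_

_⊕_ : 𝕆 → 𝕆 → 𝕆
(x , y) ⊕ (u , v) = x ℤ.+ u , y ℤ.+ v

-- x + yθ is represented by (x , y), where θ² = tθ − n.
module Order (t n : ℤ) where

  infixl 7 _⊗_
  infix  4 _∣ᴼ_

  -- Opaque only to keep the typechecker from unfolding integer arithmetic.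
  opaque
    _⊗_ : 𝕆 → 𝕆 → 𝕆
    (x , y) ⊗ (u , v) = x ℤ.* u ℤ.- n ℤ.* (y ℤ.* v) , x ℤ.* v ℤ.+ y ℤ.* u ℤ.+ t ℤ.* (y ℤ.* v)

    -- θ and its conjugate are the roots of X² - tX + n, so the conjugate of θ is t - θ.
    conj : 𝕆 → 𝕆
    conj (x , y) = x ℤ.+ t ℤ.* y , ℤ.- y

    N : 𝕆 → ℤ
    N (x , y) = x ℤ.* x ℤ.+ t ℤ.* (x ℤ.* y) ℤ.+ n ℤ.* (y ℤ.* y)

    ⊗-comm : ∀ z w → z ⊗ w ≡ w ⊗ z
    ⊗-comm (x , y) (u , v) = cong₂ _,_ (re n x y u v) (im t x y u v)
      where
      re : ∀ n x y u v → x ℤ.* u ℤ.- n ℤ.* (y ℤ.* v) ≡ u ℤ.* x ℤ.- n ℤ.* (v ℤ.* y)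
      re = solve-∀
      im : ∀ t x y u v → x ℤ.* v ℤ.+ y ℤ.* u ℤ.+ t ℤ.* (y ℤ.* v) ≡ u ℤ.* y ℤ.+ v ℤ.* x ℤ.+ t ℤ.* (v ℤ.* y)
      im = solve-∀

    ⊗-assoc : ∀ z w q → (z ⊗ w) ⊗ q ≡ z ⊗ (w ⊗ q)
    ⊗-assoc (x , y) (u , v) (k , l) = cong₂ _,_ (re t n x y u v k l) (im t n x y u v k l)
      where
      re : ∀ t n x y u v k l →
        (x ℤ.* u ℤ.- n ℤ.* (y ℤ.* v)) ℤ.* k ℤ.- n ℤ.* ((x ℤ.* v ℤ.+ y ℤ.* u ℤ.+ t ℤ.* (y ℤ.* v)) ℤ.* l) ≡
        x ℤ.* (u ℤ.* k ℤ.- n ℤ.* (v ℤ.* l)) ℤ.- n ℤ.* (y ℤ.* (u ℤ.* l ℤ.+ v ℤ.* k ℤ.+ t ℤ.* (v ℤ.* l)))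
      re = solve-∀
      im : ∀ t n x y u v k l →
        (x ℤ.* u ℤ.- n ℤ.* (y ℤ.* v)) ℤ.* l ℤ.+ (x ℤ.* v ℤ.+ y ℤ.* u ℤ.+ t ℤ.* (y ℤ.* v)) ℤ.* k
          ℤ.+ t ℤ.* ((x ℤ.* v ℤ.+ y ℤ.* u ℤ.+ t ℤ.* (y ℤ.* v)) ℤ.* l) ≡
        x ℤ.* (u ℤ.* l ℤ.+ v ℤ.* k ℤ.+ t ℤ.* (v ℤ.* l)) ℤ.+ y ℤ.* (u ℤ.* k ℤ.- n ℤ.* (v ℤ.* l))
          ℤ.+ t ℤ.* (y ℤ.* (u ℤ.* l ℤ.+ v ℤ.* k ℤ.+ t ℤ.* (v ℤ.* l)))
      im = solve-∀

    ⊗-distribˡ-⊕ : ∀ z w q → z ⊗ (w ⊕ q) ≡ z ⊗ w ⊕ z ⊗ q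
    ⊗-distribˡ-⊕ (x , y) (u , v) (k , l) = cong₂ _,_ (re n x y u v k l) (im t x y u v k l)
      where
      re : ∀ n x y u v k l → x ℤ.* (u ℤ.+ k) ℤ.- n ℤ.* (y ℤ.* (v ℤ.+ l)) ≡
        x ℤ.* u ℤ.- n ℤ.* (y ℤ.* v) ℤ.+ (x ℤ.* k ℤ.- n ℤ.* (y ℤ.* l))
      re = solve-∀
      im : ∀ t x y u v k l → x ℤ.* (v ℤ.+ l) ℤ.+ y ℤ.* (u ℤ.+ k) ℤ.+ t ℤ.* (y ℤ.* (v ℤ.+ l)) ≡
        x ℤ.* v ℤ.+ y ℤ.* u ℤ.+ t ℤ.* (y ℤ.* v) ℤ.+ (x ℤ.* l ℤ.+ y ℤ.* k ℤ.+ t ℤ.* (y ℤ.* l))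
      im = solve-∀

    integer-⊗ : ∀ k z → (k , 0ℤ) ⊗ z ≡ (k ℤ.* proj₁ z , k ℤ.* proj₂ z)
    integer-⊗ k (x , y) = cong₂ _,_ (re n k x y) (im t k x y)
      where
      re : ∀ n k x y → k ℤ.* x ℤ.- n ℤ.* (0ℤ ℤ.* y) ≡ k ℤ.* x
      re = solve-∀
      im : ∀ t k x y → k ℤ.* y ℤ.+ 0ℤ ℤ.* x ℤ.+ t ℤ.* (0ℤ ℤ.* y) ≡ k ℤ.* y
      im = solve-∀

    ⊗-conj : ∀ z → z ⊗ conj z ≡ (N z , 0ℤ)
    ⊗-conj (x , y) = cong₂ _,_ (re t n x y) (im t x y)
      where
      re : ∀ t n x y → x ℤ.* (x ℤ.+ t ℤ.* y) ℤ.- n ℤ.* (y ℤ.* (ℤ.- y)) ≡ x ℤ.* x ℤ.+ t ℤ.* (x ℤ.* y) ℤ.+ n ℤ.* (y ℤ.* y)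
      re = solve-∀
      im : ∀ t x y → x ℤ.* (ℤ.- y) ℤ.+ y ℤ.* (x ℤ.+ t ℤ.* y) ℤ.+ t ℤ.* (y ℤ.* (ℤ.- y)) ≡ 0ℤ
      im = solve-∀

    N-⊗ : ∀ z w → N (z ⊗ w) ≡ N z ℤ.* N w
    N-⊗ (x , y) (u , v) = eq t n x y u v
      where
      eq : ∀ t n x y u v →
        (x ℤ.* u ℤ.- n ℤ.* (y ℤ.* v)) ℤ.* (x ℤ.* u ℤ.- n ℤ.* (y ℤ.* v))
          ℤ.+ t ℤ.* ((x ℤ.* u ℤ.- n ℤ.* (y ℤ.* v)) ℤ.* (x ℤ.* v ℤ.+ y ℤ.* u ℤ.+ t ℤ.* (y ℤ.* v)))
          ℤ.+ n ℤ.* ((x ℤ.* v ℤ.+ y ℤ.* u ℤ.+ t ℤ.* (y ℤ.* v)) ℤ.* (x ℤ.* v ℤ.+ y ℤ.* u ℤ.+ t ℤ.* (y ℤ.* v))) ≡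
        (x ℤ.* x ℤ.+ t ℤ.* (x ℤ.* y) ℤ.+ n ℤ.* (y ℤ.* y)) ℤ.* (u ℤ.* u ℤ.+ t ℤ.* (u ℤ.* v) ℤ.+ n ℤ.* (v ℤ.* v))
      eq = solve-∀

    N-conj : ∀ z → N (conj z) ≡ N z
    N-conj (x , y) = eq t n x y
      where
      eq : ∀ t n x y → (x ℤ.+ t ℤ.* y) ℤ.* (x ℤ.+ t ℤ.* y) ℤ.+ t ℤ.* ((x ℤ.+ t ℤ.* y) ℤ.* (ℤ.- y)) ℤ.+ n ℤ.* ((ℤ.- y) ℤ.* (ℤ.- y)) ≡
        x ℤ.* x ℤ.+ t ℤ.* (x ℤ.* y) ℤ.+ n ℤ.* (y ℤ.* y)
      eq = solve-∀

  _∣ᴼ_ : 𝕆 → 𝕆 → Set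
  α ∣ᴼ z = ∃[ w ] z ≡ α ⊗ w

  ⊗-identityˡ : ∀ z → 1𝕆 ⊗ z ≡ z
  ⊗-identityˡ z = trans (integer-⊗ 1ℤ z) (cong₂ _,_ (ℤ.*-identityˡ _) (ℤ.*-identityˡ _))

  ⊗-zeroʳ : ∀ z → z ⊗ 0𝕆 ≡ 0𝕆
  ⊗-zeroʳ z = trans (⊗-comm z 0𝕆) (integer-⊗ 0ℤ z)

  ⊗-interchange : ∀ z w q r → (z ⊗ w) ⊗ (q ⊗ r) ≡ (z ⊗ q) ⊗ (w ⊗ r)
  ⊗-interchange z w q r = begin
    (z ⊗ w) ⊗ (q ⊗ r)  ≡⟨ ⊗-assoc z w (q ⊗ r) ⟩
    z ⊗ (w ⊗ (q ⊗ r))  ≡⟨ cong (z ⊗_) (⊗-assoc w q r) ⟨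
    z ⊗ (w ⊗ q ⊗ r)    ≡⟨ cong (λ s → z ⊗ (s ⊗ r)) (⊗-comm w q) ⟩
    z ⊗ (q ⊗ w ⊗ r)    ≡⟨ cong (z ⊗_) (⊗-assoc q w r) ⟩
    z ⊗ (q ⊗ (w ⊗ r))  ≡⟨ ⊗-assoc z q (w ⊗ r) ⟨
    (z ⊗ q) ⊗ (w ⊗ r)  ∎
    where open ≡-Reasoning

  integer-⊗-cancelˡ : ∀ k .{{_ : ℤ.NonZero k}} {z w} → (k , 0ℤ) ⊗ z ≡ (k , 0ℤ) ⊗ w → z ≡ w
  integer-⊗-cancelˡ k {z} {w} eq = cong₂ _,_
    (ℤ.*-cancelˡ-≡ k _ _ (cong proj₁ eq′)) (ℤ.*-cancelˡ-≡ k _ _ (cong proj₂ eq′))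
    where
    eq′ : (k ℤ.* proj₁ z , k ℤ.* proj₂ z) ≡ (k ℤ.* proj₁ w , k ℤ.* proj₂ w)
    eq′ = trans (sym (integer-⊗ k z)) (trans eq (integer-⊗ k w))

  conj-⊗-⊗ : ∀ α z → conj α ⊗ (α ⊗ z) ≡ (N α , 0ℤ) ⊗ z
  conj-⊗-⊗ α z = trans (sym (⊗-assoc (conj α) α z)) (cong (_⊗ z) (trans (⊗-comm (conj α) α) (⊗-conj α)))

  -- Multiplying by the conjugate of α replaces α by the integer N α, which cancels in each
  -- coordinate.
  ⊗-cancelˡ : ∀ α .{{_ : ℤ.NonZero (N α)}} {z w} → α ⊗ z ≡ α ⊗ w → z ≡ w
  ⊗-cancelˡ α {z} {w} eq = integer-⊗-cancelˡ (N α)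
    (trans (sym (conj-⊗-⊗ α z)) (trans (cong (conj α ⊗_) eq) (conj-⊗-⊗ α w)))

  ∣ᴼ-⊗ : ∀ {α} z w → α ∣ᴼ z → α ∣ᴼ z ⊗ w
  ∣ᴼ-⊗ {α} z w (q , eq) = q ⊗ w , trans (cong (_⊗ w) eq) (⊗-assoc α q w)

  module PrimeElement {p : ℕ} (p-prime : Prime p) (π : 𝕆) (Nπ : N π ≡ + p) where

    private
      a b : ℤ
      a = proj₁ π
      b = proj₂ π

      instance
        p-nonZero : ℕ.NonZero p
        p-nonZero = prime⇒nonZero p-prime

    -- Up to the unit −b, the residue of z in 𝕆/(π) ≅ ℤ/p.
    residue : 𝕆 → ℤ
    residue (x , y) = a ℤ.* y ℤ.- b ℤ.* x

    opaque
      unfolding _⊗_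

      -- If p divided b, then a² = N π - b(ta + nb) would be divisible by p, hence also a. Then p²
      -- would divide N π = p.
      p∤b : ¬ + p ℤ.∣ b
      p∤b p∣b = absurd p∣b (Sum.reduce (prime-divides-* p-prime a a (subst (+ p ℤ.∣_) (a² t n a b)
        (ℤ.∣m∣n⇒∣m-n (subst (+ p ℤ.∣_) (sym Nπ) ℤ.∣-refl) (ℤ.∣m⇒∣m*n (t ℤ.* a ℤ.+ n ℤ.* b) p∣b)))))
        where
        a² : ∀ t n a b → a ℤ.* a ℤ.+ t ℤ.* (a ℤ.* b) ℤ.+ n ℤ.* (b ℤ.* b) ℤ.- b ℤ.* (t ℤ.* a ℤ.+ n ℤ.* b) ≡ a ℤ.* a
        a² = solve-∀
        N-multiple : ∀ t n k l q → (l ℤ.* q) ℤ.* (l ℤ.* q) ℤ.+ t ℤ.* ((l ℤ.* q) ℤ.* (k ℤ.* q)) ℤ.+ n ℤ.* ((k ℤ.* q) ℤ.* (k ℤ.* q)) ≡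
          (l ℤ.* l ℤ.+ t ℤ.* (l ℤ.* k) ℤ.+ n ℤ.* (k ℤ.* k)) ℤ.* q ℤ.* q
        N-multiple = solve-∀

        absurd : + p ℤ.∣ b → + p ℤ.∣ a → ⊥
        absurd (divides k b≡kp) (divides l a≡lp) = ¬prime[1] (subst Prime p≡1 p-prime)
          where
          p≡Np*p : 1ℤ ℤ.* + p ≡ N (l , k) ℤ.* + p ℤ.* + p
          p≡Np*p = trans (ℤ.*-identityˡ (+ p))
            (trans (sym Nπ) (trans (cong N (cong₂ _,_ a≡lp b≡kp)) (N-multiple t n k l (+ p))))
          p≡1 : p ≡ 1
          p≡1 = ℕ.∣1⇒≡1 (ℤ.∣⇒∣ᵤ (divides (N (l , k)) (ℤ.*-cancelʳ-≡ 1ℤ (N (l , k) ℤ.* + p) (+ p) p≡Np*p)))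

      -- The product of π̄ and z has coordinates `e` and `residue z`. Since b e = p y - (a + tb)
      -- `residue z` and p does not divide b, both coordinates are divisible by p, say π̄ z = p w.
      -- Then p z = π π̄ z = p π w, and p cancels.
      p∣residue⇒π∣ : ∀ z → + p ℤ.∣ residue z → π ∣ᴼ z
      p∣residue⇒π∣ z@(x , y) p∣r = [ (λ p∣b → contradiction p∣b p∤b) , (λ p∣e → quotient p∣e p∣r) ]′
        (prime-divides-* p-prime b e (subst (+ p ℤ.∣_)
          (trans (cong (λ q → q ℤ.* y ℤ.- (a ℤ.+ t ℤ.* b) ℤ.* residue z) (sym Nπ)) (eq t n a b x y))
          (ℤ.∣m∣n⇒∣m-n (ℤ.∣m⇒∣m*n y ℤ.∣-refl) (ℤ.∣n⇒∣m*n (a ℤ.+ t ℤ.* b) p∣r))))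
        where
        open ≡-Reasoning
        e : ℤ
        e = (a ℤ.+ t ℤ.* b) ℤ.* x ℤ.+ n ℤ.* (b ℤ.* y)

        eq : ∀ t n a b x y → (a ℤ.* a ℤ.+ t ℤ.* (a ℤ.* b) ℤ.+ n ℤ.* (b ℤ.* b)) ℤ.* y ℤ.- (a ℤ.+ t ℤ.* b) ℤ.* (a ℤ.* y ℤ.- b ℤ.* x) ≡
          b ℤ.* ((a ℤ.+ t ℤ.* b) ℤ.* x ℤ.+ n ℤ.* (b ℤ.* y))
        eq = solve-∀
        re : ∀ t n a b x y → (a ℤ.+ t ℤ.* b) ℤ.* x ℤ.- n ℤ.* ((ℤ.- b) ℤ.* y) ≡ (a ℤ.+ t ℤ.* b) ℤ.* x ℤ.+ n ℤ.* (b ℤ.* y)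
        re = solve-∀
        im : ∀ t a b x y → (a ℤ.+ t ℤ.* b) ℤ.* y ℤ.+ (ℤ.- b) ℤ.* x ℤ.+ t ℤ.* ((ℤ.- b) ℤ.* y) ≡ a ℤ.* y ℤ.- b ℤ.* x
        im = solve-∀

        conj-⊗ : conj π ⊗ z ≡ (e , residue z)
        conj-⊗ = cong₂ _,_ (re t n a b x y) (im t a b x y)

        quotient : + p ℤ.∣ e → + p ℤ.∣ residue z → π ∣ᴼ z
        quotient (divides k e≡kp) (divides l r≡lp) = (k , l) , integer-⊗-cancelˡ (+ p) (begin
          (+ p , 0ℤ) ⊗ z              ≡⟨ cong (λ q → (q , 0ℤ) ⊗ z) Nπ ⟨
          (N π , 0ℤ) ⊗ z              ≡⟨ cong (_⊗ z) (⊗-conj π) ⟨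
          π ⊗ conj π ⊗ z              ≡⟨ ⊗-assoc π (conj π) z ⟩
          π ⊗ (conj π ⊗ z)            ≡⟨ cong (π ⊗_) conj-⊗ ⟩
          π ⊗ (e , residue z)         ≡⟨ cong (π ⊗_) (cong₂ _,_ (trans e≡kp (ℤ.*-comm k (+ p))) (trans r≡lp (ℤ.*-comm l (+ p)))) ⟩
          π ⊗ (+ p ℤ.* k , + p ℤ.* l) ≡⟨ cong (π ⊗_) (integer-⊗ (+ p) (k , l)) ⟨
          π ⊗ ((+ p , 0ℤ) ⊗ (k , l))  ≡⟨ ⊗-assoc π (+ p , 0ℤ) (k , l) ⟨
          π ⊗ (+ p , 0ℤ) ⊗ (k , l)    ≡⟨ cong (_⊗ (k , l)) (⊗-comm π (+ p , 0ℤ)) ⟩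
          (+ p , 0ℤ) ⊗ π ⊗ (k , l)    ≡⟨ ⊗-assoc (+ p , 0ℤ) π (k , l) ⟩
          (+ p , 0ℤ) ⊗ (π ⊗ (k , l))  ∎)

      π∣⇒p∣residue : ∀ z → π ∣ᴼ z → + p ℤ.∣ residue z
      π∣⇒p∣residue z ((x , y) , refl) = divides y (trans (eq t n a b x y) (cong (y ℤ.*_) Nπ))
        where
        eq : ∀ t n a b x y → a ℤ.* (a ℤ.* y ℤ.+ b ℤ.* x ℤ.+ t ℤ.* (b ℤ.* y)) ℤ.- b ℤ.* (a ℤ.* x ℤ.- n ℤ.* (b ℤ.* y)) ≡
          y ℤ.* (a ℤ.* a ℤ.+ t ℤ.* (a ℤ.* b) ℤ.+ n ℤ.* (b ℤ.* b))
        eq = solve-∀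

    π∣? : ∀ z → Dec (π ∣ᴼ z)
    π∣? z with + p ℤ.∣? residue z
    ... | yes d = yes (p∣residue⇒π∣ z d)
    ... | no ¬d = no (¬d ∘ π∣⇒p∣residue z)

    opaque
      unfolding _⊗_

      -- Up to the factor -b, `residue` is multiplicative modulo p: `residue z` times `residue w`
      -- equals y v N π - b `residue (z ⊗ w)`.
      π-prime : ∀ z w → π ∣ᴼ z ⊗ w → π ∣ᴼ z ⊎ π ∣ᴼ w
      π-prime z@(x , y) w@(u , v) d = Sum.map (p∣residue⇒π∣ z) (p∣residue⇒π∣ w)
        (prime-divides-* p-prime (residue z) (residue w) (subst (+ p ℤ.∣_)
          (trans (cong (λ q → y ℤ.* v ℤ.* q ℤ.- b ℤ.* residue (z ⊗ w)) (sym Nπ)) (eq t n a b x y u v))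
          (ℤ.∣m∣n⇒∣m-n (ℤ.∣n⇒∣m*n (y ℤ.* v) ℤ.∣-refl) (ℤ.∣n⇒∣m*n b (π∣⇒p∣residue (z ⊗ w) d)))))
        where
        eq : ∀ t n a b x y u v → y ℤ.* v ℤ.* (a ℤ.* a ℤ.+ t ℤ.* (a ℤ.* b) ℤ.+ n ℤ.* (b ℤ.* b))
          ℤ.- b ℤ.* (a ℤ.* (x ℤ.* v ℤ.+ y ℤ.* u ℤ.+ t ℤ.* (y ℤ.* v)) ℤ.- b ℤ.* (x ℤ.* u ℤ.- n ℤ.* (y ℤ.* v))) ≡
          (a ℤ.* y ℤ.- b ℤ.* x) ℤ.* (a ℤ.* v ℤ.- b ℤ.* u)
        eq = solve-∀

  opaque
    unfolding _⊗_

    -- The residues of z with respect to π and to π̄ have the product y² N π - b² N z, so p divides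
    -- one of them.
    p∣N⇒π∣⊎π̄∣ : ∀ {p} (p-prime : Prime p) π (Nπ : N π ≡ + p) z → + p ℤ.∣ N z → π ∣ᴼ z ⊎ conj π ∣ᴼ z
    p∣N⇒π∣⊎π̄∣ {p} p-prime π@(a , b) Nπ z@(x , y) d = Sum.map (P.p∣residue⇒π∣ z) (Q.p∣residue⇒π∣ z)
      (prime-divides-* p-prime (P.residue z) (Q.residue z) (subst (+ p ℤ.∣_)
        (trans (cong (λ q → y ℤ.* y ℤ.* q ℤ.- b ℤ.* b ℤ.* N z) (sym Nπ)) (eq t n a b x y))
        (ℤ.∣m∣n⇒∣m-n (ℤ.∣n⇒∣m*n (y ℤ.* y) ℤ.∣-refl) (ℤ.∣n⇒∣m*n (b ℤ.* b) d))))
      where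
      module P = PrimeElement p-prime π Nπ
      module Q = PrimeElement p-prime (conj π) (trans (N-conj π) Nπ)
      eq : ∀ t n a b x y →
        y ℤ.* y ℤ.* (a ℤ.* a ℤ.+ t ℤ.* (a ℤ.* b) ℤ.+ n ℤ.* (b ℤ.* b)) ℤ.- b ℤ.* b ℤ.* (x ℤ.* x ℤ.+ t ℤ.* (x ℤ.* y) ℤ.+ n ℤ.* (y ℤ.* y)) ≡
        (a ℤ.* y ℤ.- b ℤ.* x) ℤ.* ((a ℤ.+ t ℤ.* b) ℤ.* y ℤ.- (ℤ.- b) ℤ.* x)
      eq = solve-∀

-- Factorisation of primes

prime-coprime : ∀ {p} → Prime p → ∀ {k} → ¬ p ℕ.∣ k → Coprime p k
prime-coprime pr p∤k (d∣p , d∣k) = [ (λ d≡1 → d≡1) , (λ d≡p → contradiction (subst (ℕ._∣ _) d≡p d∣k) p∤k) ]′ (prime⇒irreducible pr d∣p)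

inverse-mod-ℕ : ∀ {p} → Prime p → ∀ k → ¬ p ℕ.∣ k → ∃[ u ] + p ℤ.∣ u ℤ.* + k ℤ.- 1ℤ
inverse-mod-ℕ {p} pr k p∤k with coprime-Bézout (prime-coprime pr p∤k)
... | Bézout.+- x y eq = ℤ.- + y , divides (ℤ.- + x) (trans (regroup (+ y) (+ k))
  (trans (cong ℤ.-_ (trans (sym (cong (λ s → 1ℤ ℤ.+ s) (ℤ.pos-* y k))) (trans (cong +_ eq) (ℤ.pos-* x p)))) (ℤ.neg-distribˡ-* (+ x) (+ p))))
  where
  regroup : ∀ y k → (ℤ.- y) ℤ.* k ℤ.- 1ℤ ≡ ℤ.- (1ℤ ℤ.+ y ℤ.* k)
  regroup = solve-∀
... | Bézout.-+ x y eq = + y , divides (+ x) (trans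
  (cong (ℤ._- 1ℤ) (trans (sym (ℤ.pos-* y k)) (trans (cong +_ (sym eq)) (cong (λ s → 1ℤ ℤ.+ s) (ℤ.pos-* x p)))))
  (cancel (+ x ℤ.* + p)))
  where
  cancel : ∀ s → 1ℤ ℤ.+ s ℤ.- 1ℤ ≡ s
  cancel = solve-∀

inverse-mod : ∀ {p} → Prime p → ∀ y → ¬ + p ℤ.∣ y → ∃[ u ] + p ℤ.∣ u ℤ.* y ℤ.- 1ℤ
inverse-mod pr (+ k) p∤y = inverse-mod-ℕ pr k (p∤y ∘ ℤ.∣ᵤ⇒∣)
inverse-mod {p} pr -[1+ k ] p∤y =
  let (u , d) = inverse-mod-ℕ pr (suc k) (p∤y ∘ ℤ.∣ᵤ⇒∣)
  in ℤ.- u , subst (λ s → + p ℤ.∣ s ℤ.- 1ℤ) (neg-neg u (+ suc k)) d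
  where
  neg-neg : ∀ u k → u ℤ.* k ≡ (ℤ.- u) ℤ.* (ℤ.- k)
  neg-neg = solve-∀

-- Dividing u + a instead of u moves the remainder from [0, 2a) to [-a, a). In the reduction this
-- normalises the middle coefficient 2b + t.
centred-residue : ∀ u a .{{_ : ℕ.NonZero a}} → ∃[ q ] ℤ.∣ u ℤ.- q ℤ.* + (2 ℕ.* a) ∣ ℕ.≤ a
centred-residue u a = q , subst (λ s → ℤ.∣ s ∣ ℕ.≤ a) (sym eq) (bound (ℕ.≤-total r a))
  where
  instance
    2a-nonZero : ℕ.NonZero (2 ℕ.* a)
    2a-nonZero = ℕ.m*n≢0 2 a
  r : ℕ
  r = (u ℤ.+ + a) %ℕ (2 ℕ.* a)
  q : ℤ
  q = (u ℤ.+ + a) /ℕ (2 ℕ.* a)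
  shift : ∀ u a s → u ℤ.- s ≡ u ℤ.+ a ℤ.- s ℤ.- a
  shift = solve-∀
  unshift : ∀ r s a → r ℤ.+ s ℤ.- s ℤ.- a ≡ r ℤ.- a
  unshift = solve-∀
  eq : u ℤ.- q ℤ.* + (2 ℕ.* a) ≡ r ℤ.⊖ a
  eq = trans (shift u (+ a) (q ℤ.* + (2 ℕ.* a)))
    (trans (cong (λ s → s ℤ.- q ℤ.* + (2 ℕ.* a) ℤ.- + a) (a≡a%ℕn+[a/ℕn]*n (u ℤ.+ + a) (2 ℕ.* a)))
      (trans (unshift (+ r) (q ℤ.* + (2 ℕ.* a)) (+ a)) (ℤ.m-n≡m⊖n r a)))
  bound : r ℕ.≤ a ⊎ a ℕ.≤ r → ℤ.∣ r ℤ.⊖ a ∣ ℕ.≤ a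
  bound (inj₁ r≤a) = subst (ℕ._≤ a) (sym (ℤ.∣⊖∣-≤ r≤a)) (ℕ.m∸n≤m a r)
  bound (inj₂ a≤r) = subst (ℕ._≤ a) (sym (cong ℤ.∣_∣ (ℤ.⊖-≥ a≤r))) (ℕ.m≤n+o⇒m∸n≤o r a
    (subst (r ℕ.≤_) (cong (a ℕ.+_) (ℕ.+-identityʳ a)) (ℕ.<⇒≤ (n%ℕd<d (u ℤ.+ + a) (2 ℕ.* a)))))

-- Norms in the order of discriminant -D

module Imaginary (t n : ℤ) (D : ℕ) (disc : + 4 ℤ.* n ≡ t ℤ.* t ℤ.+ + D) (4<D : 4 ℕ.< D) where

  open Order t n

  opaque
    unfolding _⊗_

    4N : ∀ x y → + 4 ℤ.* N (x , y) ≡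
      + (ℤ.∣ + 2 ℤ.* x ℤ.+ t ℤ.* y ∣ ℕ.* ℤ.∣ + 2 ℤ.* x ℤ.+ t ℤ.* y ∣ ℕ.+ D ℕ.* (ℤ.∣ y ∣ ℕ.* ℤ.∣ y ∣))
    4N x y = begin
      + 4 ℤ.* N (x , y)                          ≡⟨ complete-square t n x y ⟩
      A ℤ.* A ℤ.+ (+ 4 ℤ.* n ℤ.- t ℤ.* t) ℤ.* (y ℤ.* y) ≡⟨ cong (λ s → A ℤ.* A ℤ.+ (s ℤ.- t ℤ.* t) ℤ.* (y ℤ.* y)) disc ⟩
      A ℤ.* A ℤ.+ (t ℤ.* t ℤ.+ + D ℤ.- t ℤ.* t) ℤ.* (y ℤ.* y) ≡⟨ cong (λ s → A ℤ.* A ℤ.+ s ℤ.* (y ℤ.* y)) (cancel (t ℤ.* t) (+ D)) ⟩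
      A ℤ.* A ℤ.+ + D ℤ.* (y ℤ.* y)             ≡⟨ cong₂ (λ r s → r ℤ.+ + D ℤ.* s) (square-abs A) (square-abs y) ⟩
      + (∣A∣ ℕ.* ∣A∣) ℤ.+ + D ℤ.* + (∣y∣ ℕ.* ∣y∣) ≡⟨ cong (λ s → + (∣A∣ ℕ.* ∣A∣) ℤ.+ s) (ℤ.pos-* D (∣y∣ ℕ.* ∣y∣)) ⟨
      + (∣A∣ ℕ.* ∣A∣) ℤ.+ + (D ℕ.* (∣y∣ ℕ.* ∣y∣)) ≡⟨ ℤ.pos-+ (∣A∣ ℕ.* ∣A∣) (D ℕ.* (∣y∣ ℕ.* ∣y∣)) ⟨
      + (∣A∣ ℕ.* ∣A∣ ℕ.+ D ℕ.* (∣y∣ ℕ.* ∣y∣)) ∎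
      where
      open ≡-Reasoning
      A : ℤ
      A = + 2 ℤ.* x ℤ.+ t ℤ.* y
      ∣A∣ ∣y∣ : ℕ
      ∣A∣ = ℤ.∣ A ∣
      ∣y∣ = ℤ.∣ y ∣
      complete-square : ∀ t n x y → + 4 ℤ.* (x ℤ.* x ℤ.+ t ℤ.* (x ℤ.* y) ℤ.+ n ℤ.* (y ℤ.* y)) ≡
        (+ 2 ℤ.* x ℤ.+ t ℤ.* y) ℤ.* (+ 2 ℤ.* x ℤ.+ t ℤ.* y) ℤ.+ (+ 4 ℤ.* n ℤ.- t ℤ.* t) ℤ.* (y ℤ.* y)
      complete-square = solve-∀
      cancel : ∀ s d → s ℤ.+ d ℤ.- s ≡ d
      cancel = solve-∀

  4N≡ : ∀ x y {m} → N (x , y) ≡ + m →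
    4 ℕ.* m ≡ ℤ.∣ + 2 ℤ.* x ℤ.+ t ℤ.* y ∣ ℕ.* ℤ.∣ + 2 ℤ.* x ℤ.+ t ℤ.* y ∣ ℕ.+ D ℕ.* (ℤ.∣ y ∣ ℕ.* ℤ.∣ y ∣)
  4N≡ x y {m} eq = ℤ.+-injective (trans (ℤ.pos-* 4 m) (trans (cong (+ 4 ℤ.*_) (sym eq)) (4N x y)))

  N-natural : ∀ z → ∃[ m ] N z ≡ + m
  N-natural z@(x , y) = nonneg (N z) (4N x y)
    where
    nonneg : ∀ i {k} → + 4 ℤ.* i ≡ + k → ∃[ m ] i ≡ + m
    nonneg (+ m) _ = m , refl

  small-D-multiple : ∀ k → D ℕ.* (k ℕ.* k) ℕ.≤ 4 → k ≡ 0
  small-D-multiple zero    _  = refl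
  small-D-multiple (suc k) le = contradiction
    (ℕ.≤-trans (ℕ.m≤m*n D (suc k ℕ.* suc k)) le) (ℕ.<⇒≱ 4<D)

  opaque
    unfolding _⊗_

    N-at-y≡0 : ∀ x → N (x , 0ℤ) ≡ + (ℤ.∣ x ∣ ℕ.* ℤ.∣ x ∣)
    N-at-y≡0 x = trans (eq t n x) (square-abs x)
      where
      eq : ∀ t n x → x ℤ.* x ℤ.+ t ℤ.* (x ℤ.* 0ℤ) ℤ.+ n ℤ.* (0ℤ ℤ.* 0ℤ) ≡ x ℤ.* x
      eq = solve-∀

  -- 4N = (2x + ty)² + Dy² gives Dy² ≤ 4 < D, so y = 0. Both the definiteness of N and the
  -- determination of the units come from this.
  N≤1⇒rational : ∀ x y {m} → m ℕ.≤ 1 → N (x , y) ≡ + m → y ≡ 0ℤ × ℤ.∣ x ∣ ℕ.* ℤ.∣ x ∣ ≡ m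
  N≤1⇒rational x y {m} m≤1 eq = y≡0 , ℤ.+-injective (trans (sym (N-at-y≡0 x)) (trans (cong (λ s → N (x , s)) (sym y≡0)) eq))
    where
    y≡0 : y ≡ 0ℤ
    y≡0 = ℤ.∣i∣≡0⇒i≡0 (small-D-multiple ℤ.∣ y ∣ (ℕ.≤-trans (ℕ.m≤n+m _ _) (subst (ℕ._≤ 4) (4N≡ x y eq) (ℕ.*-monoʳ-≤ 4 m≤1))))

  N≡0⇒≡0 : ∀ z → N z ≡ 0ℤ → z ≡ 0𝕆
  N≡0⇒≡0 (x , y) eq = let (y≡0 , xx≡0) = N≤1⇒rational x y ℕ.z≤n eq
    in cong₂ _,_ (ℤ.∣i∣≡0⇒i≡0 (Sum.reduce (ℕ.m*n≡0⇒m≡0∨n≡0 ℤ.∣ x ∣ xx≡0))) y≡0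

  N≡1⇒±1 : ∀ z → N z ≡ 1ℤ → z ≡ 1𝕆 ⊎ z ≡ (ℤ.- 1ℤ , 0ℤ)
  N≡1⇒±1 (x , y) eq = let (y≡0 , xx≡1) = N≤1⇒rational x y ℕ.≤-refl eq
    in Sum.map (λ p → cong₂ _,_ p y≡0) (λ p → cong₂ _,_ p y≡0) (±1 x (ℕ.m*n≡1⇒m≡1 ℤ.∣ x ∣ ℤ.∣ x ∣ xx≡1))
    where
    ±1 : ∀ x → ℤ.∣ x ∣ ≡ 1 → x ≡ 1ℤ ⊎ x ≡ ℤ.- 1ℤ
    ±1 (+ 1)      _ = inj₁ refl
    ±1 -[1+ 0 ]   _ = inj₂ refl

  ⊗-nonZero : ∀ z w → z ≢ 0𝕆 → w ≢ 0𝕆 → z ⊗ w ≢ 0𝕆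
  ⊗-nonZero z w z≢0 w≢0 eq = [ z≢0 ∘ N≡0⇒≡0 z , w≢0 ∘ N≡0⇒≡0 w ]′
    (ℤ.i*j≡0⇒i≡0∨j≡0 (N z) (trans (sym (N-⊗ z w)) (trans (cong N eq) (N-at-y≡0 0ℤ))))

  opaque
    unfolding _⊗_

    N-mod : ∀ a .{{_ : ℕ.NonZero a}} b → + a ℤ.∣ N (b , 1ℤ) → + a ℤ.∣ N (+ (b %ℕ a) , 1ℤ)
    N-mod a b d = subst (+ a ℤ.∣_)
      (trans (cong (λ s → N (s , 1ℤ) ℤ.- (+ 2 ℤ.* + r ℤ.* q ℤ.+ q ℤ.* q ℤ.* + a ℤ.+ t ℤ.* q) ℤ.* + a) (a≡a%ℕn+[a/ℕn]*n b a)) (eq t n (+ r) q (+ a)))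
      (ℤ.∣m∣n⇒∣m-n d (ℤ.∣n⇒∣m*n (+ 2 ℤ.* + r ℤ.* q ℤ.+ q ℤ.* q ℤ.* + a ℤ.+ t ℤ.* q) ℤ.∣-refl))
      where
      r : ℕ
      r = b %ℕ a
      q : ℤ
      q = b /ℕ a
      eq : ∀ t n r q a →
        (r ℤ.+ q ℤ.* a) ℤ.* (r ℤ.+ q ℤ.* a) ℤ.+ t ℤ.* ((r ℤ.+ q ℤ.* a) ℤ.* 1ℤ) ℤ.+ n ℤ.* (1ℤ ℤ.* 1ℤ)
          ℤ.- (+ 2 ℤ.* r ℤ.* q ℤ.+ q ℤ.* q ℤ.* a ℤ.+ t ℤ.* q) ℤ.* a ≡
        r ℤ.* r ℤ.+ t ℤ.* (r ℤ.* 1ℤ) ℤ.+ n ℤ.* (1ℤ ℤ.* 1ℤ)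
      eq = solve-∀

  opaque
    unfolding _⊗_

    N-shift : ∀ b q a → N (b ℤ.- q ℤ.* a , 1ℤ) ≡ N (b , 1ℤ) ℤ.- (+ 2 ℤ.* b ℤ.* q ℤ.- q ℤ.* q ℤ.* a ℤ.+ t ℤ.* q) ℤ.* a
    N-shift = eq t n
      where
      eq : ∀ t n b q a →
        (b ℤ.- q ℤ.* a) ℤ.* (b ℤ.- q ℤ.* a) ℤ.+ t ℤ.* ((b ℤ.- q ℤ.* a) ℤ.* 1ℤ) ℤ.+ n ℤ.* (1ℤ ℤ.* 1ℤ) ≡
        b ℤ.* b ℤ.+ t ℤ.* (b ℤ.* 1ℤ) ℤ.+ n ℤ.* (1ℤ ℤ.* 1ℤ) ℤ.- (+ 2 ℤ.* b ℤ.* q ℤ.- q ℤ.* q ℤ.* a ℤ.+ t ℤ.* q) ℤ.* a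
      eq = solve-∀

  -- `N (b , 1)` is b² + tb + n, the minimal polynomial of -θ at b. Taking b among the residues in
  -- `Fin p` makes the existence of a root a finite search.
  Root : ℕ → Set
  Root p = ∃[ b ] + p ℤ.∣ N (+ toℕ {p} b , 1ℤ)

  root? : ∀ p → Dec (Root p)
  root? p = Fin.any? (λ b → + p ℤ.∣? N (+ toℕ b , 1ℤ))

  mod-root : ∀ a .{{_ : ℕ.NonZero a}} b → + a ℤ.∣ N (b , 1ℤ) → Root a
  mod-root a b d = fromℕ< (n%ℕd<d b a) , subst (λ r → + a ℤ.∣ N (+ r , 1ℤ)) (sym (Fin.toℕ-fromℕ< (n%ℕd<d b a))) (N-mod a b d)

  opaque
    unfolding _⊗_

    -- If p did not divide y, take u with uy ≡ 1. Then u² N z ≡ `N (u x , 1)` modulo p, so ux would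
    -- be a root. Hence p divides y, then x², then x.
    inert : ∀ {p} → Prime p → ¬ Root p → ∀ z → + p ℤ.∣ N z → (+ p , 0ℤ) ∣ᴼ z
    inert {p} pr noRoot z@(x , y) p∣Nz = quotient p∣x p∣y
      where
      instance
        p-nonZero : ℕ.NonZero p
        p-nonZero = prime⇒nonZero pr

      eq : ∀ t n x y u → u ℤ.* u ℤ.* (x ℤ.* x ℤ.+ t ℤ.* (x ℤ.* y) ℤ.+ n ℤ.* (y ℤ.* y))
        ℤ.- (u ℤ.* y ℤ.- 1ℤ) ℤ.* (t ℤ.* (u ℤ.* x) ℤ.+ n ℤ.* (u ℤ.* y ℤ.+ 1ℤ)) ≡
        (u ℤ.* x) ℤ.* (u ℤ.* x) ℤ.+ t ℤ.* ((u ℤ.* x) ℤ.* 1ℤ) ℤ.+ n ℤ.* (1ℤ ℤ.* 1ℤ)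
      eq = solve-∀
      x²-part : ∀ t n x y → x ℤ.* x ℤ.+ t ℤ.* (x ℤ.* y) ℤ.+ n ℤ.* (y ℤ.* y) ℤ.- y ℤ.* (t ℤ.* x ℤ.+ n ℤ.* y) ≡ x ℤ.* x
      x²-part = solve-∀

      root : (∃[ u ] + p ℤ.∣ u ℤ.* y ℤ.- 1ℤ) → Root p
      root (u , d) = mod-root p (u ℤ.* x) (subst (+ p ℤ.∣_) (eq t n x y u)
        (ℤ.∣m∣n⇒∣m-n (ℤ.∣n⇒∣m*n (u ℤ.* u) p∣Nz) (ℤ.∣m⇒∣m*n (t ℤ.* (u ℤ.* x) ℤ.+ n ℤ.* (u ℤ.* y ℤ.+ 1ℤ)) d)))

      p∣y : + p ℤ.∣ y
      p∣y with + p ℤ.∣? y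
      ... | yes d = d
      ... | no ¬d = contradiction (root (inverse-mod pr y ¬d)) noRoot

      p∣x : + p ℤ.∣ x
      p∣x = Sum.reduce (prime-divides-* pr x x (subst (+ p ℤ.∣_) (x²-part t n x y)
        (ℤ.∣m∣n⇒∣m-n p∣Nz (ℤ.∣m⇒∣m*n (t ℤ.* x ℤ.+ n ℤ.* y) p∣y))))

      quotient : + p ℤ.∣ x → + p ℤ.∣ y → (+ p , 0ℤ) ∣ᴼ z
      quotient (divides k x≡kp) (divides l y≡lp) = (k , l) , trans
        (cong₂ _,_ (trans x≡kp (ℤ.*-comm k (+ p))) (trans y≡lp (ℤ.*-comm l (+ p)))) (sym (integer-⊗ (+ p) (k , l)))

  -- N is positive definite and b + θ is nonzero, so c is positive, being the quotient of
  -- `N (b , 1)` by a positive number.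
  cofactor-positive : ∀ b c a → N (b , 1ℤ) ≡ c ℤ.* + suc a → ∃[ k ] c ≡ + suc k
  cofactor-positive b (+ suc k) a eq = k , refl
  cofactor-positive b (+ zero)  a eq = contradiction (cong proj₂ (N≡0⇒≡0 (b , 1ℤ) eq)) λ ()
  cofactor-positive b -[1+ k ]  a eq = contradiction (trans (sym (4N b 1ℤ)) (cong (+ 4 ℤ.*_) eq)) λ ()

  -- Gauss reduction of the form (a , 2b + t , c) of discriminant −D, tracking
  -- a factorisation of b + θ instead of the change of variables.
  module Reduction (noSmallRoot : ∀ a → 2 ℕ.≤ a → 3 ℕ.* (a ℕ.* a) ℕ.≤ D → ¬ Root a) where

    -- When a divides N(b + θ), the ideal (a, b + θ) has norm a. A divisor π of b + θ with norm a
    -- generates it, so this says that the ideal attached to the form is principal.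
    Factor : ℤ → ℕ → Set
    Factor b a = ∃[ π ] ∃[ ρ ] (π ⊗ ρ ≡ (b , 1ℤ) × N π ≡ + a)

    -- In b + θ = πρ with norm ca and N π = c, the other factor ρ has norm a. This is the exchange
    -- of the outer coefficients of the form.
    swap : ∀ {b a c} .{{_ : ℕ.NonZero c}} → N (b , 1ℤ) ≡ + c ℤ.* + a → Factor b c → Factor b a
    swap {b} {a} {c} eq (π , ρ , πρ , Nπ) = ρ , π , trans (⊗-comm ρ π) πρ ,
      ℤ.*-cancelˡ-≡ (+ c) _ _ (trans (cong (ℤ._* N ρ) (sym Nπ)) (trans (sym (N-⊗ π ρ)) (trans (cong N πρ) eq)))

    -- Because a = π π̄, one has b + θ = (b - qa + θ) + qa = π(ρ + q π̄). This is the translation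
    -- step of the reduction.
    shift-back : ∀ {b a} q → Factor (b ℤ.- q ℤ.* + a) a → Factor b a
    shift-back {b} {a} q (π , ρ , πρ , Nπ) = π , ρ ⊕ (q , 0ℤ) ⊗ conj π , (begin
      π ⊗ (ρ ⊕ (q , 0ℤ) ⊗ conj π)                      ≡⟨ ⊗-distribˡ-⊕ π ρ _ ⟩
      π ⊗ ρ ⊕ π ⊗ ((q , 0ℤ) ⊗ conj π)                  ≡⟨ cong (π ⊗ ρ ⊕_) (⊗-assoc π (q , 0ℤ) (conj π)) ⟨
      π ⊗ ρ ⊕ π ⊗ (q , 0ℤ) ⊗ conj π                    ≡⟨ cong (λ s → π ⊗ ρ ⊕ s ⊗ conj π) (⊗-comm π (q , 0ℤ)) ⟩
      π ⊗ ρ ⊕ (q , 0ℤ) ⊗ π ⊗ conj π                    ≡⟨ cong (π ⊗ ρ ⊕_) (⊗-assoc (q , 0ℤ) π (conj π)) ⟩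
      π ⊗ ρ ⊕ (q , 0ℤ) ⊗ (π ⊗ conj π)                  ≡⟨ cong (λ s → π ⊗ ρ ⊕ (q , 0ℤ) ⊗ s) (trans (⊗-conj π) (cong (_, 0ℤ) Nπ)) ⟩
      π ⊗ ρ ⊕ (q , 0ℤ) ⊗ (+ a , 0ℤ)                    ≡⟨ cong₂ _⊕_ πρ (integer-⊗ q (+ a , 0ℤ)) ⟩
      (b ℤ.- q ℤ.* + a , 1ℤ) ⊕ (q ℤ.* + a , q ℤ.* 0ℤ)  ≡⟨ cong₂ _,_ (cancel b (q ℤ.* + a)) (cong (λ s → 1ℤ ℤ.+ s) (ℤ.*-zeroʳ q)) ⟩
      (b , 1ℤ)                                          ∎) , Nπ
      where
      open ≡-Reasoning
      cancel : ∀ b s → b ℤ.- s ℤ.+ s ≡ b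
      cancel = solve-∀

    -- 4a² ≤ 4ca = (2b + t)² + D ≤ a² + D.
    reduced⇒small : ∀ b a c → ℤ.∣ + 2 ℤ.* b ℤ.+ t ∣ ℕ.≤ a → a ℕ.≤ c → N (b , 1ℤ) ≡ + c ℤ.* + a → 3 ℕ.* (a ℕ.* a) ℕ.≤ D
    reduced⇒small b a c A≤a a≤c eq = ℕ.+-cancelˡ-≤ (a ℕ.* a) _ _ (begin
      4 ℕ.* (a ℕ.* a)          ≤⟨ ℕ.*-monoʳ-≤ 4 (ℕ.*-monoˡ-≤ a a≤c) ⟩
      4 ℕ.* (c ℕ.* a)          ≡⟨ 4N≡ b 1ℤ (trans eq (sym (ℤ.pos-* c a))) ⟩
      A′ ℕ.* A′ ℕ.+ D ℕ.* 1    ≡⟨ cong₂ (λ r s → ℤ.∣ + 2 ℤ.* b ℤ.+ r ∣ ℕ.* ℤ.∣ + 2 ℤ.* b ℤ.+ r ∣ ℕ.+ s) (ℤ.*-identityʳ t) (ℕ.*-identityʳ D) ⟩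
      A ℕ.* A ℕ.+ D            ≤⟨ ℕ.+-monoˡ-≤ D (ℕ.*-mono-≤ A≤a A≤a) ⟩
      a ℕ.* a ℕ.+ D            ∎)
      where
      open ℕ.≤-Reasoning
      A A′ : ℕ
      A = ℤ.∣ + 2 ℤ.* b ℤ.+ t ∣
      A′ = ℤ.∣ + 2 ℤ.* b ℤ.+ t ℤ.* 1ℤ ∣

    factor-one : ∀ b → Factor b 1
    factor-one b = 1𝕆 , (b , 1ℤ) , ⊗-identityˡ (b , 1ℤ) , N-at-y≡0 1ℤ

    mutual
      -- Translation makes |2b + t| at most the norm. After that either the cofactor is smaller, and
      -- the swap continues with it as the new norm, or the form is reduced. The norm decreases at
      -- every swap, which gives termination.
      factor : ∀ a → Acc ℕ._<_ (suc a) → ∀ b c → N (b , 1ℤ) ≡ c ℤ.* + suc a → Factor b (suc a)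
      factor a rec b c eq = shift-back q (factor-centred a rec (b ℤ.- q ℤ.* + suc a) (proj₁ positive)
        (subst (λ s → ℤ.∣ s ∣ ℕ.≤ suc a) (trans (cong (λ s → + 2 ℤ.* b ℤ.+ t ℤ.- q ℤ.* s) (ℤ.pos-* 2 (suc a))) (centre t b q (+ suc a))) (proj₂ centred))
        (trans eq′ (cong (ℤ._* + suc a) (proj₂ positive))))
        where
        centred : ∃[ q ] ℤ.∣ + 2 ℤ.* b ℤ.+ t ℤ.- q ℤ.* + (2 ℕ.* suc a) ∣ ℕ.≤ suc a
        centred = centred-residue (+ 2 ℤ.* b ℤ.+ t) (suc a)
        q c′ : ℤ
        q = proj₁ centred
        c′ = c ℤ.- (+ 2 ℤ.* b ℤ.* q ℤ.- q ℤ.* q ℤ.* + suc a ℤ.+ t ℤ.* q)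
        centre : ∀ t b q a → + 2 ℤ.* b ℤ.+ t ℤ.- q ℤ.* (+ 2 ℤ.* a) ≡ + 2 ℤ.* (b ℤ.- q ℤ.* a) ℤ.+ t
        centre = solve-∀
        collect : ∀ c k a → c ℤ.* a ℤ.- k ℤ.* a ≡ (c ℤ.- k) ℤ.* a
        collect = solve-∀
        eq′ : N (b ℤ.- q ℤ.* + suc a , 1ℤ) ≡ c′ ℤ.* + suc a
        eq′ = trans (N-shift b q (+ suc a)) (trans
          (cong (ℤ._- (+ 2 ℤ.* b ℤ.* q ℤ.- q ℤ.* q ℤ.* + suc a ℤ.+ t ℤ.* q) ℤ.* + suc a) eq)
          (collect c (+ 2 ℤ.* b ℤ.* q ℤ.- q ℤ.* q ℤ.* + suc a ℤ.+ t ℤ.* q) (+ suc a)))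
        positive : ∃[ k ] c′ ≡ + suc k
        positive = cofactor-positive (b ℤ.- q ℤ.* + suc a) c′ a eq′

      factor-centred : ∀ a → Acc ℕ._<_ (suc a) → ∀ b c → ℤ.∣ + 2 ℤ.* b ℤ.+ t ∣ ℕ.≤ suc a →
        N (b , 1ℤ) ≡ + suc c ℤ.* + suc a → Factor b (suc a)
      factor-centred a (acc rec) b c A≤a eq = [ descend , reduced a (A≤a) eq ]′ (ℕ.<-≤-connex (suc c) (suc a))
        where
        descend : suc c ℕ.< suc a → Factor b (suc a)
        descend c<a = swap eq (factor c (rec c<a) b (+ suc a) (trans eq (ℤ.*-comm (+ suc c) (+ suc a))))
        reduced : ∀ a → ℤ.∣ + 2 ℤ.* b ℤ.+ t ∣ ℕ.≤ suc a → N (b , 1ℤ) ≡ + suc c ℤ.* + suc a → suc a ℕ.≤ suc c → Factor b (suc a)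
        reduced zero    A≤a eq a≤c = factor-one b
        -- The norm is now at least 2. It divides `N (b , 1)`, so b is a root modulo it, and the
        -- bound for reduced forms puts it in the range of `noSmallRoot`.
        reduced (suc a) A≤a eq a≤c = contradiction (mod-root (2 ℕ.+ a) b (divides (+ suc c) eq))
          (noSmallRoot (2 ℕ.+ a) (ℕ.s≤s (ℕ.s≤s ℕ.z≤n)) (reduced⇒small b (2 ℕ.+ a) (suc c) A≤a a≤c eq))

    root⇒norm : ∀ a .{{_ : ℕ.NonZero a}} → Root a → ∃[ π ] N π ≡ + a
    root⇒norm (suc a) (b , divides c eq) =
      let (π , _ , _ , Nπ) = factor a (<-wellFounded (suc a)) (+ toℕ b) c eq in π , Nπ

-- Sums of squares over the elements of given norm

prime-divisor : ∀ m → 2 ℕ.≤ m → ∃[ p ] (Prime p × p ℕ.∣ m)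
prime-divisor m@(suc _) 2≤m with factorise m
... | record { factors = [] ; isFactorisation = eq } = contradiction 2≤m (subst (λ k → ¬ 2 ℕ.≤ k) (sym eq) λ { (ℕ.s≤s ()) })
... | record { factors = p ∷ ps ; isFactorisation = eq ; factorsPrime = pr ∷ _ } =
  p , pr , ℕ.divides (product ps) (trans eq (ℕ.*-comm p (product ps)))

-- A shell is a predicate, while a sum needs a list. Two enumerations of one predicate are
-- permutations of each other, so the sum of squares depends on the shell only.
record Enumerates {A : Set} (P : A → Set) (L : List A) : Set where
  field
    unique   : Uniqueˡ L
    sound    : ∀ {z} → z ∈ˡ L → P z
    complete : ∀ {z} → P z → z ∈ˡ L

enumerations-↭ : ∀ {A : Set} {P : A → Set} {L M} → Enumerates P L → Enumerates P M → L ↭ M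
enumerations-↭ e f = ∼bag⇒↭ (unique∧set⇒bag (Enumerates.unique e) (Enumerates.unique f)
  (mk⇔ (Enumerates.complete f ∘ Enumerates.sound e) (Enumerates.complete e ∘ Enumerates.sound f)))

enumerates-map : ∀ {A B : Set} {P : A → Set} {Q : B → Set} {L} (f : A → B) → (∀ {z w} → f z ≡ f w → z ≡ w) →
  (∀ z → P z → Q (f z)) → (∀ w → Q w → ∃[ z ] (P z × w ≡ f z)) → Enumerates P L → Enumerates Q (map f L)
enumerates-map {Q = Q} f inj to from e = record
  { unique   = map⁺ inj (Enumerates.unique e)
  ; sound    = λ w∈ → let (z , z∈ , eq) = ∈-map⁻ f w∈ in subst Q (sym eq) (to z (Enumerates.sound e z∈))
  ; complete = λ {w} q → let (z , p , eq) = from w q in subst (_∈ˡ _) (sym eq) (∈-map⁺ f (Enumerates.complete e p))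
  }

enumerates-++ : ∀ {A : Set} {P Q R : A → Set} {L M} → (∀ z → P z → ¬ Q z) →
  (∀ z → P z → R z) → (∀ z → Q z → R z) → (∀ z → R z → P z ⊎ Q z) →
  Enumerates P L → Enumerates Q M → Enumerates R (L ++ M)
enumerates-++ {L = L} disjoint P⇒R Q⇒R split e f = record
  { unique   = ++⁺ (Enumerates.unique e) (Enumerates.unique f) (λ (z∈L , z∈M) → disjoint _ (Enumerates.sound e z∈L) (Enumerates.sound f z∈M))
  ; sound    = λ z∈ → [ P⇒R _ ∘ Enumerates.sound e , Q⇒R _ ∘ Enumerates.sound f ]′ (∈-++⁻ L z∈)
  ; complete = λ r → [ ∈-++⁺ˡ ∘ Enumerates.complete e , ∈-++⁺ʳ L ∘ Enumerates.complete f ]′ (split _ r)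
  }

enumerates-resp : ∀ {A : Set} {P Q : A → Set} {L} → (∀ z → P z → Q z) → (∀ z → Q z → P z) → Enumerates P L → Enumerates Q L
enumerates-resp P⇒Q Q⇒P e = record { unique = Enumerates.unique e ; sound = P⇒Q _ ∘ Enumerates.sound e ; complete = Enumerates.complete e ∘ Q⇒P _ }

-- `noSmallRoot` leaves no reduced form with first coefficient at least 2, which forces class number
-- one.
module ClassNumberOne (t n : ℤ) (D : ℕ) (disc : + 4 ℤ.* n ≡ t ℤ.* t ℤ.+ + D) (4<D : 4 ℕ.< D)
  (noSmallRoot : ∀ a → 2 ℕ.≤ a → 3 ℕ.* (a ℕ.* a) ℕ.≤ D → ¬ Imaginary.Root t n D disc 4<D a) where

  open Order t n
  open Imaginary t n D disc 4<D
  open Reduction noSmallRoot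

  ∑² : List 𝕆 → 𝕆
  ∑² = foldr (λ z s → z ⊗ z ⊕ s) 0𝕆

  ⊕-assoc : ∀ z w q → (z ⊕ w) ⊕ q ≡ z ⊕ (w ⊕ q)
  ⊕-assoc (x , y) (u , v) (k , l) = cong₂ _,_ (ℤ.+-assoc x u k) (ℤ.+-assoc y v l)

  ⊕-comm : ∀ z w → z ⊕ w ≡ w ⊕ z
  ⊕-comm (x , y) (u , v) = cong₂ _,_ (ℤ.+-comm x u) (ℤ.+-comm y v)

  ⊕-identityˡ : ∀ z → 0𝕆 ⊕ z ≡ z
  ⊕-identityˡ (x , y) = cong₂ _,_ (ℤ.+-identityˡ x) (ℤ.+-identityˡ y)

  ∑²-++ : ∀ L M → ∑² (L ++ M) ≡ ∑² L ⊕ ∑² M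
  ∑²-++ []      M = sym (⊕-identityˡ (∑² M))
  ∑²-++ (z ∷ L) M = trans (cong (z ⊗ z ⊕_) (∑²-++ L M)) (sym (⊕-assoc (z ⊗ z) (∑² L) (∑² M)))

  ∑²-map : ∀ α L → ∑² (map (α ⊗_) L) ≡ α ⊗ α ⊗ ∑² L
  ∑²-map α []      = sym (⊗-zeroʳ (α ⊗ α))
  ∑²-map α (z ∷ L) = trans (cong₂ _⊕_ (⊗-interchange α z α z) (∑²-map α L)) (sym (⊗-distribˡ-⊕ (α ⊗ α) (z ⊗ z) (∑² L)))

  ∑²-↭ : ∀ {L M} → L ↭ M → ∑² L ≡ ∑² M
  ∑²-↭ Perm.refl = refl
  ∑²-↭ (Perm.prep z p) = cong (z ⊗ z ⊕_) (∑²-↭ p)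
  ∑²-↭ (Perm.swap z w p) = trans (sym (⊕-assoc (z ⊗ z) (w ⊗ w) _)) (trans
    (cong₂ _⊕_ (⊕-comm (z ⊗ z) (w ⊗ w)) (∑²-↭ p)) (⊕-assoc (w ⊗ w) (z ⊗ z) _))
  ∑²-↭ (Perm.trans p q) = trans (∑²-↭ p) (∑²-↭ q)

  HasNorm : ℕ → 𝕆 → Set
  HasNorm m z = N z ≡ + m

  N-multiple : ∀ α {k} w {m} → N α ≡ + k → HasNorm m w → HasNorm (k ℕ.* m) (α ⊗ w)
  N-multiple α {k} w {m} Nα Nw = trans (N-⊗ α w) (trans (cong₂ ℤ._*_ Nα Nw) (sym (ℤ.pos-* k m)))

  N-quotient : ∀ α {k} .{{_ : ℕ.NonZero k}} w {m} → N α ≡ + k → HasNorm (k ℕ.* m) (α ⊗ w) → HasNorm m w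
  N-quotient α {suc k} w {m} Nα eq = ℤ.*-cancelˡ-≡ (+ suc k) _ _
    (trans (cong (ℤ._* N w) (sym Nα)) (trans (sym (N-⊗ α w)) (trans eq (ℤ.pos-* (suc k) m))))

  ⊗-injective : ∀ α {k} .{{_ : ℕ.NonZero k}} → N α ≡ + k → ∀ {z w} → α ⊗ z ≡ α ⊗ w → z ≡ w
  ⊗-injective α {k} Nα = ⊗-cancelˡ α {{subst ℤ.NonZero (sym Nα) (pos k)}}
    where
    pos : ∀ k .{{_ : ℕ.NonZero k}} → ℤ.NonZero (+ k)
    pos (suc k) = _

  norm≢0 : ∀ α {k} .{{_ : ℕ.NonZero k}} → N α ≡ + k → α ≢ 0𝕆
  norm≢0 α {suc k} Nα refl = contradiction (trans (sym Nα) (N-at-y≡0 0ℤ)) λ ()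

  -- Finiteness of the shell is part of the claim: the induction constructs an enumeration together
  -- with its nonzero sum. The list coming from a design is compared with it only at the end.
  Nonvanishing : ℕ → Set
  Nonvanishing m = ∃[ L ] (Enumerates (HasNorm m) L × ∑² L ≢ 0𝕆)

  nonvanishing-one : Nonvanishing 1
  nonvanishing-one = L , enumerates , λ ∑≡0 → contradiction (trans (sym ∑L) ∑≡0) λ ()
    where
    L : List 𝕆
    L = 1𝕆 ∷ (ℤ.- 1ℤ , 0ℤ) ∷ []
    ∑L : ∑² L ≡ (+ 2 , 0ℤ)
    ∑L = cong₂ (λ z w → z ⊕ (w ⊕ 0𝕆)) (integer-⊗ 1ℤ 1𝕆) (integer-⊗ (ℤ.- 1ℤ) (ℤ.- 1ℤ , 0ℤ))
    enumerates : Enumerates (HasNorm 1) L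
    enumerates = record
      { unique   = ((λ ()) ∷ []) ∷ [] ∷ []
      ; sound    = λ { (here refl) → N-at-y≡0 1ℤ ; (there (here refl)) → N-at-y≡0 (ℤ.- 1ℤ) }
      ; complete = λ {z} eq → [ here , there ∘ here ]′ (N≡1⇒±1 z eq)
      }

  -- Multiplication by α is a bijection from norm m to norm km and scales the sum by α², which is
  -- nonzero. It serves ramified primes with α = π, and inert primes with α = p and k = p².
  nonvanishing-multiple : ∀ α k .{{_ : ℕ.NonZero k}} → N α ≡ + k → ∀ {m} →
    (∀ z → HasNorm (k ℕ.* m) z → α ∣ᴼ z) → Nonvanishing m → Nonvanishing (k ℕ.* m)
  nonvanishing-multiple α k Nα {m} α∣ (L , e , ∑≢0) = map (α ⊗_) L ,
    enumerates-map (α ⊗_) (⊗-injective α Nα) (λ w → N-multiple α w Nα)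
      (λ z Nz → let (w , eq) = α∣ z Nz in w , N-quotient α w Nα (trans (cong N (sym eq)) Nz) , eq) e ,
    λ eq → ⊗-nonZero (α ⊗ α) (∑² L) (⊗-nonZero α α α≢0 α≢0) ∑≢0 (trans (sym (∑²-map α L)) eq)
    where
    α≢0 : α ≢ 0𝕆
    α≢0 = norm≢0 α Nα

  module Split {p} (p-prime : Prime p) (π : 𝕆) (Nπ : N π ≡ + p) (π∤π̄ : ¬ π ∣ᴼ conj π) where

    open PrimeElement p-prime π Nπ

    private
      instance
        p-nonZero : ℕ.NonZero p
        p-nonZero = prime⇒nonZero p-prime

    Nπ̄ : N (conj π) ≡ + p
    Nπ̄ = trans (N-conj π) Nπ

    π∣⇒p∣N : ∀ z m → HasNorm m z → π ∣ᴼ z → p ℕ.∣ m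
    π∣⇒p∣N z m Nz (w , eq) = ℤ.∣⇒∣ᵤ (divides (N w) (trans (sym Nz) (trans (cong N eq)
      (trans (N-⊗ π w) (trans (cong (ℤ._* N w) Nπ) (ℤ.*-comm (+ p) (N w)))))))

    ∣ᴼ-⊕-cancelˡ : ∀ z w → π ∣ᴼ z → π ∣ᴼ z ⊕ w → π ∣ᴼ w
    ∣ᴼ-⊕-cancelˡ z@(x , y) w@(u , v) d e = p∣residue⇒π∣ w (ℤ.∣m+n∣m⇒∣n
      (subst (+ p ℤ.∣_) (eq (proj₁ π) (proj₂ π) x y u v) (π∣⇒p∣residue (z ⊕ w) e)) (π∣⇒p∣residue z d))
      where
      eq : ∀ a b x y u v → a ℤ.* (y ℤ.+ v) ℤ.- b ℤ.* (x ℤ.+ u) ≡ (a ℤ.* y ℤ.- b ℤ.* x) ℤ.+ (a ℤ.* v ℤ.- b ℤ.* u)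
      eq = solve-∀

    π∤1 : ¬ π ∣ᴼ 1𝕆
    π∤1 d = ¬prime[1] (subst Prime (ℕ.∣1⇒≡1 (π∣⇒p∣N 1𝕆 1 (N-at-y≡0 1ℤ) d)) p-prime)

    π∤⊗ : ∀ z w → ¬ π ∣ᴼ z → ¬ π ∣ᴼ w → ¬ π ∣ᴼ z ⊗ w
    π∤⊗ z w ¬z ¬w d = [ ¬z , ¬w ]′ (π-prime z w d)

    -- With p^k ∥ m, v is v_k and u is π̄^{2k}, while s is the sum for m / p^k.
    record LocalFactor (m : ℕ) : Set where
      field
        all prim         : List 𝕆
        v u s            : 𝕆
        enumerates-all   : Enumerates (HasNorm m) all
        enumerates-prim  : Enumerates (λ z → HasNorm m z × ¬ π ∣ᴼ z) prim
        ∑-all            : ∑² all ≡ v ⊗ s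
        ∑-prim           : ∑² prim ≡ u ⊗ s
        π∤v              : ¬ π ∣ᴼ v
        π∤u              : ¬ π ∣ᴼ u
        s≢0              : s ≢ 0𝕆

    -- An element divisible by π has norm divisible by p, so for m prime to p the two lists
    -- coincide. This is k = 0.
    localFactor-base : ∀ {m} → ¬ p ℕ.∣ m → Nonvanishing m → LocalFactor m
    localFactor-base {m} p∤m (L , e , ∑≢0) = record
      { all = L ; prim = L ; v = 1𝕆 ; u = 1𝕆 ; s = ∑² L
      ; enumerates-all  = e
      ; enumerates-prim = enumerates-resp (λ z Nz → Nz , p∤m ∘ π∣⇒p∣N z m Nz) (λ z → proj₁) e
      ; ∑-all  = sym (⊗-identityˡ (∑² L))
      ; ∑-prim = sym (⊗-identityˡ (∑² L))
      ; π∤v = π∤1 ; π∤u = π∤1 ; s≢0 = ∑≢0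
      }

    -- The elements of norm pm that π divides are π times all elements of norm m. The others are
    -- divisible by π̄, and their quotients are again not divisible by π, so they are π̄ times the
    -- list `prim`. The new v is π² v plus the new u; π divides the first summand and not the
    -- second.
    localFactor-step : ∀ {m} → LocalFactor m → LocalFactor (p ℕ.* m)
    localFactor-step {m} F = record
      { all = map (π ⊗_) all ++ prim′ ; prim = prim′
      ; v = π ⊗ π ⊗ v ⊕ u′ ; u = u′ ; s = s
      ; enumerates-all  = enumerates-++ (λ z p q → proj₂ q (proj₂ p)) (λ z → proj₁) (λ z → proj₁) π∣⊎π∤ multiples e′
      ; enumerates-prim = e′
      ; ∑-all = ∑-all′
      ; ∑-prim = ∑-prim′
      ; π∤v = λ d → π∤u′ (∣ᴼ-⊕-cancelˡ (π ⊗ π ⊗ v) u′ (π ⊗ v , ⊗-assoc π π v) d)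
      ; π∤u = π∤u′
      ; s≢0 = s≢0
      }
      where
      open LocalFactor F
      open ≡-Reasoning
      prim′ : List 𝕆
      prim′ = map (conj π ⊗_) prim
      u′ : 𝕆
      u′ = conj π ⊗ conj π ⊗ u

      π∤u′ : ¬ π ∣ᴼ u′
      π∤u′ = π∤⊗ (conj π ⊗ conj π) u (π∤⊗ (conj π) (conj π) π∤π̄ π∤π̄) π∤u

      π∣⊎π∤ : ∀ z → HasNorm (p ℕ.* m) z → (HasNorm (p ℕ.* m) z × π ∣ᴼ z) ⊎ (HasNorm (p ℕ.* m) z × ¬ π ∣ᴼ z)
      π∣⊎π∤ z Nz with π∣? z
      ... | yes d = inj₁ (Nz , d)
      ... | no ¬d = inj₂ (Nz , ¬d)

      multiples : Enumerates (λ z → HasNorm (p ℕ.* m) z × π ∣ᴼ z) (map (π ⊗_) all)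
      multiples = enumerates-map (π ⊗_) (⊗-injective π Nπ) (λ w Nw → N-multiple π w Nπ Nw , w , refl)
        (λ { z (Nz , w , eq) → w , N-quotient π w Nπ (trans (cong N (sym eq)) Nz) , eq }) enumerates-all

      π̄∣ : ∀ z → HasNorm (p ℕ.* m) z → ¬ π ∣ᴼ z → conj π ∣ᴼ z
      π̄∣ z Nz ¬d = [ (λ d → contradiction d ¬d) , (λ d → d) ]′
        (p∣N⇒π∣⊎π̄∣ p-prime π Nπ z (divides (+ m) (trans Nz (trans (ℤ.pos-* p m) (ℤ.*-comm (+ p) (+ m))))))

      e′ : Enumerates (λ z → HasNorm (p ℕ.* m) z × ¬ π ∣ᴼ z) prim′
      e′ = enumerates-map (conj π ⊗_) (⊗-injective (conj π) Nπ̄)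
        (λ { w (Nw , ¬d) → N-multiple (conj π) w Nπ̄ Nw , π∤⊗ (conj π) w π∤π̄ ¬d })
        (λ { z (Nz , ¬d) → let (w , eq) = π̄∣ z Nz ¬d in
          w , (N-quotient (conj π) w Nπ̄ (trans (cong N (sym eq)) Nz) ,
            λ d → ¬d (subst (π ∣ᴼ_) (trans (⊗-comm w (conj π)) (sym eq)) (∣ᴼ-⊗ w (conj π) d))) , eq }) enumerates-prim

      ∑-prim′ : ∑² prim′ ≡ u′ ⊗ s
      ∑-prim′ = begin
        ∑² prim′                       ≡⟨ ∑²-map (conj π) prim ⟩
        conj π ⊗ conj π ⊗ ∑² prim     ≡⟨ cong (conj π ⊗ conj π ⊗_) ∑-prim ⟩
        conj π ⊗ conj π ⊗ (u ⊗ s)     ≡⟨ ⊗-assoc (conj π ⊗ conj π) u s ⟨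
        u′ ⊗ s                         ∎

      ∑-all′ : ∑² (map (π ⊗_) all ++ prim′) ≡ (π ⊗ π ⊗ v ⊕ u′) ⊗ s
      ∑-all′ = begin
        ∑² (map (π ⊗_) all ++ prim′)          ≡⟨ ∑²-++ (map (π ⊗_) all) prim′ ⟩
        ∑² (map (π ⊗_) all) ⊕ ∑² prim′        ≡⟨ cong₂ _⊕_ (∑²-map π all) ∑-prim′ ⟩
        π ⊗ π ⊗ ∑² all ⊕ u′ ⊗ s               ≡⟨ cong (λ q → π ⊗ π ⊗ q ⊕ u′ ⊗ s) ∑-all ⟩
        π ⊗ π ⊗ (v ⊗ s) ⊕ u′ ⊗ s              ≡⟨ cong (_⊕ u′ ⊗ s) (⊗-assoc (π ⊗ π) v s) ⟨
        π ⊗ π ⊗ v ⊗ s ⊕ u′ ⊗ s                ≡⟨ cong₂ _⊕_ (⊗-comm (π ⊗ π ⊗ v) s) (⊗-comm u′ s) ⟩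
        s ⊗ (π ⊗ π ⊗ v) ⊕ s ⊗ u′              ≡⟨ ⊗-distribˡ-⊕ s (π ⊗ π ⊗ v) u′ ⟨
        s ⊗ (π ⊗ π ⊗ v ⊕ u′)                  ≡⟨ ⊗-comm s (π ⊗ π ⊗ v ⊕ u′) ⟩
        (π ⊗ π ⊗ v ⊕ u′) ⊗ s                  ∎

    localFactor⇒nonvanishing : ∀ {m} → LocalFactor m → Nonvanishing m
    localFactor⇒nonvanishing F = all , enumerates-all , λ eq → ⊗-nonZero v s v≢0 s≢0 (trans (sym ∑-all) eq)
      where
      open LocalFactor F
      v≢0 : v ≢ 0𝕆
      v≢0 eq = π∤v (subst (π ∣ᴼ_) (sym eq) (0𝕆 , sym (⊗-zeroʳ π)))

    -- One of π and π̄ divides the given element. The quotient shows that the smaller shell is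
    -- nonempty, as the induction hypothesis requires.
    divide : ∀ m → ∃ (HasNorm (p ℕ.* m)) → ∃ (HasNorm m)
    divide m (z , Nz) = [ (λ (w , eq) → w , N-quotient π w Nπ (trans (cong N (sym eq)) Nz))
                        , (λ (w , eq) → w , N-quotient (conj π) w Nπ̄ (trans (cong N (sym eq)) Nz)) ]′
      (p∣N⇒π∣⊎π̄∣ p-prime π Nπ z (divides (+ m) (trans Nz (trans (ℤ.pos-* p m) (ℤ.*-comm (+ p) (+ m))))))

    -- The recursion strips all factors p from m and calls `nonvanishing` at the part prime to p,
    -- which is not known in advance; hence the assumption for every k up to m.
    localFactor : ∀ m → Acc ℕ._<_ m → .{{_ : ℕ.NonZero m}} →
      (∀ k → .{{_ : ℕ.NonZero k}} → k ℕ.≤ m → ∃ (HasNorm k) → Nonvanishing k) → ∃ (HasNorm m) → LocalFactor m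
    localFactor m (acc rec) nonvanishing w with p ℕ.∣? m
    ... | no p∤m = localFactor-base p∤m (nonvanishing m ℕ.≤-refl w)
    ... | yes (ℕ.divides q eq) = subst LocalFactor (sym eq′) (localFactor-step
          (localFactor q (rec q<m) {{q≢0}} (λ k k≤q → nonvanishing k (ℕ.≤-trans k≤q (ℕ.<⇒≤ q<m)))
            (divide q (subst (λ k → ∃ (HasNorm k)) eq′ w))))
      where
      eq′ : m ≡ p ℕ.* q
      eq′ = trans eq (ℕ.*-comm q p)
      q≢0 : ℕ.NonZero q
      q≢0 = ℕ.m*n≢0⇒m≢0 q {{subst ℕ.NonZero eq it}}
      q<m : q ℕ.< m
      q<m = subst (q ℕ.<_) (sym eq) (ℕ.m<m*n q p {{q≢0}} (ℕ.nonTrivial⇒n>1 p {{prime⇒nonTrivial p-prime}}))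

  nonvanishing : ∀ m → Acc ℕ._<_ m → .{{_ : ℕ.NonZero m}} → ∃ (HasNorm m) → Nonvanishing m
  nonvanishing (suc zero) _ _ = nonvanishing-one
  nonvanishing m@(suc (suc m-2)) (acc rec) w = by-prime (prime-divisor m (ℕ.s≤s (ℕ.s≤s ℕ.z≤n)))
    where
    by-prime : ∃[ p ] (Prime p × p ℕ.∣ m) → Nonvanishing m
    by-prime (p , p-prime , ℕ.divides q eq) = [ split-or-ramified , inert-case ]′ (dec (root? p))
      where
      dec : ∀ {A : Set} → Dec A → A ⊎ ¬ A
      dec (yes a) = inj₁ a
      dec (no ¬a) = inj₂ ¬a

      instance
        p≢0 : ℕ.NonZero p
        p≢0 = prime⇒nonZero p-prime
        q≢0 : ℕ.NonZero q
        q≢0 = ℕ.m*n≢0⇒m≢0 q {{subst ℕ.NonZero eq _}}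

      eq′ : m ≡ p ℕ.* q
      eq′ = trans eq (ℕ.*-comm q p)

      q<m : q ℕ.< m
      q<m = subst (q ℕ.<_) (sym eq) (ℕ.m<m*n q p (ℕ.nonTrivial⇒n>1 p {{prime⇒nonTrivial p-prime}}))

      w′ : ∃ (HasNorm (p ℕ.* q))
      w′ = subst (λ k → ∃ (HasNorm k)) eq′ w

      p∣N : ∀ z → HasNorm (p ℕ.* q) z → + p ℤ.∣ N z
      p∣N z Nz = divides (+ q) (trans Nz (trans (ℤ.pos-* p q) (ℤ.*-comm (+ p) (+ q))))

      split-or-ramified : Root p → Nonvanishing m
      split-or-ramified root = subst Nonvanishing (sym eq′) (case-π (root⇒norm p root))
        where
        case-π : ∃[ π ] N π ≡ + p → Nonvanishing (p ℕ.* q)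
        case-π (π , Nπ) with PrimeElement.π∣? p-prime π Nπ (conj π)
        -- Ramified case: π̄ is a multiple of π, so every element of norm pq is divisible by π,
        -- whichever of the two divides it.
        ... | yes (ε , π̄≡πε) = nonvanishing-multiple π p Nπ π∣
              (nonvanishing q (rec q<m) (proj₁ (π∣ (proj₁ w′) (proj₂ w′)) ,
                N-quotient π _ Nπ (trans (cong N (sym (proj₂ (π∣ (proj₁ w′) (proj₂ w′))))) (proj₂ w′))))
          where
          π∣ : ∀ z → HasNorm (p ℕ.* q) z → π ∣ᴼ z
          π∣ z Nz = [ (λ d → d) , (λ (w , eq) → ε ⊗ w , trans eq (trans (cong (_⊗ w) π̄≡πε) (⊗-assoc π ε w))) ]′
            (p∣N⇒π∣⊎π̄∣ p-prime π Nπ z (p∣N z Nz))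
        -- Split case: one step is made here, so that the induction hypothesis is called only for
        -- numbers at most q, hence below m.
        ... | no π∤π̄ = localFactor⇒nonvanishing (localFactor-step (localFactor q (<-wellFounded q)
              (λ k k≤q → nonvanishing k (rec (ℕ.≤-<-trans k≤q q<m))) (divide q w′)))
          where open Split p-prime π Nπ π∤π̄

      inert-case : ¬ Root p → Nonvanishing m
      -- The given element of norm m is p times some `y`, so p² divides m. The induction continues
      -- at k = m / p², with `y` as the element of norm k.
      inert-case noRoot = subst Nonvanishing (sym m≡p²k) (nonvanishing-multiple (+ p , 0ℤ) (p ℕ.* p) Np
        (λ z Nz → p∣z z (divides (+ (p ℕ.* k)) (trans Nz (trans (cong +_ (ℕ.*-assoc p p k)) (trans (ℤ.pos-* p (p ℕ.* k)) (ℤ.*-comm (+ p) _))))))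
        (nonvanishing k (rec k<m) (y , Ny)))
        where
        instance
          pp≢0 : ℕ.NonZero (p ℕ.* p)
          pp≢0 = ℕ.m*n≢0 p p
        p∣z : ∀ z → + p ℤ.∣ N z → (+ p , 0ℤ) ∣ᴼ z
        p∣z = inert p-prime noRoot
        Np : N (+ p , 0ℤ) ≡ + (p ℕ.* p)
        Np = N-at-y≡0 (+ p)
        y : 𝕆
        y = proj₁ (p∣z (proj₁ w′) (p∣N (proj₁ w′) (proj₂ w′)))
        Npy : N ((+ p , 0ℤ) ⊗ y) ≡ + m
        Npy = trans (cong N (sym (proj₂ (p∣z (proj₁ w′) (p∣N (proj₁ w′) (proj₂ w′)))))) (trans (proj₂ w′) (cong +_ (sym eq′)))
        p²∣m : p ℕ.* p ℕ.∣ m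
        p²∣m = ℤ.∣⇒∣ᵤ {+ (p ℕ.* p)} (divides (N y) (trans (sym Npy) (trans (N-⊗ (+ p , 0ℤ) y) (trans (cong (ℤ._* N y) Np) (ℤ.*-comm (+ (p ℕ.* p)) (N y))))))
        k : ℕ
        k = ℕ.quotient p²∣m
        m≡p²k : m ≡ p ℕ.* p ℕ.* k
        m≡p²k = ℕ.m∣n⇒n≡m*quotient p²∣m
        Ny : HasNorm k y
        Ny = N-quotient (+ p , 0ℤ) y Np (trans Npy (cong +_ m≡p²k))
        instance
          k≢0 : ℕ.NonZero k
          k≢0 = ℕ.m*n≢0⇒n≢0 (p ℕ.* p) {{subst ℕ.NonZero m≡p²k _}}
        k<m : k ℕ.< m
        k<m = subst (k ℕ.<_) (trans (ℕ.*-comm k (p ℕ.* p)) (sym m≡p²k)) (ℕ.m<m*n k (p ℕ.* p)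
          (ℕ.<-≤-trans (ℕ.nonTrivial⇒n>1 p {{prime⇒nonTrivial p-prime}}) (ℕ.m≤m*n p p)))

  ∑²-shell≢0 : ∀ m .{{_ : ℕ.NonZero m}} L → Enumerates (HasNorm m) L → ∃ (HasNorm m) → ∑² L ≢ 0𝕆
  ∑²-shell≢0 m L e w ∑≡0 =
    let (M , f , ∑≢0) = nonvanishing m (<-wellFounded m) w
    in ∑≢0 (trans (∑²-↭ (enumerations-↭ f e)) ∑≡0)

-- Real numbers

opaque
  ι : ℤ → ℚ
  ι a = a ℚ./ 1

  ι-/ : ∀ a n → a ℚ./ suc n ≡ ι a ℚ.* (+ 1 ℚ./ suc n)
  ι-/ a n = ℚ.toℚᵘ-injective (ℚᵘ.≃-trans (ℚ.toℚᵘ-fromℚᵘ (ℚᵘ.mkℚᵘ a n))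
    (ℚᵘ.≃-trans (ℚᵘ.*≡* (cong₂ ℤ._*_ (sym (ℤ.*-identityʳ a)) (cong +_ (ℕ.*-identityˡ (suc n)))))
      (ℚᵘ.≃-sym (ℚᵘ.≃-trans (ℚ.toℚᵘ-homo-* (a ℚ./ 1) (+ 1 ℚ./ suc n))
        (ℚᵘ.*-cong (ℚ.toℚᵘ-fromℚᵘ (ℚᵘ.mkℚᵘ a 0)) (ℚ.toℚᵘ-fromℚᵘ (ℚᵘ.mkℚᵘ (+ 1) n)))))))

  ι-def : ∀ a → a ℚ./ 1 ≡ ι a
  ι-def a = refl

  ι-+ : ∀ a b → ι (a ℤ.+ b) ≡ ι a ℚ.+ ι b
  ι-+ a b = ℚ.toℚᵘ-injective (ℚᵘ.≃-trans (ℚ.toℚᵘ-fromℚᵘ (ℚᵘ.mkℚᵘ (a ℤ.+ b) 0))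
    (ℚᵘ.≃-trans (ℚᵘ.*≡* (cong (ℤ._* + 1) (cong₂ ℤ._+_ (sym (ℤ.*-identityʳ a)) (sym (ℤ.*-identityʳ b)))))
      (ℚᵘ.≃-sym (ℚᵘ.≃-trans (ℚ.toℚᵘ-homo-+ (a ℚ./ 1) (b ℚ./ 1))
        (ℚᵘ.+-cong (ℚ.toℚᵘ-fromℚᵘ (ℚᵘ.mkℚᵘ a 0)) (ℚ.toℚᵘ-fromℚᵘ (ℚᵘ.mkℚᵘ b 0)))))))

  ι-* : ∀ a b → ι (a ℤ.* b) ≡ ι a ℚ.* ι b
  ι-* a b = ℚ.toℚᵘ-injective (ℚᵘ.≃-trans (ℚ.toℚᵘ-fromℚᵘ (ℚᵘ.mkℚᵘ (a ℤ.* b) 0))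
    (ℚᵘ.≃-trans (ℚᵘ.*≡* refl)
      (ℚᵘ.≃-sym (ℚᵘ.≃-trans (ℚ.toℚᵘ-homo-* (a ℚ./ 1) (b ℚ./ 1))
        (ℚᵘ.*-cong (ℚ.toℚᵘ-fromℚᵘ (ℚᵘ.mkℚᵘ a 0)) (ℚ.toℚᵘ-fromℚᵘ (ℚᵘ.mkℚᵘ b 0)))))))

  ι-injective : ∀ {a b} → ι a ≡ ι b → a ≡ b
  ι-injective {a} {b} eq = trans (sym (ℤ.*-identityʳ a)) (trans (ℚᵘ.drop-*≡*
    (ℚᵘ.≃-trans (ℚᵘ.≃-sym (ℚ.toℚᵘ-fromℚᵘ (ℚᵘ.mkℚᵘ a 0)))
      (ℚᵘ.≃-trans (ℚᵘ.≃-reflexive (cong ℚ.toℚᵘ eq)) (ℚ.toℚᵘ-fromℚᵘ (ℚᵘ.mkℚᵘ b 0)))))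
    (ℤ.*-identityʳ b))

  ι-0 : ι 0ℤ ≡ 0ℚ
  ι-0 = refl

  ι-1 : ι 1ℤ ≡ 1ℚ
  ι-1 = refl

  ι-mono-≤ : ∀ {a b} → a ℤ.≤ b → ι a ℚ.≤ ι b
  ι-mono-≤ {a} {b} a≤b = ℚ.toℚᵘ-cancel-≤
    (ℚᵘ.≤-respˡ-≃ (ℚᵘ.≃-sym (ℚ.toℚᵘ-fromℚᵘ (ℚᵘ.mkℚᵘ a 0)))
      (ℚᵘ.≤-respʳ-≃ (ℚᵘ.≃-sym (ℚ.toℚᵘ-fromℚᵘ (ℚᵘ.mkℚᵘ b 0)))
        (ℚᵘ.*≤* (subst₂ ℤ._≤_ (sym (ℤ.*-identityʳ a)) (sym (ℤ.*-identityʳ b)) a≤b))))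

ι-neg : ∀ a → ι (ℤ.- a) ≡ ℚ.- ι a
ι-neg a = begin
  ι (ℤ.- a)                    ≡⟨ solve 2 (λ x y → x := x :+ y :- y) refl (ι (ℤ.- a)) (ι a) ⟩
  ι (ℤ.- a) ℚ.+ ι a ℚ.- ι a    ≡⟨ cong (ℚ._- ι a) (ι-+ (ℤ.- a) a) ⟨
  ι (ℤ.- a ℤ.+ a) ℚ.- ι a      ≡⟨ cong (λ s → ι s ℚ.- ι a) (ℤ.+-inverseˡ a) ⟩
  ι 0ℤ ℚ.- ι a                 ≡⟨ cong (ℚ._- ι a) ι-0 ⟩
  0ℚ ℚ.- ι a                   ≡⟨ ℚ.+-identityˡ (ℚ.- ι a) ⟩
  ℚ.- ι a                      ∎
  where
  open ≡-Reasoning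
  open ℚ.+-*-Solver

-- _≃_ unfolds to a function type; the wrapper lets Agda infer its arguments.
infix 4 _≋_

record _≋_ (x y : ℝ) : Set where
  constructor ⟪_⟫
  field unwrap : x ≃ y

open _≋_

≋-refl : ∀ {x} → x ≋ x
≋-refl {x} = ⟪ ≃-refl {x} ⟫

≋-sym : ∀ {x y} → x ≋ y → y ≋ x
≋-sym {x} {y} ⟪ p ⟫ = ⟪ ≃-sym {x} {y} p ⟫

≋-trans : ∀ {x y z} → x ≋ y → y ≋ z → x ≋ z
≋-trans {x} {y} {z} ⟪ p ⟫ ⟪ q ⟫ = ⟪ ≃-trans {x} {y} {z} p q ⟫

≋-setoid : Setoid _ _
≋-setoid = record
  { Carrier = ℝ ; _≈_ = _≋_
  ; isEquivalence = record { refl = ≋-refl ; sym = ≋-sym ; trans = ≋-trans } }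

pointwise : ∀ {x y} → (∀ n → seq x n ≡ seq y n) → x ≋ y
pointwise {x} {y} eq = ⟪ (λ ε 0<ε → 0 , λ n _ → subst (ℚ._< ε)
  (sym (trans (cong (λ s → ∣ s ℚ.- seq y n ∣) (eq n)) (cong ∣_∣ (ℚ.+-inverseʳ (seq y n))))) 0<ε) ⟫

+-cong : ∀ {x y u v} → x ≋ y → u ≋ v → x + u ≋ y + v
+-cong {x} {y} {u} {v} ⟪ p ⟫ ⟪ q ⟫ = ⟪ (λ ε 0<ε →
  let (M , g) = p (½ ℚ.* ε) (0<½* 0<ε)
      (N , h) = q (½ ℚ.* ε) (0<½* 0<ε)
  in M ℕ.⊔ N , λ n le → subst₂ ℚ._<_ (cong ∣_∣ (+-split (seq x n) (seq y n) (seq u n) (seq v n))) (halves ε)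
    (ℚ.≤-<-trans (ℚ.∣p+q∣≤∣p∣+∣q∣ (seq x n ℚ.- seq y n) (seq u n ℚ.- seq v n))
      (ℚ.+-mono-< (g n (ℕ.≤-trans (ℕ.m≤m⊔n M N) le)) (h n (ℕ.≤-trans (ℕ.m≤n⊔m M N) le))))) ⟫

-‿cong : ∀ {x y} → x ≋ y → - x ≋ - y
-‿cong {x} {y} ⟪ p ⟫ = ⟪ (λ ε 0<ε → let (N , h) = p ε 0<ε in N , λ n le →
  subst (ℚ._< ε) (sym (trans (cong ∣_∣ (minus-neg (seq x n) (seq y n))) (ℚ.∣-p∣≡∣p∣ (seq x n ℚ.- seq y n)))) (h n le)) ⟫

-- The threshold ε / B for c suffices. `*-cong` applies this to both terms of xu - yv = x(u - v) +
-- v(x - y).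
bounded-*-null : ∀ (a c : ℕ → ℚ) → ∃[ B ] (0ℚ ℚ.< B × ∃[ N ] (∀ n → N ℕ.≤ n → ∣ a n ∣ ℚ.≤ B)) →
  (∀ ε → 0ℚ ℚ.< ε → ∃[ N ] (∀ n → N ℕ.≤ n → ∣ c n ∣ ℚ.< ε)) →
  ∀ ε → 0ℚ ℚ.< ε → ∃[ N ] (∀ n → N ℕ.≤ n → ∣ a n ℚ.* c n ∣ ℚ.< ε)
bounded-*-null a c (B , 0<B , M , b) null ε 0<ε = M ℕ.⊔ N , λ n le →
  subst₂ ℚ._<_ (sym (ℚ.∣p*q∣≡∣p∣*∣q∣ (a n) (c n))) B*η≡ε
    (*-mono-≤-< (ℚ.0≤∣p∣ (c n)) 0<B (b n (ℕ.≤-trans (ℕ.m≤m⊔n M N) le)) (h n (ℕ.≤-trans (ℕ.m≤n⊔m M N) le)))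
  where
  instance
    B-pos : ℚ.Positive B
    B-pos = ℚ.positive 0<B
    B≢0 : ℚ.NonZero B
    B≢0 = ℚ.pos⇒nonZero B
  η : ℚ
  η = ℚ.1/ B ℚ.* ε
  0<η : 0ℚ ℚ.< η
  0<η = ℚ.positive⁻¹ η {{ℚ.pos*pos⇒pos (ℚ.1/ B) {{ℚ.1/pos⇒pos B}} ε {{ℚ.positive 0<ε}}}}
  N : ℕ
  N = proj₁ (null η 0<η)
  h : ∀ n → N ℕ.≤ n → ∣ c n ∣ ℚ.< η
  h = proj₂ (null η 0<η)
  B*η≡ε : B ℚ.* η ≡ ε
  B*η≡ε = trans (sym (ℚ.*-assoc B (ℚ.1/ B) ε)) (trans (cong (ℚ._* ε) (ℚ.*-inverseʳ B)) (ℚ.*-identityˡ ε))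

*-cong : ∀ {x y u v} → x ≋ y → u ≋ v → x * u ≋ y * v
*-cong {x} {y} {u} {v} ⟪ p ⟫ ⟪ q ⟫ = ⟪ (λ ε 0<ε →
  let (M , g) = bounded-*-null (seq x) (λ n → seq u n ℚ.- seq v n) (bounded x) q (½ ℚ.* ε) (0<½* 0<ε)
      (N , h) = bounded-*-null (seq v) (λ n → seq x n ℚ.- seq y n) (bounded v) p (½ ℚ.* ε) (0<½* 0<ε)
  in M ℕ.⊔ N , λ n le → subst₂ ℚ._<_ (cong ∣_∣ (*-split (seq x n) (seq y n) (seq u n) (seq v n))) (halves ε)
    (ℚ.≤-<-trans (ℚ.∣p+q∣≤∣p∣+∣q∣ (seq x n ℚ.* (seq u n ℚ.- seq v n)) (seq v n ℚ.* (seq x n ℚ.- seq y n)))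
      (ℚ.+-mono-< (g n (ℕ.≤-trans (ℕ.m≤m⊔n M N) le)) (h n (ℕ.≤-trans (ℕ.m≤n⊔m M N) le))))) ⟫

*-zeroʳ : ∀ x → x * 0ℝ ≋ 0ℝ
*-zeroʳ x = pointwise λ n → ℚ.*-zeroʳ (seq x n)

-- For p ≠ q the choice ε = |p - q| would give |p - q| < |p - q|.
fromℚ-injective : ∀ {p q} → fromℚ p ≋ fromℚ q → p ≡ q
fromℚ-injective {p} {q} ⟪ eq ⟫ with p ℚ.≟ q
... | yes p≡q = p≡q
... | no  p≢q = contradiction (proj₂ (eq ∣ p ℚ.- q ∣ 0<∣∣) _ ℕ.≤-refl) (ℚ.<-irrefl refl)
  where
  0<∣∣ : 0ℚ ℚ.< ∣ p ℚ.- q ∣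
  0<∣∣ = ℚ.≰⇒> λ ∣∣≤0 → p≢q (trans (sym (add-back p q)) (trans
    (cong (ℚ._+ q) (ℚ.∣p∣≡0⇒p≡0 (p ℚ.- q) (ℚ.≤-antisym ∣∣≤0 (ℚ.0≤∣p∣ (p ℚ.- q))))) (ℚ.+-identityˡ q)))

0<⇒≢0 : ∀ {x} → 0ℝ < x → ¬ x ≋ 0ℝ
0<⇒≢0 {x} (ε , 0<ε , M , g) ⟪ eq ⟫ = ℚ.<-irrefl refl (ℚ.<-trans (h k (ℕ.m≤n⊔m M N)) ε<∣∣)
  where
  N k : ℕ
  N = proj₁ (eq ε 0<ε)
  h = proj₂ (eq ε 0<ε)
  k = M ℕ.⊔ N
  ε<x : ε ℚ.< seq x k
  ε<x = subst (ℚ._< seq x k) (ℚ.+-identityˡ ε) (g k (ℕ.m≤m⊔n M N))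
  ε<∣∣ : ε ℚ.< ∣ seq x k ℚ.- 0ℚ ∣
  ε<∣∣ = subst (ε ℚ.<_) (sym (trans (cong ∣_∣ (ℚ.+-identityʳ (seq x k))) (ℚ.0≤p⇒∣p∣≡p (ℚ.<⇒≤ (ℚ.<-trans 0<ε ε<x))))) ε<x

fromℚ-*-cancel : ∀ {q} → q ≢ 0ℚ → ∀ {x} → fromℚ q * x ≋ 0ℝ → x ≋ 0ℝ
fromℚ-*-cancel {q} q≢0 {x} eq = begin
  x                               ≈⟨ pointwise (λ n → trans (sym (ℚ.*-identityˡ (seq x n)))
                                       (trans (cong (ℚ._* seq x n) (sym (ℚ.*-inverseˡ q))) (ℚ.*-assoc (ℚ.1/ q) q (seq x n)))) ⟩
  fromℚ (ℚ.1/ q) * (fromℚ q * x)  ≈⟨ *-cong ≋-refl eq ⟩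
  fromℚ (ℚ.1/ q) * 0ℝ             ≈⟨ *-zeroʳ _ ⟩
  0ℝ                              ∎
  where
  open SetoidReasoning ≋-setoid
  instance
    q-nonZero : ℚ.NonZero q
    q-nonZero = ℚ.≢-nonZero q≢0

-- With M = n + 1 and e the integer root of dM², the error is (dM² - e²) / M². From dM² < (e + 1)²
-- the numerator is at most 2e, and e ≤ dM because d ≤ d². So the error is at most 2d / M.
√-square : ∀ d → √ d * √ d ≋ fromℚ (ι (+ d))
√-square d = ⟪ (λ ε 0<ε →
  let (N , h) = archimedean (η ε) (0<η ε 0<ε)
  in N , λ n N≤n → subst (ℚ._< ε) (sym (∣error∣ n)) (ℚ.≤-<-trans (error≤ n)
       (subst (ι (+ K) ℚ.* i n ℚ.<_) (K*η≡ε ε) (ℚ.*-monoʳ-<-pos (ι (+ K)) (h n N≤n))))) ⟫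
  where
  open ℕ.+-*-Solver using () renaming (solve to solveℕ; _:*_ to _⊠_; _:+_ to _⊞_; _:=_ to _≐_; con to conℕ)
  open ℚ.+-*-Solver
  -- One more than the bound 2d, so that `K` is positive for d = 0 too and ε / K makes sense.
  K : ℕ
  K = suc (2 ℕ.* d)

  instance
    K-pos : ℚ.Positive (ι (+ K))
    K-pos = ℚ.positive (ℚ.<-≤-trans (subst (0ℚ ℚ.<_) (sym ι-1) (ℚ.positive⁻¹ 1ℚ)) (ι-mono-≤ {1ℤ} {+ K} (ℤ.+≤+ (ℕ.s≤s ℕ.z≤n))))
    K≢0 : ℚ.NonZero (ι (+ K))
    K≢0 = ℚ.pos⇒nonZero (ι (+ K))

  η : ℚ → ℚ
  η ε = ℚ.1/ (ι (+ K)) ℚ.* ε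
  0<η : ∀ ε → 0ℚ ℚ.< ε → 0ℚ ℚ.< η ε
  0<η ε 0<ε = ℚ.positive⁻¹ (η ε) {{ℚ.pos*pos⇒pos (ℚ.1/ (ι (+ K))) {{ℚ.1/pos⇒pos (ι (+ K))}} ε {{ℚ.positive 0<ε}}}}
  K*η≡ε : ∀ ε → ι (+ K) ℚ.* η ε ≡ ε
  K*η≡ε ε = trans (sym (ℚ.*-assoc (ι (+ K)) (ℚ.1/ (ι (+ K))) ε)) (trans (cong (ℚ._* ε) (ℚ.*-inverseʳ (ι (+ K)))) (ℚ.*-identityˡ ε))

  i : ℕ → ℚ
  i n = + 1 ℚ./ suc n
  e δ : ℕ → ℕ
  e n = isqrt (d ℕ.* (suc n ℕ.* suc n))
  δ n = d ℕ.* (suc n ℕ.* suc n) ℕ.∸ e n ℕ.* e n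

  0≤i : ∀ n → 0ℚ ℚ.≤ i n
  0≤i n = ℚ.<⇒≤ (ℚ.positive⁻¹ (i n) {{ℚ.normalize-pos 1 (suc n)}})

  i*n≡1 : ∀ n → ι (+ suc n) ℚ.* i n ≡ 1ℚ
  i*n≡1 n = trans (sym (ι-/ (+ suc n) n)) (ℚ.fromℚᵘ-cong {ℚᵘ.mkℚᵘ (+ suc n) n} {ℚᵘ.1ℚᵘ} (ℚᵘ.*≡* (ℤ.*-comm (+ suc n) 1ℤ)))

  e≤dn : ∀ n → e n ℕ.≤ d ℕ.* suc n
  e≤dn n = ℕ.≮⇒≥ λ lt → ℕ.<⇒≱ (ℕ.*-mono-< lt lt) (ℕ.≤-trans (isqrt-lower (d ℕ.* (suc n ℕ.* suc n)))
    (subst (d ℕ.* (suc n ℕ.* suc n) ℕ.≤_) (solveℕ 2 (λ d n → d ⊠ d ⊠ (n ⊠ n) ≐ d ⊠ n ⊠ (d ⊠ n)) refl d (suc n))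
      (ℕ.*-monoˡ-≤ (suc n ℕ.* suc n) (d≤dd d))))
    where
    d≤dd : ∀ d → d ℕ.≤ d ℕ.* d
    d≤dd zero    = ℕ.z≤n
    d≤dd (suc d) = ℕ.m≤m*n (suc d) (suc d)

  δ≤ : ∀ n → δ n ℕ.≤ 2 ℕ.* d ℕ.* suc n
  δ≤ n = ℕ.m≤n+o⇒m∸n≤o (d ℕ.* (suc n ℕ.* suc n)) (e n ℕ.* e n) (ℕ.≤-trans
    (ℕ.≤-pred (subst (d ℕ.* (suc n ℕ.* suc n) ℕ.<_) (solveℕ 1 (λ e → (conℕ 1 ⊞ e) ⊠ (conℕ 1 ⊞ e) ≐ conℕ 1 ⊞ (e ⊠ e ⊞ conℕ 2 ⊠ e)) refl (e n))
      (isqrt-upper (d ℕ.* (suc n ℕ.* suc n)))))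
    (ℕ.+-monoʳ-≤ (e n ℕ.* e n) (subst (2 ℕ.* e n ℕ.≤_) (sym (ℕ.*-assoc 2 d (suc n))) (ℕ.*-monoʳ-≤ 2 (e≤dn n)))))

  error : ∀ n → ι (+ d) ℚ.- √-approx d n ℚ.* √-approx d n ≡ ι (+ δ n) ℚ.* (i n ℚ.* i n)
  error n = begin
    ι (+ d) ℚ.- √-approx d n ℚ.* √-approx d n
      ≡⟨ cong₂ (λ r s → r ℚ.- s ℚ.* s) (trans (sym (ℚ.*-identityʳ (ι (+ d)))) (cong₂ (λ r s → ι (+ d) ℚ.* (r ℚ.* s)) (sym (i*n≡1 n)) (sym (i*n≡1 n)))) (ι-/ (+ e n) n) ⟩
    ι (+ d) ℚ.* ((M ℚ.* i n) ℚ.* (M ℚ.* i n)) ℚ.- (E ℚ.* i n) ℚ.* (E ℚ.* i n)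
      ≡⟨ solve 4 (λ d M E i → d :* ((M :* i) :* (M :* i)) :- (E :* i) :* (E :* i) := (d :* (M :* M) :- E :* E) :* (i :* i)) refl (ι (+ d)) M E (i n) ⟩
    (ι (+ d) ℚ.* (M ℚ.* M) ℚ.- E ℚ.* E) ℚ.* (i n ℚ.* i n)
      ≡⟨ cong (λ s → (s ℚ.- E ℚ.* E) ℚ.* (i n ℚ.* i n)) total ⟩
    (E ℚ.* E ℚ.+ ι (+ δ n) ℚ.- E ℚ.* E) ℚ.* (i n ℚ.* i n)
      ≡⟨ cong (ℚ._* (i n ℚ.* i n)) (cancel-left (E ℚ.* E) (ι (+ δ n))) ⟩
    ι (+ δ n) ℚ.* (i n ℚ.* i n) ∎
    where
    open ≡-Reasoning
    M E : ℚ
    M = ι (+ suc n)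
    E = ι (+ e n)
    total : ι (+ d) ℚ.* (M ℚ.* M) ≡ E ℚ.* E ℚ.+ ι (+ δ n)
    total = begin
      ι (+ d) ℚ.* (M ℚ.* M)                  ≡⟨ cong (ι (+ d) ℚ.*_) (ι-* (+ suc n) (+ suc n)) ⟨
      ι (+ d) ℚ.* ι (+ suc n ℤ.* + suc n)    ≡⟨ ι-* (+ d) (+ suc n ℤ.* + suc n) ⟨
      ι (+ d ℤ.* (+ suc n ℤ.* + suc n))      ≡⟨ cong ι (ℤ.pos-* d (suc n ℕ.* suc n)) ⟨
      ι (+ (d ℕ.* (suc n ℕ.* suc n)))        ≡⟨ cong (λ s → ι (+ s)) (ℕ.m+[n∸m]≡n (isqrt-lower (d ℕ.* (suc n ℕ.* suc n)))) ⟨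
      ι (+ (e n ℕ.* e n ℕ.+ δ n))            ≡⟨ cong ι (ℤ.pos-+ (e n ℕ.* e n) (δ n)) ⟩
      ι (+ (e n ℕ.* e n) ℤ.+ + δ n)          ≡⟨ ι-+ (+ (e n ℕ.* e n)) (+ δ n) ⟩
      ι (+ (e n ℕ.* e n)) ℚ.+ ι (+ δ n)      ≡⟨ cong (λ s → ι s ℚ.+ ι (+ δ n)) (ℤ.pos-* (e n) (e n)) ⟩
      ι (+ e n ℤ.* + e n) ℚ.+ ι (+ δ n)      ≡⟨ cong (ℚ._+ ι (+ δ n)) (ι-* (+ e n) (+ e n)) ⟩
      E ℚ.* E ℚ.+ ι (+ δ n)                  ∎

  0≤ii : ∀ n → 0ℚ ℚ.≤ i n ℚ.* i n
  0≤ii n = ℚ.nonNegative⁻¹ (i n ℚ.* i n) {{ℚ.nonNeg*nonNeg⇒nonNeg (i n) {{ℚ.nonNegative (0≤i n)}} (i n) {{ℚ.nonNegative (0≤i n)}}}}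

  error≤ : ∀ n → ι (+ δ n) ℚ.* (i n ℚ.* i n) ℚ.≤ ι (+ K) ℚ.* i n
  error≤ n = ℚ.≤-trans
    (ℚ.*-monoʳ-≤-nonNeg (i n ℚ.* i n) {{ℚ.nonNegative (0≤ii n)}} (ι-mono-≤ {+ δ n} {+ (K ℕ.* suc n)}
      (ℤ.+≤+ (ℕ.≤-trans (δ≤ n) (ℕ.*-monoˡ-≤ (suc n) (ℕ.n≤1+n (2 ℕ.* d)))))))
    (ℚ.≤-reflexive (begin
      ι (+ (K ℕ.* suc n)) ℚ.* (i n ℚ.* i n)       ≡⟨ cong (λ s → ι s ℚ.* (i n ℚ.* i n)) (ℤ.pos-* K (suc n)) ⟩
      ι (+ K ℤ.* + suc n) ℚ.* (i n ℚ.* i n)       ≡⟨ cong (ℚ._* (i n ℚ.* i n)) (ι-* (+ K) (+ suc n)) ⟩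
      ι (+ K) ℚ.* ι (+ suc n) ℚ.* (i n ℚ.* i n)   ≡⟨ solve 3 (λ k m i → k :* m :* (i :* i) := k :* (m :* i :* i)) refl (ι (+ K)) (ι (+ suc n)) (i n) ⟩
      ι (+ K) ℚ.* (ι (+ suc n) ℚ.* i n ℚ.* i n)   ≡⟨ cong (λ s → ι (+ K) ℚ.* (s ℚ.* i n)) (i*n≡1 n) ⟩
      ι (+ K) ℚ.* (1ℚ ℚ.* i n)                    ≡⟨ cong (ι (+ K) ℚ.*_) (ℚ.*-identityˡ (i n)) ⟩
      ι (+ K) ℚ.* i n                             ∎))
    where open ≡-Reasoning

  ∣error∣ : ∀ n → ∣ √-approx d n ℚ.* √-approx d n ℚ.- ι (+ d) ∣ ≡ ι (+ δ n) ℚ.* (i n ℚ.* i n)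
  ∣error∣ n = trans (∣-∣-swap (ι (+ d)) (√-approx d n ℚ.* √-approx d n)) (trans (cong ∣_∣ (error n)) (ℚ.0≤p⇒∣p∣≡p
    (ℚ.nonNegative⁻¹ _ {{ℚ.nonNeg*nonNeg⇒nonNeg (ι (+ δ n)) {{ℚ.nonNegative (subst (ℚ._≤ ι (+ δ n)) ι-0 (ι-mono-≤ (ℤ.+≤+ ℕ.z≤n)))}} (i n ℚ.* i n) {{ℚ.nonNegative (0≤ii n)}}}})))

-- Designs and harmonic polynomials

-- These are the coefficients of α(x² - y²) + βxy. For z = x + iy the two parts are Re z² and half
-- of Im z², so together they capture z².
coeff : ℚ → ℚ → ℕ → ℕ → ℝ
coeff α β 2 0 = fromℚ α
coeff α β 0 2 = fromℚ (ℚ.- α)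
coeff α β 1 1 = fromℚ β
coeff α β _ _ = 0ℝ

harmonic : ℚ → ℚ → ℝ² → ℝ
harmonic α β = poly 2 (coeff α β)

harmonic-seq : ∀ α β x y k → seq (harmonic α β (x , y)) k ≡
  α ℚ.* (seq x k ℚ.* seq x k ℚ.- seq y k ℚ.* seq y k) ℚ.+ β ℚ.* (seq x k ℚ.* seq y k)
harmonic-seq α β x y k = identity α β (seq x k) (seq y k)
  where
  open ℚ.+-*-Solver
  -- The left side is `poly 2` evaluated term by term, with its zero coefficients, trivial powers
  -- and empty sums left in place.
  identity : ∀ α β x y →
    (0ℚ ℚ.* (1ℚ ℚ.* 1ℚ) ℚ.+ 0ℚ) ℚ.+ ((0ℚ ℚ.* (1ℚ ℚ.* (y ℚ.* 1ℚ)) ℚ.+ (0ℚ ℚ.* ((x ℚ.* 1ℚ) ℚ.* 1ℚ) ℚ.+ 0ℚ)) ℚ.+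
      (((ℚ.- α) ℚ.* (1ℚ ℚ.* (y ℚ.* (y ℚ.* 1ℚ))) ℚ.+ (β ℚ.* ((x ℚ.* 1ℚ) ℚ.* (y ℚ.* 1ℚ)) ℚ.+ (α ℚ.* ((x ℚ.* (x ℚ.* 1ℚ)) ℚ.* 1ℚ) ℚ.+ 0ℚ))) ℚ.+ 0ℚ)) ≡
    α ℚ.* (x ℚ.* x ℚ.- y ℚ.* y) ℚ.+ β ℚ.* (x ℚ.* y)
  identity = solve 4 (λ α β x y →
    (con 0ℚ :* (con 1ℚ :* con 1ℚ) :+ con 0ℚ) :+ ((con 0ℚ :* (con 1ℚ :* (y :* con 1ℚ)) :+ (con 0ℚ :* ((x :* con 1ℚ) :* con 1ℚ) :+ con 0ℚ)) :+
      (((:- α) :* (con 1ℚ :* (y :* (y :* con 1ℚ))) :+ (β :* ((x :* con 1ℚ) :* (y :* con 1ℚ)) :+ (α :* ((x :* (x :* con 1ℚ)) :* con 1ℚ) :+ con 0ℚ))) :+ con 0ℚ)) :=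
    α :* (x :* x :- y :* y) :+ β :* (x :* y)) refl

sum-zero : ∀ k (h : ℕ → ℝ) n → (∀ j → seq (h j) k ≡ 0ℚ) → seq (sum (applyUpTo h n)) k ≡ 0ℚ
sum-zero k h zero    h≡0 = refl
sum-zero k h (suc n) h≡0 = trans (cong₂ ℚ._+_ (h≡0 0) (sum-zero k (h ∘ suc) n (h≡0 ∘ suc))) (ℚ.+-identityˡ 0ℚ)

riemannSum-zero : ∀ g → (∀ q k → seq (g q) k ≡ 0ℚ) → ∀ n k → seq (riemannSum g n) k ≡ 0ℚ
riemannSum-zero g g≡0 n k = sum-zero k (λ j → fromℚ (+ 1 ℚ./ suc n) * g (+ j ℚ./ suc n)) (suc n) λ j →
  trans (cong ((+ 1 ℚ./ suc n) ℚ.*_) (g≡0 (+ j ℚ./ suc n) k)) (ℚ.*-zeroʳ (+ 1 ℚ./ suc n))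

∣∣-<⁺ : ∀ {x ε} → x ℚ.< ε → ℚ.- x ℚ.< ε → ∣ x ∣ ℚ.< ε
∣∣-<⁺ {x} {ε} p q = [ (λ eq → subst (ℚ._< ε) (sym eq) p) , (λ eq → subst (ℚ._< ε) (sym eq) q) ]′ (ℚ.∣p∣≡p∨∣p∣≡-p x)

-- For each ε a single late term of u, being zero, already gives l - ε < 0 < l + ε.
limit-zero : ∀ (u : ℕ → ℝ) → (∀ n k → seq (u n) k ≡ 0ℚ) → ∀ {l} → u ⟶ l → l ≋ 0ℝ
limit-zero u u≡0 {l} lim = ⟪ (λ ε 0<ε → close ε (lim ε 0<ε)) ⟫
  where
  open ℚ.+-*-Solver
  close : ∀ ε → ∃[ N ] (∀ n → N ℕ.≤ n → (l - fromℚ ε < u n) × (u n < l + fromℚ ε)) →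
    ∃[ M ] (∀ k → M ℕ.≤ k → ∣ seq l k ℚ.- 0ℚ ∣ ℚ.< ε)
  close ε (N , h) = bound (h N ℕ.≤-refl)
    where
    bound : (l - fromℚ ε < u N) × (u N < l + fromℚ ε) → ∃[ M ] (∀ k → M ℕ.≤ k → ∣ seq l k ℚ.- 0ℚ ∣ ℚ.< ε)
    bound ((a , 0<a , A , f) , (b , 0<b , B , g)) = A ℕ.⊔ B , λ k le →
      let x = seq l k
          upper = ℚ.<-trans (subst (ℚ._< x ℚ.+ ℚ.- ε ℚ.+ a) (ℚ.+-identityʳ (x ℚ.+ ℚ.- ε)) (ℚ.+-monoʳ-< (x ℚ.+ ℚ.- ε) 0<a))
                    (subst (x ℚ.+ ℚ.- ε ℚ.+ a ℚ.<_) (u≡0 N k) (f k (ℕ.≤-trans (ℕ.m≤m⊔n A B) le)))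
          lower = ℚ.<-trans 0<b (subst (ℚ._< x ℚ.+ ε) (trans (cong (ℚ._+ b) (u≡0 N k)) (ℚ.+-identityˡ b)) (g k (ℕ.≤-trans (ℕ.m≤n⊔m A B) le)))
      in subst (λ s → ∣ s ∣ ℚ.< ε) (sym (ℚ.+-identityʳ x)) (∣∣-<⁺
        (subst₂ ℚ._<_ (solve 2 (λ x e → x :+ :- e :+ e := x) refl x ε) (ℚ.+-identityˡ ε) (ℚ.+-monoˡ-< ε upper))
        (subst₂ ℚ._<_ (ℚ.+-identityˡ (ℚ.- x)) (solve 2 (λ x e → x :+ e :+ :- x := e) refl x ε) (ℚ.+-monoˡ-< (ℚ.- x) lower)))

-- A quarter turn negates x² − y² and xy, so the integrand of the circle
-- integral vanishes identically.
harmonic-mean : ∀ α β {A} → HasCircleMean (harmonic α β) A → A ≋ 0ℝ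
harmonic-mean α β {A} (I , S , S>0 , ∫I , _ , A≃) = ≋-trans ⟪ A≃ ⟫ (≋-trans (*-cong (≋-refl {inv S S>0}) I≋0) (*-zeroʳ (inv S S>0)))
  where
  open ℚ.+-*-Solver
  cancel : ∀ α β s x y → s ℚ.* (
      (α ℚ.* (x ℚ.* x ℚ.- y ℚ.* y) ℚ.+ β ℚ.* (x ℚ.* y))
      ℚ.+ (α ℚ.* ((ℚ.- y) ℚ.* (ℚ.- y) ℚ.- x ℚ.* x) ℚ.+ β ℚ.* ((ℚ.- y) ℚ.* x))
      ℚ.+ (α ℚ.* ((ℚ.- x) ℚ.* (ℚ.- x) ℚ.- (ℚ.- y) ℚ.* (ℚ.- y)) ℚ.+ β ℚ.* ((ℚ.- x) ℚ.* (ℚ.- y)))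
      ℚ.+ (α ℚ.* ((ℚ.- (ℚ.- y)) ℚ.* (ℚ.- (ℚ.- y)) ℚ.- (ℚ.- x) ℚ.* (ℚ.- x)) ℚ.+ β ℚ.* ((ℚ.- (ℚ.- y)) ℚ.* (ℚ.- x)))) ≡ 0ℚ
  cancel = solve 5 (λ α β s x y → s :* (
      (α :* (x :* x :- y :* y) :+ β :* (x :* y))
      :+ (α :* ((:- y) :* (:- y) :- x :* x) :+ β :* ((:- y) :* x))
      :+ (α :* ((:- x) :* (:- x) :- (:- y) :* (:- y)) :+ β :* ((:- x) :* (:- y)))
      :+ (α :* ((:- (:- y)) :* (:- (:- y)) :- (:- x) :* (:- x)) :+ β :* ((:- (:- y)) :* (:- x)))) := con 0ℚ) refl

  turn₁ turn₂ turn₃ : ℝ² → ℝ²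
  turn₁ = quarterTurn
  turn₂ = quarterTurn ∘ turn₁
  turn₃ = quarterTurn ∘ turn₂

  vanishes : ∀ (s : ℝ) (p : ℝ²) k →
    seq (s * (harmonic α β p + harmonic α β (turn₁ p) + harmonic α β (turn₂ p) + harmonic α β (turn₃ p))) k ≡ 0ℚ
  vanishes s (x , y) k = trans
    (cong (seq s k ℚ.*_) (cong₂ ℚ._+_ (cong₂ ℚ._+_ (cong₂ ℚ._+_
      (harmonic-seq α β x y k) (harmonic-seq α β (- y) x k)) (harmonic-seq α β (- x) (- y) k)) (harmonic-seq α β (- (- y)) (- x) k)))
    (cancel α β (seq s k) (seq x k) (seq y k))

  I≋0 : I ≋ 0ℝ
  I≋0 = limit-zero (riemannSum g) (riemannSum-zero g (λ q → vanishes (arcSpeed q) (arc q))) ∫I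
    where
    g : ℚ → ℝ
    g q = arcSpeed q * (harmonic α β (arc q) + harmonic α β (turn₁ (arc q)) + harmonic α β (turn₂ (arc q)) + harmonic α β (turn₃ (arc q)))

∑-harmonic : ∀ {X} (fin : FiniteNonempty X) α β → HasCircleMean (harmonic α β) (FiniteNonempty.average fin (harmonic α β)) →
  sum (map (harmonic α β) (FiniteNonempty.first fin ∷ FiniteNonempty.rest fin)) ≋ 0ℝ
∑-harmonic fin α β mean = fromℚ-*-cancel {+ 1 ℚ./ suc (length (FiniteNonempty.rest fin))} 1/len≢0 (harmonic-mean α β mean)
  where
  1/len≢0 : + 1 ℚ./ suc (length (FiniteNonempty.rest fin)) ≢ 0ℚ
  1/len≢0 eq = ℚ.<-irrefl (sym eq) (ℚ.positive⁻¹ (+ 1 ℚ./ suc (length (FiniteNonempty.rest fin))) {{ℚ.normalize-pos 1 (suc (length (FiniteNonempty.rest fin)))}})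

-- Shells in the plane

infix 4 _≋²_

_≋²_ : ℝ² → ℝ² → Set
(x , y) ≋² (u , v) = x ≋ u × y ≋ v

wrap² : ∀ p q → p ≈² q → p ≋² q
wrap² _ _ (e , f) = ⟪ e ⟫ , ⟪ f ⟫

unwrap² : ∀ p q → p ≋² q → p ≈² q
unwrap² _ _ (e , f) = unwrap e , unwrap f

≋²-sym : ∀ {p q} → p ≋² q → q ≋² p
≋²-sym (e , f) = ≋-sym e , ≋-sym f

≋²-trans : ∀ {p q r} → p ≋² q → q ≋² r → p ≋² r
≋²-trans (e , f) (g , h) = ≋-trans e g , ≋-trans f h

·-cong : ∀ c {p q} → p ≋² q → c · p ≋² c · q
·-cong c (e , f) = *-cong ≋-refl e , *-cong ≋-refl f

∣∣²-cong : ∀ {p q} → p ≋² q → ∣ p ∣² ≋ ∣ q ∣²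
∣∣²-cong (e , f) = +-cong (*-cong e e) (*-cong f f)

∣·∣² : ∀ c p → ∣ c · p ∣² ≋ c * c * ∣ p ∣²
∣·∣² c (x , y) = pointwise λ k → solve 3 (λ c x y → c :* x :* (c :* x) :+ c :* y :* (c :* y) := c :* c :* (x :* x :+ y :* y)) refl (seq c k) (seq x k) (seq y k)
  where open ℚ.+-*-Solver

harmonic-cong : ∀ α β {p q} → p ≋² q → harmonic α β p ≋ harmonic α β q
harmonic-cong α β {p} {q} (e , f) = ≋-trans (formula p) (≋-trans
  (+-cong (*-cong ≋-refl (+-cong (*-cong e e) (-‿cong (*-cong f f)))) (*-cong ≋-refl (*-cong e f))) (≋-sym (formula q)))
  where
  formula : ∀ p → harmonic α β p ≋ fromℚ α * (proj₁ p * proj₁ p - proj₂ p * proj₂ p) + fromℚ β * (proj₁ p * proj₂ p)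
  formula (x , y) = pointwise (harmonic-seq α β x y)

pos≢0 : ∀ {p} → 0ℚ ℚ.< p → p ≢ 0ℚ
pos≢0 0<p refl = ℚ.<-irrefl refl 0<p

-- The lattice ℤ + ℤ(τ + σi), where τ = t/2 and τ² + σ² = n.
module Embedding (t n : ℤ) (D : ℕ) (disc : + 4 ℤ.* n ≡ t ℤ.* t ℤ.+ + D) (4<D : 4 ℕ.< D)
  (noSmallRoot : ∀ a → 2 ℕ.≤ a → 3 ℕ.* (a ℕ.* a) ℕ.≤ D → ¬ Imaginary.Root t n D disc 4<D a)
  (τ κ : ℚ) (2τ≡t : τ ℚ.+ τ ≡ ι t) (τ²+κ≡n : τ ℚ.* τ ℚ.+ κ ≡ ι n) (κ≢0 : κ ≢ 0ℚ)
  (σ : ℝ) (σ²≋κ : σ * σ ≋ fromℚ κ) where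

  open Order t n
  open Imaginary t n D disc 4<D
  open ClassNumberOne t n D disc 4<D noSmallRoot
  open ℚ.+-*-Solver

  embed : 𝕆 → ℝ²
  embed (x , y) = fromℤ x · (1ℝ , 0ℝ) +² fromℤ y · (fromℚ τ , σ)

  -- The imaginary part is recorded as a rational multiple of σ. The factor ½ is there because xy is
  -- half of Im z².
  re im½ : 𝕆 → ℚ
  re (x , y) = ι x ℚ.+ ι y ℚ.* τ
  im½ (x , y) = ½ ℚ.* ι y

  embed-coordinates : ∀ z → embed z ≋² (fromℚ (re z) , fromℚ (ι (proj₂ z)) * σ)
  embed-coordinates (x , y) =
    pointwise (λ k → trans (cong₂ (λ r s → r ℚ.* 1ℚ ℚ.+ s ℚ.* τ) (ι-def x) (ι-def y)) (cong (ℚ._+ ι y ℚ.* τ) (ℚ.*-identityʳ (ι x)))) ,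
    pointwise (λ k → trans (cong₂ (λ r s → r ℚ.* 0ℚ ℚ.+ s ℚ.* seq σ k) (ι-def x) (ι-def y))
      (trans (cong (ℚ._+ ι y ℚ.* seq σ k) (ℚ.*-zeroʳ (ι x))) (ℚ.+-identityˡ (ι y ℚ.* seq σ k))))

  opaque
    unfolding _⊗_

    ι-N : ∀ z → ι (N z) ≡ re z ℚ.* re z ℚ.+ ι (proj₂ z) ℚ.* ι (proj₂ z) ℚ.* κ
    ι-N (x , y) = begin
      ι (x ℤ.* x ℤ.+ t ℤ.* (x ℤ.* y) ℤ.+ n ℤ.* (y ℤ.* y))
        ≡⟨ trans (ι-+ _ _) (cong₂ ℚ._+_ (trans (ι-+ _ _) (cong₂ ℚ._+_ (ι-* x x) (trans (ι-* _ _) (cong (ι t ℚ.*_) (ι-* x y))))) (trans (ι-* _ _) (cong (ι n ℚ.*_) (ι-* y y)))) ⟩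
      ι x ℚ.* ι x ℚ.+ ι t ℚ.* (ι x ℚ.* ι y) ℚ.+ ι n ℚ.* (ι y ℚ.* ι y)
        ≡⟨ cong₂ (λ r s → ι x ℚ.* ι x ℚ.+ r ℚ.* (ι x ℚ.* ι y) ℚ.+ s ℚ.* (ι y ℚ.* ι y)) (sym 2τ≡t) (sym τ²+κ≡n) ⟩
      ι x ℚ.* ι x ℚ.+ (τ ℚ.+ τ) ℚ.* (ι x ℚ.* ι y) ℚ.+ (τ ℚ.* τ ℚ.+ κ) ℚ.* (ι y ℚ.* ι y)
        ≡⟨ solve 4 (λ x y τ κ → x :* x :+ (τ :+ τ) :* (x :* y) :+ (τ :* τ :+ κ) :* (y :* y) := (x :+ y :* τ) :* (x :+ y :* τ) :+ y :* y :* κ) refl (ι x) (ι y) τ κ ⟩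
      (ι x ℚ.+ ι y ℚ.* τ) ℚ.* (ι x ℚ.+ ι y ℚ.* τ) ℚ.+ ι y ℚ.* ι y ℚ.* κ ∎
      where open ≡-Reasoning

    ι-⊗₁ : ∀ x y → ι (proj₁ ((x , y) ⊗ (x , y))) ≡ ι x ℚ.* ι x ℚ.- (τ ℚ.* τ ℚ.+ κ) ℚ.* (ι y ℚ.* ι y)
    ι-⊗₁ x y = trans (ι-+ _ _) (cong₂ ℚ._+_ (ι-* x x) (trans (ι-neg _) (cong ℚ.-_ (trans (ι-* _ _) (cong₂ ℚ._*_ (sym τ²+κ≡n) (ι-* y y))))))

    ι-⊗₂ : ∀ x y → ι (proj₂ ((x , y) ⊗ (x , y))) ≡ ι x ℚ.* ι y ℚ.+ ι y ℚ.* ι x ℚ.+ (τ ℚ.+ τ) ℚ.* (ι y ℚ.* ι y)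
    ι-⊗₂ x y = trans (ι-+ _ _) (cong₂ ℚ._+_ (trans (ι-+ _ _) (cong₂ ℚ._+_ (ι-* x y) (ι-* y x))) (trans (ι-* _ _) (cong₂ ℚ._*_ (sym 2τ≡t) (ι-* y y))))

  re-⊗ : ∀ z → re (z ⊗ z) ≡ re z ℚ.* re z ℚ.- ι (proj₂ z) ℚ.* ι (proj₂ z) ℚ.* κ
  re-⊗ (x , y) = trans (cong₂ (λ r s → r ℚ.+ s ℚ.* τ) (ι-⊗₁ x y) (ι-⊗₂ x y))
    (solve 4 (λ x y τ κ → x :* x :- (τ :* τ :+ κ) :* (y :* y) :+ (x :* y :+ y :* x :+ (τ :+ τ) :* (y :* y)) :* τ :=
      (x :+ y :* τ) :* (x :+ y :* τ) :- y :* y :* κ) refl (ι x) (ι y) τ κ)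

  im½-⊗ : ∀ z → im½ (z ⊗ z) ≡ re z ℚ.* ι (proj₂ z)
  im½-⊗ (x , y) = trans (cong (½ ℚ.*_) (ι-⊗₂ x y))
    (solve 3 (λ x y τ → con ½ :* (x :* y :+ y :* x :+ (τ :+ τ) :* (y :* y)) := (x :+ y :* τ) :* y) refl (ι x) (ι y) τ)

  ∣embed∣² : ∀ z → ∣ embed z ∣² ≋ fromℚ (ι (N z))
  ∣embed∣² z@(x , y) = begin
    ∣ embed z ∣²                                       ≈⟨ ∣∣²-cong (embed-coordinates z) ⟩
    fromℚ u * fromℚ u + fromℚ v * σ * (fromℚ v * σ)    ≈⟨ pointwise (λ k → solve 3 (λ u v s → u :* u :+ v :* s :* (v :* s) := u :* u :+ v :* v :* (s :* s)) refl u v (seq σ k)) ⟩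
    fromℚ (u ℚ.* u) + fromℚ (v ℚ.* v) * (σ * σ)        ≈⟨ +-cong ≋-refl (*-cong ≋-refl σ²≋κ) ⟩
    fromℚ (u ℚ.* u) + fromℚ (v ℚ.* v) * fromℚ κ        ≈⟨ pointwise (λ k → sym (ι-N z)) ⟩
    fromℚ (ι (N z))                                    ∎
    where
    open SetoidReasoning ≋-setoid
    u v : ℚ
    u = re z
    v = ι y

  -- The quadratic polynomial at z is a linear form in w = z². This is that form; being additive, it
  -- turns a sum of values of the polynomial into one value at the sum of squares.
  square-part : ℚ → ℚ → 𝕆 → ℝ
  square-part α β w = fromℚ (α ℚ.* re w) + fromℚ (β ℚ.* im½ w) * σ

  harmonic-embed : ∀ α β c z → harmonic α β (c · embed z) ≋ c * c * square-part α β (z ⊗ z)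
  harmonic-embed α β c z@(x , y) = begin
    harmonic α β (c · embed z)
      ≈⟨ harmonic-cong α β (·-cong c (embed-coordinates z)) ⟩
    harmonic α β (c * fromℚ u , c * (fromℚ v * σ))
      ≈⟨ pointwise (λ k → trans (harmonic-seq α β (c * fromℚ u) (c * (fromℚ v * σ)) k) (regroup α β (seq c k) u v (seq σ k))) ⟩
    c * c * (fromℚ α * (fromℚ (u ℚ.* u) - fromℚ (v ℚ.* v) * (σ * σ)) + fromℚ (β ℚ.* (u ℚ.* v)) * σ)
      ≈⟨ *-cong ≋-refl (+-cong (*-cong ≋-refl (+-cong ≋-refl (-‿cong (*-cong ≋-refl σ²≋κ)))) ≋-refl) ⟩
    c * c * (fromℚ α * (fromℚ (u ℚ.* u) - fromℚ (v ℚ.* v) * fromℚ κ) + fromℚ (β ℚ.* (u ℚ.* v)) * σ)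
      ≈⟨ pointwise (λ k → cong₂ (λ r s → seq c k ℚ.* seq c k ℚ.* (α ℚ.* r ℚ.+ β ℚ.* s ℚ.* seq σ k)) (sym (re-⊗ z)) (sym (im½-⊗ z))) ⟩
    c * c * square-part α β (z ⊗ z) ∎
    where
    open SetoidReasoning ≋-setoid
    u v : ℚ
    u = re z
    v = ι y
    regroup : ∀ α β c u v s → α ℚ.* ((c ℚ.* u) ℚ.* (c ℚ.* u) ℚ.- (c ℚ.* (v ℚ.* s)) ℚ.* (c ℚ.* (v ℚ.* s))) ℚ.+ β ℚ.* ((c ℚ.* u) ℚ.* (c ℚ.* (v ℚ.* s))) ≡
      c ℚ.* c ℚ.* (α ℚ.* (u ℚ.* u ℚ.- v ℚ.* v ℚ.* (s ℚ.* s)) ℚ.+ β ℚ.* (u ℚ.* v) ℚ.* s)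
    regroup = solve 6 (λ α β c u v s → α :* ((c :* u) :* (c :* u) :- (c :* (v :* s)) :* (c :* (v :* s))) :+ β :* ((c :* u) :* (c :* (v :* s))) :=
      c :* c :* (α :* (u :* u :- v :* v :* (s :* s)) :+ β :* (u :* v) :* s)) refl

  square-part-⊕ : ∀ α β z w → square-part α β (z ⊕ w) ≋ square-part α β z + square-part α β w
  square-part-⊕ α β (x , y) (u , v) = pointwise λ k → trans
    (cong₂ (λ r s → α ℚ.* (r ℚ.+ s ℚ.* τ) ℚ.+ β ℚ.* (½ ℚ.* s) ℚ.* seq σ k) (ι-+ x u) (ι-+ y v))
    (solve 8 (λ α β x y u v τ s → α :* ((x :+ u) :+ (y :+ v) :* τ) :+ β :* (con ½ :* (y :+ v)) :* s :=
      α :* (x :+ y :* τ) :+ β :* (con ½ :* y) :* s :+ (α :* (u :+ v :* τ) :+ β :* (con ½ :* v) :* s)) refl α β (ι x) (ι y) (ι u) (ι v) τ (seq σ k))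

  square-part-0 : ∀ α β → square-part α β 0𝕆 ≋ 0ℝ
  square-part-0 α β = pointwise λ k → trans
    (cong (λ r → α ℚ.* (r ℚ.+ r ℚ.* τ) ℚ.+ β ℚ.* (½ ℚ.* r) ℚ.* seq σ k) ι-0)
    (solve 4 (λ α β τ s → α :* (con 0ℚ :+ con 0ℚ :* τ) :+ β :* (con ½ :* con 0ℚ) :* s := con 0ℚ) refl α β τ (seq σ k))

  -- (α, β) = (1, 0) isolates the real part and (0, 1) the multiple of σ. Multiplying the latter by
  -- σ replaces σ by the nonzero rational κ, so no inverse of σ is required.
  square-part-zero : ∀ w → (∀ α β → square-part α β w ≋ 0ℝ) → w ≡ 0𝕆
  square-part-zero w@(x , y) vanish = cong₂ _,_ x≡0 y≡0
    where
    open SetoidReasoning ≋-setoid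
    im-zero : fromℚ (im½ w) * σ ≋ 0ℝ
    im-zero = ≋-trans (pointwise (λ k → solve 3 (λ r i s → i :* s := con 0ℚ :* r :+ con 1ℚ :* i :* s) refl (re w) (im½ w) (seq σ k))) (vanish 0ℚ 1ℚ)
    κ*im≡0 : fromℚ κ * fromℚ (im½ w) ≋ 0ℝ
    κ*im≡0 = begin
      fromℚ κ * fromℚ (im½ w)   ≈⟨ *-cong (≋-sym σ²≋κ) ≋-refl ⟩
      σ * σ * fromℚ (im½ w)     ≈⟨ pointwise (λ k → solve 2 (λ s i → s :* s :* i := s :* (i :* s)) refl (seq σ k) (im½ w)) ⟩
      σ * (fromℚ (im½ w) * σ)   ≈⟨ *-cong ≋-refl im-zero ⟩
      σ * 0ℝ                    ≈⟨ *-zeroʳ σ ⟩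
      0ℝ                        ∎
    y≡0 : y ≡ 0ℤ
    y≡0 = ι-injective (trans (fromℚ-injective (fromℚ-*-cancel {½} (pos≢0 (ℚ.positive⁻¹ ½)) {fromℚ (ι y)}
      (≋-trans (pointwise (λ k → refl)) (fromℚ-*-cancel κ≢0 κ*im≡0)))) (sym ι-0))
    re≡0 : re w ≡ 0ℚ
    re≡0 = fromℚ-injective (≋-trans (pointwise (λ k → solve 3 (λ r i s → r := con 1ℚ :* r :+ con 0ℚ :* i :* s) refl (re w) (im½ w) (seq σ k))) (vanish 1ℚ 0ℚ))
    x≡0 : x ≡ 0ℤ
    x≡0 = ι-injective (trans (trans (sym (trans (cong (λ s → ι x ℚ.+ s ℚ.* τ) (trans (cong ι y≡0) ι-0))
      (trans (cong (ι x ℚ.+_) (ℚ.*-zeroˡ τ)) (ℚ.+-identityʳ (ι x))))) re≡0) (sym ι-0))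

  embed-injective : ∀ z w → embed z ≋² embed w → z ≡ w
  embed-injective z@(x , y) w@(u , v) eq = cong₂ _,_ x≡u y≡v
    where
    open SetoidReasoning ≋-setoid
    eq′ : (fromℚ (re z) , fromℚ (ι y) * σ) ≋² (fromℚ (re w) , fromℚ (ι v) * σ)
    eq′ = ≋²-trans (≋²-sym (embed-coordinates z)) (≋²-trans eq (embed-coordinates w))
    κ*Δ≡0 : fromℚ κ * fromℚ (ι y ℚ.- ι v) ≋ 0ℝ
    κ*Δ≡0 = begin
      fromℚ κ * fromℚ (ι y ℚ.- ι v)                ≈⟨ *-cong (≋-sym σ²≋κ) ≋-refl ⟩
      σ * σ * fromℚ (ι y ℚ.- ι v)                  ≈⟨ pointwise (λ k → solve 3 (λ s y v → s :* s :* (y :- v) := s :* (y :* s :- v :* s)) refl (seq σ k) (ι y) (ι v)) ⟩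
      σ * (fromℚ (ι y) * σ - fromℚ (ι v) * σ)      ≈⟨ *-cong ≋-refl (+-cong (proj₂ eq′) ≋-refl) ⟩
      σ * (fromℚ (ι v) * σ - fromℚ (ι v) * σ)      ≈⟨ pointwise (λ k → solve 2 (λ s v → s :* (v :* s :- v :* s) := con 0ℚ) refl (seq σ k) (ι v)) ⟩
      0ℝ                                           ∎
    y≡v : y ≡ v
    y≡v = ι-injective (trans (sym (add-back (ι y) (ι v)))
      (trans (cong (ℚ._+ ι v) (fromℚ-injective (fromℚ-*-cancel κ≢0 κ*Δ≡0))) (ℚ.+-identityˡ (ι v))))
    x≡u : x ≡ u
    x≡u = ι-injective (trans (sym (cancel-τ (ι x) (ι y))) (trans (cong₂ ℚ._-_ (fromℚ-injective (proj₁ eq′)) (cong (λ s → ι s ℚ.* τ) y≡v)) (cancel-τ (ι u) (ι v))))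
      where
      cancel-τ : ∀ x y → x ℚ.+ y ℚ.* τ ℚ.- y ℚ.* τ ≡ x
      cancel-τ x y = solve 2 (λ x s → x :+ s :- s := x) refl x (y ℚ.* τ)

  -- c is the reciprocal radius that carries the elements of norm M to the unit circle. The relation
  -- c²M = 1 provides cM as the inverse of c.
  module Matching (c : ℝ) (M : ℕ) (c²M≋1 : c * c * fromℚ (ι (+ M)) ≋ 1ℝ) where

    Match : ℝ² → 𝕆 → Set
    Match q z = q ≋² c · embed z

    c-cancel : ∀ x → c * c * x ≋ 0ℝ → x ≋ 0ℝ
    c-cancel x eq = begin
      x                                   ≈⟨ pointwise (λ k → sym (ℚ.*-identityˡ (seq x k))) ⟩
      1ℝ * x                              ≈⟨ *-cong (≋-sym c²M≋1) ≋-refl ⟩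
      c * c * fromℚ (ι (+ M)) * x         ≈⟨ pointwise (λ k → solve 3 (λ c m x → c :* c :* m :* x := m :* (c :* c :* x)) refl (seq c k) (ι (+ M)) (seq x k)) ⟩
      fromℚ (ι (+ M)) * (c * c * x)       ≈⟨ *-cong ≋-refl eq ⟩
      fromℚ (ι (+ M)) * 0ℝ                ≈⟨ *-zeroʳ _ ⟩
      0ℝ                                  ∎
      where open SetoidReasoning ≋-setoid

    c-injective : ∀ {x y} → c * x ≋ c * y → x ≋ y
    c-injective {x} {y} eq = begin
      x                                   ≈⟨ expand x ⟩
      c * fromℚ (ι (+ M)) * (c * x)       ≈⟨ *-cong ≋-refl eq ⟩
      c * fromℚ (ι (+ M)) * (c * y)       ≈⟨ expand y ⟨
      y                                   ∎
      where
      open SetoidReasoning ≋-setoid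
      expand : ∀ x → x ≋ c * fromℚ (ι (+ M)) * (c * x)
      expand x = begin
        x                                 ≈⟨ pointwise (λ k → sym (ℚ.*-identityˡ (seq x k))) ⟩
        1ℝ * x                            ≈⟨ *-cong (≋-sym c²M≋1) ≋-refl ⟩
        c * c * fromℚ (ι (+ M)) * x       ≈⟨ pointwise (λ k → solve 3 (λ c m x → c :* c :* m :* x := c :* m :* (c :* x)) refl (seq c k) (ι (+ M)) (seq x k)) ⟩
        c * fromℚ (ι (+ M)) * (c * x)     ∎

    match-injective : ∀ {q z w} → Match q z → Match q w → z ≡ w
    match-injective {q} {z} {w} qz qw = let (e , f) = ≋²-trans (≋²-sym qz) qw in embed-injective z w (c-injective e , c-injective f)

    sum-match : ∀ α β {L zs} → Pointwise Match L zs → sum (map (harmonic α β) L) ≋ c * c * square-part α β (∑² zs)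
    sum-match α β [] = ≋-sym (≋-trans (*-cong (≋-refl {c * c}) (square-part-0 α β)) (*-zeroʳ (c * c)))
    sum-match α β {q ∷ L} {z ∷ zs} (qz ∷ m) = begin
      harmonic α β q + sum (map (harmonic α β) L)
        ≈⟨ +-cong (≋-trans (harmonic-cong α β qz) (harmonic-embed α β c z)) (sum-match α β m) ⟩
      c * c * square-part α β (z ⊗ z) + c * c * square-part α β (∑² zs)
        ≈⟨ pointwise (λ k → sym (ℚ.*-distribˡ-+ (seq c k ℚ.* seq c k) (seq (square-part α β (z ⊗ z)) k) (seq (square-part α β (∑² zs)) k))) ⟩
      c * c * (square-part α β (z ⊗ z) + square-part α β (∑² zs))
        ≈⟨ *-cong ≋-refl (≋-sym (square-part-⊕ α β (z ⊗ z) (∑² zs))) ⟩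
      c * c * square-part α β (∑² (z ∷ zs)) ∎
      where open SetoidReasoning ≋-setoid

    choose : ∀ {P : 𝕆 → Set} L → All (λ q → ∃[ z ] (Match q z × P z)) L → ∃[ zs ] (Pointwise Match L zs × All P zs)
    choose []      []                   = [] , [] , []
    choose (q ∷ L) ((z , qz , Pz) ∷ qs) = let (zs , m , Ps) = choose L qs in z ∷ zs , qz ∷ m , Pz ∷ Ps

    match-unique : ∀ {L zs} → Pointwise Match L zs → Unique L → Uniqueˡ zs
    match-unique []       []       = []
    match-unique {q ∷ _} {z ∷ _} (qz ∷ m) (q∉ ∷ u) = distinct m q∉ ∷ match-unique m u
      where
      distinct : ∀ {L zs} → Pointwise Match L zs → All (λ q′ → ¬ q ≈² q′) L → All (z ≢_) zs
      distinct []        []         = []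
      distinct {q′ ∷ _} (qz′ ∷ m) (q≉ ∷ qs) = (λ { refl → q≉ (unwrap² q q′ (≋²-trans qz (≋²-sym qz′))) }) ∷ distinct m qs

    match-∈ : ∀ {L zs q z} → Pointwise Match L zs → q ∈ L → Match q z → z ∈ˡ zs
    match-∈ {q = q} (_∷_ {x = q′} q′w m) (here q≈q′) qz = here (match-injective qz (≋²-trans (wrap² q q′ q≈q′) q′w))
    match-∈ (_ ∷ m) (there q∈) qz = there (match-∈ m q∈ qz)

  Lattice : ℝ² → Set
  Lattice p = ∃[ x ] ∃[ y ] p ≈² (fromℤ x · (1ℝ , 0ℝ) +² fromℤ y · (fromℚ τ , σ))

  -- Each listed point of the design comes from an element of norm M, and these elements enumerate
  -- the whole shell. The design condition for all rational α and β forces their sum of squares to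
  -- be 0, against `∑²-shell≢0`.
  shell-not-2-design : ∀ m → 0ℝ < m → ∃ (Shell Lattice m) → ¬ SphericalDesign 2 (Shell Lattice m)
  shell-not-2-design m 0<m (p₀ , (x₀ , y₀ , p₀≈) , ∣p₀∣²≃m) (r , r>0 , _ , fin , onUnit , mean) =
    ∑²-shell≢0 M {{M≢0}} zs enumerates (z₀ , Nz₀) (square-part-zero (∑² zs) λ α β → c-cancel (square-part α β (∑² zs))
      (≋-trans (≋-sym (sum-match α β matching)) (∑-harmonic fin α β (mean (coeff α β)))))
    where
    open FiniteNonempty fin
    c : ℝ
    c = inv r r>0
    z₀ : 𝕆
    z₀ = x₀ , y₀
    M : ℕ
    M = proj₁ (N-natural z₀)
    Nz₀ : N z₀ ≡ + M
    Nz₀ = proj₂ (N-natural z₀)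

    norm≋m : ∀ p z → p ≈² embed z → ∣ p ∣² ≃ m → m ≋ fromℚ (ι (N z))
    norm≋m p z p≈ ∣p∣²≃m = ≋-trans (≋-sym ⟪ ∣p∣²≃m ⟫) (≋-trans (∣∣²-cong (wrap² p (embed z) p≈)) (∣embed∣² z))

    m≋M : m ≋ fromℚ (ι (+ M))
    m≋M = subst (λ s → m ≋ fromℚ (ι s)) Nz₀ (norm≋m p₀ z₀ p₀≈ ∣p₀∣²≃m)

    M≢0 : ℕ.NonZero M
    M≢0 = ℕ.≢-nonZero λ M≡0 → 0<⇒≢0 0<m (subst (λ s → m ≋ fromℚ s) (trans (cong (λ k → ι (+ k)) M≡0) ι-0) m≋M)

    -- The scaled point c · p₀ lies on the unit circle, and its squared length is c² |p₀|² = c² m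
    -- with m = M.
    c²M≋1 : c * c * fromℚ (ι (+ M)) ≋ 1ℝ
    c²M≋1 = ≋-trans (*-cong ≋-refl (≋-trans (≋-sym m≋M) (≋-sym ⟪ ∣p₀∣²≃m ⟫)))
      (≋-trans (≋-sym (∣·∣² c p₀)) ⟪ onUnit (c · p₀) (p₀ , ((x₀ , y₀ , p₀≈) , ∣p₀∣²≃m) , unwrap² (c · p₀) (c · p₀) (≋-refl , ≋-refl)) ⟫)

    open Matching c M c²M≋1

    points : List ℝ²
    points = first ∷ rest

    lattice-point : ∀ {q} → q ∈ points → ∃[ z ] (Match q z × HasNorm M z)
    lattice-point {q} q∈ = preimage (Equivalence.from (complete q) q∈)
      where
      preimage : scale c (Shell Lattice m) q → ∃[ z ] (Match q z × HasNorm M z)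
      preimage (p , ((x , y , p≈) , ∣p∣²≃m) , q≈) = (x , y) ,
        ≋²-trans (wrap² q (c · p) q≈) (·-cong c (wrap² p (embed (x , y)) p≈)) ,
        ι-injective (fromℚ-injective (≋-trans (≋-sym (norm≋m p (x , y) p≈ ∣p∣²≃m)) m≋M))

    chosen : ∃[ zs ] (Pointwise Match points zs × All (HasNorm M) zs)
    chosen = choose points (All.tabulateₛ ℝ²-setoid lattice-point)
    zs : List 𝕆
    zs = proj₁ chosen
    matching : Pointwise Match points zs
    matching = proj₁ (proj₂ chosen)

    scaled-shell : ∀ z → HasNorm M z → c · embed z ∈ points
    scaled-shell z Nz = Equivalence.to (complete (c · embed z)) (embed z ,
      ((proj₁ z , proj₂ z , unwrap² (embed z) (embed z) (≋-refl , ≋-refl)) ,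
        unwrap (≋-trans (∣embed∣² z) (≋-sym (subst (λ s → m ≋ fromℚ (ι s)) (sym Nz) m≋M)))) ,
      unwrap² (c · embed z) (c · embed z) (≋-refl , ≋-refl))

    enumerates : Enumerates (HasNorm M) zs
    enumerates = record
      { unique   = match-unique matching unique
      ; sound    = All.lookup (proj₂ (proj₂ chosen))
      ; complete = λ {z} Nz → match-∈ matching (scaled-shell z Nz) (≋-refl , ≋-refl)
      }

-- The seven discriminants

NoSmallRoot : (t n : ℤ) (D : ℕ) (disc : + 4 ℤ.* n ≡ t ℤ.* t ℤ.+ + D) (4<D : 4 ℕ.< D) → Set
NoSmallRoot t n D disc 4<D = (i : Fin 6) → 3 ℕ.* ((2 ℕ.+ toℕ i) ℕ.* (2 ℕ.+ toℕ i)) ℕ.≤ D → ¬ Imaginary.Root t n D disc 4<D (2 ℕ.+ toℕ i)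

noSmallRoot? : ∀ t n D disc 4<D → Dec (NoSmallRoot t n D disc 4<D)
noSmallRoot? t n D disc 4<D = Fin.all? λ i →
  (3 ℕ.* ((2 ℕ.+ toℕ i) ℕ.* (2 ℕ.+ toℕ i)) ℕ.≤? D) →-dec ¬? (Imaginary.root? t n D disc 4<D (2 ℕ.+ toℕ i))

-- From a = 8 on, 3a² is at least 192 and exceeds D, so the six values 2, ..., 7 are all there is to
-- check. The largest D that occurs is 163.
noSmallRoot⇒ : ∀ {t n D disc 4<D} → D ℕ.< 192 → NoSmallRoot t n D disc 4<D →
  ∀ a → 2 ℕ.≤ a → 3 ℕ.* (a ℕ.* a) ℕ.≤ D → ¬ Imaginary.Root t n D disc 4<D a
noSmallRoot⇒ {t} {n} {D} {disc} {4<D} D<192 none (suc (suc a)) _ small = subst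
  (λ k → 3 ℕ.* ((2 ℕ.+ k) ℕ.* (2 ℕ.+ k)) ℕ.≤ D → ¬ Imaginary.Root t n D disc 4<D (2 ℕ.+ k))
  (Fin.toℕ-fromℕ< a<6) (none (fromℕ< a<6)) small
  where
  a<6 : a ℕ.< 6
  a<6 = ℕ.≰⇒> λ 6≤a → ℕ.<⇒≱ D<192 (ℕ.≤-trans
    (ℕ.*-monoʳ-≤ 3 (ℕ.*-mono-≤ (ℕ.+-monoʳ-≤ 2 6≤a) (ℕ.+-monoʳ-≤ 2 6≤a))) small)
noSmallRoot⇒ _ _ zero ()
noSmallRoot⇒ _ _ (suc zero) (ℕ.s≤s ())

opaque
  unfolding Order._⊗_

  -- For d = 2 the data are t = 0, n = 2, D = 8; for the other d they are t = 1, n = (1 + d) / 4, D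
  -- = d. Up to D = 11 no a ≥ 2 satisfies 3a² ≤ D. For D = 163 the claim is that Euler's polynomial
  -- b² + b + 41 has no root modulo 2, ..., 7.
  noSmallRoot[2] : NoSmallRoot 0ℤ (+ 2) 8 refl (ℕ.m≤m+n 5 3)
  noSmallRoot[2] = toWitness {a? = noSmallRoot? 0ℤ (+ 2) 8 refl (ℕ.m≤m+n 5 3)} _

  noSmallRoot[7] : NoSmallRoot 1ℤ (+ 2) 7 refl (ℕ.m≤m+n 5 2)
  noSmallRoot[7] = toWitness {a? = noSmallRoot? 1ℤ (+ 2) 7 refl (ℕ.m≤m+n 5 2)} _

  noSmallRoot[11] : NoSmallRoot 1ℤ (+ 3) 11 refl (ℕ.m≤m+n 5 6)
  noSmallRoot[11] = toWitness {a? = noSmallRoot? 1ℤ (+ 3) 11 refl (ℕ.m≤m+n 5 6)} _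

  noSmallRoot[19] : NoSmallRoot 1ℤ (+ 5) 19 refl (ℕ.m≤m+n 5 14)
  noSmallRoot[19] = toWitness {a? = noSmallRoot? 1ℤ (+ 5) 19 refl (ℕ.m≤m+n 5 14)} _

  noSmallRoot[43] : NoSmallRoot 1ℤ (+ 11) 43 refl (ℕ.m≤m+n 5 38)
  noSmallRoot[43] = toWitness {a? = noSmallRoot? 1ℤ (+ 11) 43 refl (ℕ.m≤m+n 5 38)} _

  noSmallRoot[67] : NoSmallRoot 1ℤ (+ 17) 67 refl (ℕ.m≤m+n 5 62)
  noSmallRoot[67] = toWitness {a? = noSmallRoot? 1ℤ (+ 17) 67 refl (ℕ.m≤m+n 5 62)} _

  noSmallRoot[163] : NoSmallRoot 1ℤ (+ 41) 163 refl (ℕ.m≤m+n 5 158)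
  noSmallRoot[163] = toWitness {a? = noSmallRoot? 1ℤ (+ 41) 163 refl (ℕ.m≤m+n 5 158)} _

-- `L` is what `𝓞 D` computes to when -D ≡ 1 modulo 4. Here τ = ½, σ = ½ √D and κ = D / 4, so that
-- τ² + κ = (1 + D) / 4 = n.
half-integral-not-2-design : ∀ n D (disc : + 4 ℤ.* n ≡ 1ℤ ℤ.* 1ℤ ℤ.+ + D) 4<D → D ℕ.< 192 → NoSmallRoot 1ℤ n D disc 4<D →
  let L = λ p → ∃[ x ] ∃[ y ] p ≈² (fromℤ x · (1ℝ , 0ℝ) +² fromℤ y · (fromℚ ½ , fromℚ ½ * √ D)) in
  ∀ m → 0ℝ < m → ∃ (Shell L m) → ¬ SphericalDesign 2 (Shell L m)
half-integral-not-2-design n D disc 4<D D<192 none =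
  Embedding.shell-not-2-design 1ℤ n D disc 4<D (noSmallRoot⇒ {disc = disc} {4<D} D<192 none)
    ½ (½ ℚ.* ½ ℚ.* ι (+ D)) (sym ι-1) norm κ≢0 (fromℚ ½ * √ D) σ²
  where
  open ℚ.+-*-Solver
  ι-4 : ι (+ 4) ≡ 1ℚ ℚ.+ 1ℚ ℚ.+ 1ℚ ℚ.+ 1ℚ
  ι-4 = trans (ι-+ (+ 3) 1ℤ) (cong₂ ℚ._+_ (trans (ι-+ (+ 2) 1ℤ) (cong₂ ℚ._+_ (trans (ι-+ 1ℤ 1ℤ) (cong₂ ℚ._+_ ι-1 ι-1)) ι-1)) ι-1)

  4n : (1ℚ ℚ.+ 1ℚ ℚ.+ 1ℚ ℚ.+ 1ℚ) ℚ.* ι n ≡ 1ℚ ℚ.+ ι (+ D)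
  4n = trans (cong (ℚ._* ι n) (sym ι-4)) (trans (sym (ι-* (+ 4) n)) (trans (cong ι disc) (trans (ι-+ 1ℤ (+ D)) (cong (ℚ._+ ι (+ D)) ι-1))))

  norm : ½ ℚ.* ½ ℚ.+ ½ ℚ.* ½ ℚ.* ι (+ D) ≡ ι n
  norm = trans (solve 1 (λ d → con ½ :* con ½ :+ con ½ :* con ½ :* d := con ½ :* con ½ :* (con 1ℚ :+ d)) refl (ι (+ D)))
    (trans (cong (½ ℚ.* ½ ℚ.*_) (sym 4n))
      (solve 1 (λ n → con ½ :* con ½ :* ((con 1ℚ :+ con 1ℚ :+ con 1ℚ :+ con 1ℚ) :* n) := n) refl (ι n)))

  κ≢0 : ½ ℚ.* ½ ℚ.* ι (+ D) ≢ 0ℚ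
  κ≢0 eq = ℕ.<⇒≢ (ℕ.<-trans (ℕ.s≤s ℕ.z≤n) 4<D) (sym (ℤ.+-injective (ι-injective (trans
    (solve 1 (λ d → d := (con 1ℚ :+ con 1ℚ :+ con 1ℚ :+ con 1ℚ) :* (con ½ :* con ½ :* d)) refl (ι (+ D)))
    (trans (cong ((1ℚ ℚ.+ 1ℚ ℚ.+ 1ℚ ℚ.+ 1ℚ) ℚ.*_) eq) (sym ι-0))))))

  σ² : fromℚ ½ * √ D * (fromℚ ½ * √ D) ≋ fromℚ (½ ℚ.* ½ ℚ.* ι (+ D))
  σ² = begin
    fromℚ ½ * √ D * (fromℚ ½ * √ D)     ≈⟨ regroup (√ D) ⟩
    fromℚ (½ ℚ.* ½) * (√ D * √ D)       ≈⟨ *-cong ≋-refl (√-square D) ⟩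
    fromℚ (½ ℚ.* ½) * fromℚ (ι (+ D))   ≈⟨ pointwise (λ _ → refl) ⟩
    fromℚ (½ ℚ.* ½ ℚ.* ι (+ D))         ∎
    where
    open SetoidReasoning ≋-setoid
    regroup : ∀ s → fromℚ ½ * s * (fromℚ ½ * s) ≋ fromℚ (½ ℚ.* ½) * (s * s)
    regroup s = pointwise λ k → solve 1 (λ s → con ½ :* s :* (con ½ :* s) := con ½ :* con ½ :* (s :* s)) refl (seq s k)

ℤ[√-2]-not-2-design : ∀ m → 0ℝ < m → ∃ (Shell (𝓞 2) m) → ¬ SphericalDesign 2 (Shell (𝓞 2) m)
ℤ[√-2]-not-2-design = Embedding.shell-not-2-design 0ℤ (+ 2) 8 refl (ℕ.m≤m+n 5 3)
  (noSmallRoot⇒ {disc = refl} {ℕ.m≤m+n 5 3} (ℕ.m≤m+n 9 183) noSmallRoot[2])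
  0ℚ (ι (+ 2)) (sym ι-0) (ℚ.+-identityˡ (ι (+ 2))) (λ eq → contradiction (ι-injective {+ 2} {0ℤ} (trans eq (sym ι-0))) λ ()) (√ 2) (√-square 2)

theorem1p3 : (d : ℕ) → d ∈ˡ (2 ∷ 7 ∷ 11 ∷ 19 ∷ 43 ∷ 67 ∷ 163 ∷ []) →
    (m : ℝ) → 0ℝ < m → ∃ (Shell (𝓞 d) m) →
    ¬ SphericalDesign 2 (Shell (𝓞 d) m)
theorem1p3 _ (here refl) = ℤ[√-2]-not-2-design
theorem1p3 _ (there (here refl)) =
  half-integral-not-2-design (+ 2) 7 refl (ℕ.m≤m+n 5 2) (ℕ.m≤m+n 8 184) noSmallRoot[7]
theorem1p3 _ (there (there (here refl))) =
  half-integral-not-2-design (+ 3) 11 refl (ℕ.m≤m+n 5 6) (ℕ.m≤m+n 12 180) noSmallRoot[11]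
theorem1p3 _ (there (there (there (here refl)))) =
  half-integral-not-2-design (+ 5) 19 refl (ℕ.m≤m+n 5 14) (ℕ.m≤m+n 20 172) noSmallRoot[19]
theorem1p3 _ (there (there (there (there (here refl))))) =
  half-integral-not-2-design (+ 11) 43 refl (ℕ.m≤m+n 5 38) (ℕ.m≤m+n 44 148) noSmallRoot[43]
theorem1p3 _ (there (there (there (there (there (here refl)))))) =
  half-integral-not-2-design (+ 17) 67 refl (ℕ.m≤m+n 5 62) (ℕ.m≤m+n 68 124) noSmallRoot[67]
theorem1p3 _ (there (there (there (there (there (there (here refl))))))) =
  half-integral-not-2-design (+ 41) 163 refl (ℕ.m≤m+n 5 158) (ℕ.m≤m+n 164 28) noSmallRoot[163]
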